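{- Let $k,\ell\ge2$ be coprime integers, and let $\mathbf a\in\mathbb Z^{\mathbb N_0}$ be a sequence that is both $k$-regular and asymptotically $\ell$-regular. Then $\mathbf a\simeq\mathbf a'$ for some $k$-regular sequence $\mathbf a'\in\mathbb Z^{\mathbb N_0}$ that satisfies a linear recurrence, i.e. there exist $d\in\mathbb N$ and $t_1,\dots,t_d\in\mathbb Z$ with $a'_{n+d}=t_1a'_{n+d-1}+\dots+t_da'_n$ for all $n\in\mathbb N_0$.
   Context: For an integer $k\ge2$ and $\mathbf a=(a_n)_{n\ge0}\in\mathbb Z^{\mathbb N_0}$, the $k$-kernel is $\mathcal N_k(\mathbf a)=\{(a_{k^in+r})_{n=0}^\infty: i,r\in\mathbb N_0,\ r<k^i\}$ and $\mathcal M_k(\mathbf a)$ is the $\mathbb Z$-module (under pointwise operations) generated by $\mathcal N_k(\mathbf a)$. $\mathbf a$ is $k$-regular if $\mathcal M_k(\mathbf a)$ is finitely generated. Two sequences are asymptotically equal, $\mathbf a\simeq\mathbf b$, if $\frac1N\#\{0\le n<N:a_n\ne b_n\}\to0$. $\mathbf a$ is asymptotically $k$-regular if $\mathcal M_k(\mathbf a)/{\simeq}$ (the quotient by the submodule of sequences asymptotically equal to $0$) is finitely generated, equivalently there exist finitely many sequences $\mathbf a^{(0)},\dots,\mathbf a^{(d-1)}$ such that every $\mathbf b\in\mathcal M_k(\mathbf a)$ satisfies $\mathbf b\simeq t_0\mathbf a^{(0)}+\dots+t_{d-1}\mathbf a^{(d-1)}$ for some $t_j\in\mathbb Z$. -}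

module Defs where

open import Data.Nat using (ℕ; zero; suc; _^_; _<_; _≤_; _∸_) renaming (_+_ to _+ℕ_; _*_ to _*ℕ_)
open import Data.Integer using (ℤ; _+_; _*_; 0ℤ)
import Data.Integer as ℤ
open import Data.Fin using (Fin; zero; suc; toℕ)
open import Data.Product using (Σ; ∃; ∃-syntax; _×_)
open import Relation.Binary.PropositionalEquality using (_≡_)
open import Relation.Nullary using (yes; no)

Seq : Set
Seq = ℕ → ℤ

sumFin : (d : ℕ) → (Fin d → ℤ) → ℤ
sumFin zero    f = 0ℤ
sumFin (suc d) f = f zero + sumFin d (λ j → f (suc j))

_≐_ : Seq → Seq → Set
b ≐ c = ∀ n → b n ≡ c n

lincomb : (d : ℕ) → (Fin d → ℤ) → (Fin d → Seq) → Seq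
lincomb d t g n = sumFin d (λ j → t j * g j n)

kernelSeq : ℕ → Seq → ℕ → ℕ → Seq
kernelSeq k a i r n = a ((k ^ i) *ℕ n +ℕ r)

InModule : ℕ → Seq → Seq → Set
InModule k a b =
  ∃[ m ] Σ (Fin m → ℤ) λ c → Σ (Fin m → ℕ) λ i → Σ (Fin m → ℕ) λ r →
    (∀ j → r j < k ^ i j) ×
    (b ≐ lincomb m c (λ j → kernelSeq k a (i j) (r j)))

IsRegular : ℕ → Seq → Set
IsRegular k a =
  ∃[ d ] Σ (Fin d → Seq) λ g →
    (∀ j → InModule k a (g j)) ×
    (∀ b → InModule k a b → ∃[ t ] (b ≐ lincomb d t g))

countDiff : ℕ → Seq → Seq → ℕ
countDiff zero    a b = zero
countDiff (suc N) a b with a N ℤ.≟ b N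
... | yes _ = countDiff N a b
... | no  _ = suc (countDiff N a b)

-- asymptotic equality: (1/N) #{n < N : a_n ≠ b_n} → 0,
-- i.e. for every m, eventually m · #{…} ≤ N  (ε = 1/m)
_≃ₐ_ : Seq → Seq → Set
a ≃ₐ b = ∀ (m : ℕ) → ∃[ N₀ ] ∀ N → N₀ ≤ N → m *ℕ countDiff N a b ≤ N

-- asymptotically k-regular (the equivalent formulation from the paper):
-- finitely many sequences a⁽⁰⁾,…,a⁽ᵈ⁻¹⁾ such that every b ∈ M_k(a)
-- is asymptotically equal to some ℤ-linear combination of them
IsAsymptoticallyRegular : ℕ → Seq → Set
IsAsymptoticallyRegular k a =
  ∃[ d ] Σ (Fin d → Seq) λ g →
    ∀ b → InModule k a b → ∃[ t ] (b ≃ₐ lincomb d t g)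

-- a' satisfies a linear recurrence:
-- a'_{n+d} = t₁ a'_{n+d-1} + … + t_d a'_n   (t indexed by Fin d, t (j) = t_{j+1})
SatisfiesLinearRecurrence : Seq → Set
SatisfiesLinearRecurrence a' =
  ∃[ d ] Σ (Fin d → ℤ) λ t → ∀ n →
    a' (n +ℕ d) ≡ sumFin d (λ (j : Fin d) → t j * a' ((n +ℕ d) ∸ suc (toℕ j)))

{-# OPTIONS --safe #-}

-- Let V generate M_k(a), so that V(kn+r) = M_r V(n), and let E be the shift.
--
-- (1) Modulo ≃ the sequences V(ℓ^e n + x) span a module of finite rank, so a nonzero polynomial p
-- satisfies p(D) V ≃ 0, where D b(n) = b(ℓn). If ℓ^{e₀} is the scale given by the order of vanishing
-- of p at 0, then a combination b of V that vanishes almost everywhere on ℓ^E ℕ, E ≥ e₀, already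
-- vanishes almost everywhere on Q ℕ, Q = ℓ^{e₀}. Likewise some relation Σ c_h V(n + hQ) ≃ 0 holds
-- along r + ℓ^E ℕ for all r < Q. Writing n = k^i m + y with y ≡ r mod ℓ^E, which almost every
-- n ≡ r mod Q admits since k and ℓ are coprime, its left side becomes such a b(m) with Q ∣ m;
-- hence the relation P(E^Q) V ≃ 0 holds without restriction.
--
-- (2) The recursion V(kn+r) = M_r V(n) yields P(E^{Q k^i}) V ≃ 0 for all i. Divided differences turn
-- this into ∏_{i<j} (E^{Q k^j} - E^{Q k^i}) V ≃ 0, hence (E^q - 1)^N a ≃ 0 for some q and N.
--
-- (3) If b is k-regular, asymptotically ℓ-regular and b(n+1) ≃ b(n), then b ≃ const: by regularity b
-- is constant on the intervals [k^L m, k^L (m+1)) for some m, and a relation Σ c_h b(A^{d-h} B^h n) ≃ 0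
-- with A < B close together and of the form k^β ℓ^α stretches these intervals by the factor B/A until
-- they cover everything. By induction on N, a is almost everywhere polynomial on each class mod q.

module Submission where

open import Defs
open import Data.Nat using (ℕ; _≤_)
open import Data.Nat.Coprimality using (Coprime)
open import Data.Product using (Σ; ∃; ∃-syntax; _×_)

open import Data.Bool using (Bool; true; false; _∨_; not)
open import Data.Empty using (⊥-elim)
open import Data.Fin as Fin using (Fin; zero; suc; toℕ; fromℕ<; punchIn; punchOut; remQuot; combine; splitAt; _↑ˡ_; _↑ʳ_)
open import Data.Fin.Properties using (any?; punchIn-punchOut; pigeonhole; remQuot-combine; toℕ<n; toℕ-fromℕ<; toℕ-injective)
open import Data.Integer as ℤ using (ℤ; 0ℤ; 1ℤ)
import Data.Integer.Properties as ℤ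
import Data.Integer.Tactic.RingSolver as ℤ-Solver
open import Data.List using (List; []; _∷_; map; length)
open import Data.List.Membership.Propositional using (_∈_)
open import Data.List.Properties using (length-map)
open import Data.List.Relation.Unary.All using (All; []; _∷_)
open import Data.List.Relation.Unary.AllPairs using (AllPairs; []; _∷_)
open import Data.List.Relation.Unary.Any using (here; there)
open import Data.Nat as ℕ using (zero; suc; _<_; _^_; _⊔_; z≤n; s≤s; NonZero)
open import Data.Nat.Coprimality as Coprime using (coprime-divisor; coprime-Bézout)
open import Data.Nat.Divisibility using (_∣_; _∣?_; divides; ∣-refl; ∣-trans; m∣m*n; n∣m*n; ∣m+n∣m⇒∣n)
import Data.Nat.DivMod as ℕ
open import Data.Nat.GCD using (module Bézout)
import Data.Nat.Properties as ℕ
import Data.Nat.Tactic.RingSolver as ℕ-Solver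
open import Data.Product using (_,_; proj₁; proj₂)
open import Data.Sum using (_⊎_; inj₁; inj₂)
open import Data.Unit using (⊤; tt)
open import Data.Vec.Functional using (_++_)
open import Data.Vec.Functional.Properties using (lookup-++ˡ; lookup-++ʳ)
open import Relation.Binary using (tri<; tri≈; tri>)
open import Relation.Binary.PropositionalEquality using (_≡_; _≢_; refl; sym; trans; cong; cong₂; subst; subst₂)
open import Relation.Nullary using (¬_; Dec; yes; no; does; ¬?)
open import Relation.Nullary.Decidable using (decidable-stable; _→-dec_)

-- The delicate point of (1) is the order of choices. Counting yields a relation between shifts only
-- if there are more shifts than (number of sequences served) × rank, and all offsets must stay
-- below the scale ℓ^E at which finite rank is used. Serving every residue mod ℓ^E would be
-- circular. The circle breaks because Q comes from the scaling relation alone, before E: only the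
-- residues r < Q are served, their number does not grow with E, and the other residues are
-- recovered since a null statement on ℓ^E ℕ improves to one on Q ℕ. In (3) the order is m, then the
-- rank, then A and B: the rank of the dilates b(k^β ℓ^α n) does not depend on β and α, so B/A can
-- be taken close to 1 relative to both. The induction subtracts integer-valued polynomials, so it
-- runs over a class 𝒞 closed under sums, differences and affine substitution rather than over
-- regular sequences. That the resulting quasi-polynomial is k-regular is a matter of rigidity: two
-- quasi-polynomials that agree almost everywhere are equal, so relations in M_k(a) carry over.

module Naturals where
  open import Data.Nat using (_+_; _*_; _∸_; _/_; _%_)
  open import Data.Nat.DivMod using (m≡m%n+[m/n]*n; m%n<n; [m+kn]%n≡m%n; m<n⇒m%n≡m; +-distrib-/; m<n⇒m/n≡0; m*n/n≡m; m/n≤m)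
  open ℕ-Solver using (solve-∀)

  -- Density

  sumℕ : ℕ → (ℕ → ℕ) → ℕ
  sumℕ zero    f = 0
  sumℕ (suc N) f = f N + sumℕ N f

  sumℕ-mono : ∀ N {f g} → (∀ n → n < N → f n ≤ g n) → sumℕ N f ≤ sumℕ N g
  sumℕ-mono zero    f≤g = z≤n
  sumℕ-mono (suc N) f≤g = ℕ.+-mono-≤ (f≤g N ℕ.≤-refl) (sumℕ-mono N λ n n<N → f≤g n (ℕ.m<n⇒m<1+n n<N))

  sumℕ-cong : ∀ N {f g} → (∀ n → n < N → f n ≡ g n) → sumℕ N f ≡ sumℕ N g
  sumℕ-cong N eq = ℕ.≤-antisym (sumℕ-mono N λ n n<N → ℕ.≤-reflexive (eq n n<N))
                               (sumℕ-mono N λ n n<N → ℕ.≤-reflexive (sym (eq n n<N)))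

  sumℕ-+ : ∀ N f g → sumℕ N (λ n → f n + g n) ≡ sumℕ N f + sumℕ N g
  sumℕ-+ zero    f g = refl
  sumℕ-+ (suc N) f g rewrite sumℕ-+ N f g = interchange (f N) (g N) _ _
    where
    interchange : ∀ a b x y → (a + b) + (x + y) ≡ (a + x) + (b + y)
    interchange = solve-∀

  sumℕ-* : ∀ N c f → sumℕ N (λ n → c * f n) ≡ c * sumℕ N f
  sumℕ-* zero    c f = sym (ℕ.*-zeroʳ c)
  sumℕ-* (suc N) c f rewrite sumℕ-* N c f = sym (ℕ.*-distribˡ-+ c (f N) (sumℕ N f))

  sumℕ-const : ∀ N c → sumℕ N (λ _ → c) ≡ N * c
  sumℕ-const zero    c = refl
  sumℕ-const (suc N) c = cong (c +_) (sumℕ-const N c)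

  sumℕ-append : ∀ N M f → sumℕ (N + M) f ≡ sumℕ N (λ n → f (n + M)) + sumℕ M f
  sumℕ-append zero    M f = refl
  sumℕ-append (suc N) M f = trans (cong (f (N + M) +_) (sumℕ-append N M f)) (sym (ℕ.+-assoc (f (N + M)) _ _))

  sumℕ-residues : ∀ K N f → sumℕ (N * K) f ≡ sumℕ K (λ s → sumℕ N (λ n → f (n * K + s)))
  sumℕ-residues K zero    f = sym (trans (sumℕ-const K 0) (ℕ.*-zeroʳ K))
  sumℕ-residues K (suc N) f =
    trans (sumℕ-append K (N * K) f)
   (trans (cong₂ _+_ (sumℕ-cong K (λ s _ → cong f (ℕ.+-comm s (N * K)))) (sumℕ-residues K N f))
          (sym (sumℕ-+ K (λ s → f (N * K + s)) (λ s → sumℕ N (λ n → f (n * K + s))))))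

  sumℕ-except : ∀ K {f} w B b → w < suc K → (∀ s → s < suc K → f s ≤ B) → f w ≤ b →
    sumℕ (suc K) f ≤ K * B + b
  sumℕ-except K {f} w B b w<K f≤B fw≤b with w ℕ.≟ K
  ... | yes refl = subst (f w + sumℕ w f ≤_) (ℕ.+-comm b (w * B))
        (ℕ.+-mono-≤ fw≤b (ℕ.≤-trans (sumℕ-mono w λ s s<w → f≤B s (ℕ.m<n⇒m<1+n s<w)) (ℕ.≤-reflexive (sumℕ-const w B))))
  sumℕ-except zero    w B b (s≤s z≤n) f≤B fw≤b | no w≢K = ⊥-elim (w≢K refl)
  sumℕ-except (suc K) {f} w B b w<K f≤B fw≤b | no w≢K =
    subst (sumℕ (suc (suc K)) f ≤_) (sym (ℕ.+-assoc B (K * B) b))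
      (ℕ.+-mono-≤ (f≤B (suc K) ℕ.≤-refl)
        (sumℕ-except K w B b (ℕ.≤∧≢⇒< (ℕ.≤-pred w<K) w≢K) (λ s s<K → f≤B s (ℕ.m<n⇒m<1+n s<K)) fw≤b))

  bit : Bool → ℕ
  bit true  = 1
  bit false = 0

  bit≤1 : ∀ b → bit b ≤ 1
  bit≤1 true  = ℕ.≤-refl
  bit≤1 false = z≤n

  count : (ℕ → Bool) → ℕ → ℕ
  count Z N = sumℕ N (λ n → bit (Z n))

  count≤ : ∀ Z N → count Z N ≤ N
  count≤ Z N = ℕ.≤-trans (sumℕ-mono N (λ n _ → bit≤1 (Z n)))
    (ℕ.≤-reflexive (trans (sumℕ-const N 1) (ℕ.*-identityʳ N)))

  count-append : ∀ Z {M N} → M ≤ N → count Z M ≤ count Z N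
  count-append Z {M} {N} M≤N = subst (λ k → count Z M ≤ count Z k) (ℕ.m∸n+n≡m M≤N)
    (ℕ.≤-trans (ℕ.m≤n+m _ _) (ℕ.≤-reflexive (sym (sumℕ-append (N ∸ M) M (λ n → bit (Z n))))))

  Null : (ℕ → Bool) → Set
  Null Z = ∀ m → ∃[ N₀ ] ∀ N → N₀ ≤ N → m * count Z N ≤ N

  -- The exceptional set is Boolean, so that finitely many exceptions can be avoided constructively by
  -- search even when P itself is undecidable.
  AE : (ℕ → Set) → Set
  AE P = Σ (ℕ → Bool) λ Z → Null Z × (∀ n → Z n ≡ false → P n)

  Null-⊆ : ∀ {Z Z′} → (∀ n → bit (Z n) ≤ bit (Z′ n)) → Null Z′ → Null Z
  Null-⊆ sub null m with null m
  ... | N₀ , h = N₀ , λ N N₀≤N → ℕ.≤-trans (ℕ.*-monoʳ-≤ m (sumℕ-mono N λ n _ → sub n)) (h N N₀≤N)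

  Null-∨ : ∀ {Z Z′} → Null Z → Null Z′ → Null (λ n → Z n ∨ Z′ n)
  Null-∨ {Z} {Z′} null null′ m with null (2 * m) | null′ (2 * m)
  ... | N₁ , h₁ | N₂ , h₂ = N₁ ⊔ N₂ , λ N le → ℕ.*-cancelˡ-≤ 2 (begin
      2 * (m * count (λ n → Z n ∨ Z′ n) N)
        ≤⟨ ℕ.*-monoʳ-≤ 2 (ℕ.*-monoʳ-≤ m (ℕ.≤-trans (sumℕ-mono N λ n _ → bit-∨ (Z n) (Z′ n))
             (ℕ.≤-reflexive (sumℕ-+ N (λ n → bit (Z n)) (λ n → bit (Z′ n)))))) ⟩
      2 * (m * (count Z N + count Z′ N))
        ≡⟨ distribute m (count Z N) (count Z′ N) ⟩
      2 * m * count Z N + 2 * m * count Z′ N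
        ≤⟨ ℕ.+-mono-≤ (h₁ N (ℕ.≤-trans (ℕ.m≤m⊔n N₁ N₂) le)) (h₂ N (ℕ.≤-trans (ℕ.m≤n⊔m N₁ N₂) le)) ⟩
      N + N
        ≡⟨ cong (N +_) (sym (ℕ.+-identityʳ N)) ⟩
      2 * N ∎)
    where
    open ℕ.≤-Reasoning
    bit-∨ : ∀ a b → bit (a ∨ b) ≤ bit a + bit b
    bit-∨ true  b = s≤s z≤n
    bit-∨ false b = ℕ.≤-refl
    distribute : ∀ m x y → 2 * (m * (x + y)) ≡ 2 * m * x + 2 * m * y
    distribute = solve-∀

  AE-pure : ∀ {P} → (∀ n → P n) → AE P
  AE-pure p = (λ _ → false) , (λ m → 0 , λ N _ →
    subst (_≤ N) (sym (trans (cong (m *_) (trans (sumℕ-const N 0) (ℕ.*-zeroʳ N))) (ℕ.*-zeroʳ m))) z≤n) , λ n _ → p n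

  AE-map₂ : ∀ {P Q R : ℕ → Set} → (∀ n → P n → Q n → R n) → AE P → AE Q → AE R
  AE-map₂ f (Z , null , p) (Z′ , null′ , q) = (λ n → Z n ∨ Z′ n) , Null-∨ {Z} {Z′} null null′ , λ n e →
    f n (p n (proj₁ (split (Z n) (Z′ n) e))) (q n (proj₂ (split (Z n) (Z′ n) e)))
    where
    split : ∀ a b → a ∨ b ≡ false → a ≡ false × b ≡ false
    split false false e = refl , refl

  AE-map : ∀ {P Q : ℕ → Set} → (∀ n → P n → Q n) → AE P → AE Q
  AE-map f (Z , null , p) = Z , null , λ n e → f n (p n e)

  AE-∀Fin : ∀ d {P : Fin d → ℕ → Set} → (∀ j → AE (P j)) → AE (λ n → ∀ j → P j n)
  AE-∀Fin zero    ae = AE-pure λ n ()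
  AE-∀Fin (suc d) {P} ae = AE-map₂ {P zero} {λ n → ∀ j → P (suc j) n}
    (λ { n p q zero → p ; n p q (suc j) → q j }) (ae zero) (AE-∀Fin d (λ j → ae (suc j)))

  AE-∀< : ∀ K {P : ℕ → ℕ → Set} → (∀ s → s < K → AE (P s)) → AE (λ n → ∀ s → s < K → P s n)
  AE-∀< zero    ae = AE-pure λ n s ()
  AE-∀< (suc K) {P} ae = AE-map₂ {P K} {λ n → ∀ s → s < K → P s n} join
    (ae K ℕ.≤-refl) (AE-∀< K (λ s s<K → ae s (ℕ.m<n⇒m<1+n s<K)))
    where
    join : ∀ n → P K n → (∀ s → s < K → P s n) → ∀ s → s < suc K → P s n
    join n p q s s<K with s ℕ.≟ K
    ... | yes refl = p
    ... | no s≢K   = q s (ℕ.≤∧≢⇒< (ℕ.≤-pred s<K) s≢K)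

  -- The first N points a n + b lie below a N + b ≤ (a + b) N, so pulling back costs at most a
  -- factor a + b in density.
  AE-affine : ∀ {P} a b → 1 ≤ a → AE P → AE (λ n → P (a * n + b))
  AE-affine {P} a b 1≤a (Z , null , p) = (λ n → Z (a * n + b)) , null′ , λ n → p (a * n + b)
    where
    open ℕ.≤-Reasoning
    sub : ∀ N → count (λ n → Z (a * n + b)) N ≤ count Z (a * N + b)
    sub zero    = z≤n
    sub (suc N) = begin
      bit (Z (a * N + b)) + count (λ n → Z (a * n + b)) N ≤⟨ ℕ.+-monoʳ-≤ _ (sub N) ⟩
      count Z (suc (a * N + b)) ≤⟨ count-append Z (begin
        1 + (a * N + b) ≤⟨ ℕ.+-monoˡ-≤ (a * N + b) 1≤a ⟩
        a + (a * N + b) ≡⟨ sym (ℕ.+-assoc a (a * N) b) ⟩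
        a + a * N + b   ≡⟨ cong (_+ b) (sym (ℕ.*-suc a N)) ⟩
        a * suc N + b   ∎) ⟩
      count Z (a * suc N + b) ∎
    null′ : Null (λ n → Z (a * n + b))
    null′ m with null (m * (a + b))
    ... | N₀ , h = suc N₀ , bound
      where
      bound : ∀ N → suc N₀ ≤ N → m * count (λ n → Z (a * n + b)) N ≤ N
      bound N@(suc _) le = ℕ.*-cancelˡ-≤ (a + b) {{ℕ.>-nonZero (ℕ.≤-trans 1≤a (ℕ.m≤m+n a b))}} (begin
        (a + b) * (m * count (λ n → Z (a * n + b)) N) ≤⟨ ℕ.*-monoʳ-≤ (a + b) (ℕ.*-monoʳ-≤ m (sub N)) ⟩
        (a + b) * (m * count Z (a * N + b))           ≡⟨ shuffle (a + b) m _ ⟩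
        m * (a + b) * count Z (a * N + b)             ≤⟨ h (a * N + b) N₀≤ ⟩
        a * N + b                                     ≤⟨ ℕ.+-monoʳ-≤ (a * N) (ℕ.m≤m*n b N) ⟩
        a * N + b * N                                 ≡⟨ sym (ℕ.*-distribʳ-+ N a b) ⟩
        (a + b) * N                                   ∎)
        where
        shuffle : ∀ x y z → x * (y * z) ≡ y * x * z
        shuffle = solve-∀
        N₀≤ : N₀ ≤ a * N + b
        N₀≤ = begin
          N₀        ≤⟨ ℕ.n≤1+n N₀ ⟩
          suc N₀    ≤⟨ le ⟩
          N         ≡⟨ sym (ℕ.*-identityˡ N) ⟩
          1 * N     ≤⟨ ℕ.*-monoˡ-≤ N 1≤a ⟩
          a * N     ≤⟨ ℕ.m≤m+n (a * N) b ⟩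
          a * N + b ∎

  AE-scale : ∀ {P} a → 1 ≤ a → AE P → AE (λ n → P (a * n))
  AE-scale {P} a 1≤a ae = AE-map (λ n → subst P (ℕ.+-identityʳ (a * n))) (AE-affine {P} a 0 1≤a ae)

  AE-shift : ∀ {P} m → AE P → AE (λ n → P (n + m))
  AE-shift {P} m ae = AE-map (λ n → subst (λ y → P (y + m)) (ℕ.*-identityˡ n)) (AE-affine {P} 1 m ℕ.≤-refl ae)

  eventually-∀< : ∀ K (Q : ℕ → ℕ → Set) → (∀ s → s < K → ∃[ N₀ ] ∀ N → N₀ ≤ N → Q s N) →
    ∃[ N₀ ] ∀ N → N₀ ≤ N → ∀ s → s < K → Q s N
  eventually-∀< zero    Q ev = 0 , λ N _ s ()
  eventually-∀< (suc K) Q ev with ev K ℕ.≤-refl | eventually-∀< K Q (λ s s<K → ev s (ℕ.m<n⇒m<1+n s<K))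
  ... | N₁ , h₁ | N₂ , h₂ = N₁ ⊔ N₂ , both
    where
    both : ∀ N → N₁ ⊔ N₂ ≤ N → ∀ s → s < suc K → Q s N
    both N le s s<K with s ℕ.≟ K
    ... | yes refl = h₁ N (ℕ.≤-trans (ℕ.m≤m⊔n N₁ N₂) le)
    ... | no s≢K   = h₂ N (ℕ.≤-trans (ℕ.m≤n⊔m N₁ N₂) le) s (ℕ.≤∧≢⇒< (ℕ.≤-pred s<K) s≢K)

  divMod-unique : ∀ q .{{_ : NonZero q}} n s → s < q → (n * q + s) / q ≡ n × (n * q + s) % q ≡ s
  divMod-unique q n s s<q =
    trans (cong (_/ q) (ℕ.+-comm (n * q) s))
   (trans (+-distrib-/ s (n * q) (subst (_< q) (sym rems) s<q))
          (cong₂ _+_ (m<n⇒m/n≡0 s<q) (m*n/n≡m n q))) ,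
    trans (cong (_% q) (ℕ.+-comm (n * q) s)) (trans ([m+kn]%n≡m%n s n q) (m<n⇒m%n≡m s<q))
    where
    rems : s % q + n * q % q ≡ s
    rems = trans (cong₂ _+_ (m<n⇒m%n≡m s<q) (ℕ.m*n%n≡0 n q)) (ℕ.+-identityʳ s)

  N<[1+N/q]*q : ∀ N q .{{_ : NonZero q}} → N < suc (N / q) * q
  N<[1+N/q]*q N q = begin-strict
    N                   ≡⟨ m≡m%n+[m/n]*n N q ⟩
    N % q + N / q * q   <⟨ ℕ.+-monoˡ-< (N / q * q) (m%n<n N q) ⟩
    q + N / q * q       ∎
    where open ℕ.≤-Reasoning

  AE-residues : ∀ q .{{_ : NonZero q}} {P} → (∀ r → r < q → AE (λ n → P (n * q + r))) → AE P
  AE-residues q {P} ae = Z , null , λ n e →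
    subst P (trans (ℕ.+-comm (n / q * q) (n % q)) (sym (m≡m%n+[m/n]*n n q)))
            (proj₂ (proj₂ (ae′ (n % q))) (n / q) e (m%n<n n q))
    where
    open ℕ.≤-Reasoning
    ae′ : ∀ r → AE (λ n → r < q → P (n * q + r))
    ae′ r with r ℕ.<? q
    ... | yes r<q = AE-map (λ _ p _ → p) (ae r r<q)
    ... | no r≮q  = AE-pure λ _ r<q → ⊥-elim (r≮q r<q)
    Zr : ℕ → ℕ → Bool
    Zr r = proj₁ (ae′ r)
    Z : ℕ → Bool
    Z n = Zr (n % q) (n / q)
    null : Null Z
    null m with eventually-∀< q (λ s M → 2 * m * q * count (Zr s) M ≤ M) (λ s _ → proj₁ (proj₂ (ae′ s)) (2 * m * q))
    ... | N₀ , h = suc (N₀ * q) , bound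
      where
      bound : ∀ N → suc (N₀ * q) ≤ N → m * count Z N ≤ N
      bound N@(suc _) le = ℕ.*-cancelˡ-≤ 2 (begin
        2 * (m * count Z N)
          ≤⟨ ℕ.*-cancelˡ-≤ q (begin
             q * (2 * (m * count Z N))           ≤⟨ ℕ.*-monoʳ-≤ q (ℕ.*-monoʳ-≤ 2 (ℕ.*-monoʳ-≤ m count≤sum)) ⟩
             q * (2 * (m * S))                   ≡⟨ shuffle q m S ⟩
             2 * m * q * S                       ≡⟨ sym (sumℕ-* q (2 * m * q) (λ s → count (Zr s) M)) ⟩
             sumℕ q (λ s → 2 * m * q * count (Zr s) M) ≤⟨ sumℕ-mono q (λ s s<q → h M N₀≤M s s<q) ⟩
             sumℕ q (λ _ → M)                    ≡⟨ sumℕ-const q M ⟩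
             q * M                               ∎) ⟩
        suc (N / q)  ≤⟨ s≤s (m/n≤m N q) ⟩
        1 + N        ≤⟨ ℕ.+-monoˡ-≤ N (s≤s z≤n) ⟩
        N + N        ≡⟨ cong (N +_) (sym (ℕ.+-identityʳ N)) ⟩
        2 * N        ∎)
        where
        M = suc (N / q)
        S = sumℕ q (λ s → count (Zr s) M)
        shuffle : ∀ x y z → x * (2 * (y * z)) ≡ 2 * y * x * z
        shuffle = solve-∀
        count≤sum : count Z N ≤ S
        count≤sum = begin
          count Z N       ≤⟨ count-append Z (ℕ.<⇒≤ (N<[1+N/q]*q N q)) ⟩
          count Z (M * q) ≡⟨ sumℕ-residues q M (λ n → bit (Z n)) ⟩
          sumℕ q (λ s → sumℕ M (λ n → bit (Z (n * q + s))))
            ≡⟨ sumℕ-cong q (λ s s<q → sumℕ-cong M λ n _ →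
                 cong bit (cong₂ Zr (proj₂ (divMod-unique q n s s<q)) (proj₁ (divMod-unique q n s s<q)))) ⟩
          S ∎
        N₀≤M : N₀ ≤ M
        N₀≤M = ℕ.*-cancelʳ-≤ N₀ M q (ℕ.≤-trans (ℕ.n≤1+n _) (ℕ.≤-trans le (ℕ.<⇒≤ (N<[1+N/q]*q N q))))

  AE-/ : ∀ q .{{_ : NonZero q}} {P} → AE P → AE (λ n → P (n / q))
  AE-/ q {P} ae = AE-residues q λ r r<q →
    AE-map (λ n → subst P (sym (proj₁ (divMod-unique q n r r<q)))) ae

  -- A window filling at least the fraction 1/M of the segment below its right end cannot consist of
  -- exceptions once these have density at most 1/(M+1). The threshold depends on the right end
  -- only, and the witness is found by searching the Boolean exceptional set.
  AE-meets : ∀ {P} → AE P → ∀ M → ∃[ N₀ ] ∀ x len → N₀ ≤ len + x → 1 ≤ len → len + x ≤ M * len →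
    ∃[ n ] x ≤ n × n < len + x × P n
  AE-meets {P} (Z , null , p) M with null (suc M)
  ... | N₀ , h = N₀ , λ x len N₀≤ 1≤len le → search x len λ full → ℕ.<-irrefl refl (begin-strict
      M * len                       <⟨ ℕ.*-monoˡ-< len {{ℕ.>-nonZero 1≤len}} (ℕ.n<1+n M) ⟩
      suc M * len                   ≤⟨ ℕ.*-monoʳ-≤ (suc M) full ⟩
      suc M * count Z (len + x)     ≤⟨ h (len + x) N₀≤ ⟩
      len + x                       ≤⟨ le ⟩
      M * len                       ∎)
    where
    open ℕ.≤-Reasoning
    search : ∀ x len → ¬ (len ≤ count Z (len + x)) → ∃[ n ] x ≤ n × n < len + x × P n
    search x zero    ¬full = ⊥-elim (¬full z≤n)
    search x (suc l) ¬full with Z (l + x) in eq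
    ... | false = l + x , ℕ.m≤n+m x l , ℕ.≤-refl , p (l + x) eq
    ... | true with search x l (λ full → ¬full (s≤s full))
    ... | n , x≤n , n<l , pn = n , x≤n , ℕ.m<n⇒m<1+n n<l , pn

  AE-exists : ∀ {P} → AE P → ∀ x → ∃[ n ] x ≤ n × P n
  AE-exists ae x with AE-meets ae (suc x)
  ... | N₀ , h with h x (suc N₀) (ℕ.≤-trans (ℕ.n≤1+n N₀) (ℕ.m≤m+n (suc N₀) x)) (s≤s z≤n) (begin
        suc N₀ + x            ≤⟨ ℕ.+-monoʳ-≤ (suc N₀) (ℕ.m≤m*n x (suc N₀)) ⟩
        suc N₀ + x * suc N₀   ∎)
    where open ℕ.≤-Reasoning
  ... | n , x≤n , _ , pn = n , x≤n , pn

  power-gap : ∀ c {a b} → a < b → ∃[ t ] c * a ^ t ≤ b ^ t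
  power-gap c {zero}  {b} a<b = 1 , ℕ.≤-trans (ℕ.≤-reflexive (ℕ.*-zeroʳ c)) z≤n
  -- Bernoulli's inequality at t = c a: (1 + 1/a)^(c a) ≥ 1 + c.
  power-gap c {a@(suc _)} {b} a<b = c * a , (begin
      c * a ^ (c * a)     ≤⟨ ℕ.*-monoˡ-≤ (a ^ (c * a)) (ℕ.n≤1+n c) ⟩
      suc c * a ^ (c * a) ≤⟨ ℕ.*-cancelˡ-≤ a (subst (_≤ a * suc a ^ (c * a)) (shuffle a c (a ^ (c * a))) (bernoulli (c * a))) ⟩
      suc a ^ (c * a)     ≤⟨ ℕ.^-monoˡ-≤ (c * a) a<b ⟩
      b ^ (c * a)         ∎)
    where
    open ℕ.≤-Reasoning
    shuffle : ∀ a c x → x * (a + c * a) ≡ a * (suc c * x)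
    shuffle = solve-∀
    bernoulli : ∀ t → a ^ t * (a + t) ≤ a * suc a ^ t
    bernoulli zero    = ℕ.≤-reflexive (trans (ℕ.*-identityˡ _) (trans (ℕ.+-identityʳ a) (sym (ℕ.*-identityʳ a))))
    bernoulli (suc t) = begin
      a * a ^ t * (a + suc t)         ≤⟨ ℕ.m≤m+n _ (a ^ t * t) ⟩
      a * a ^ t * (a + suc t) + a ^ t * t ≡⟨ expand a (a ^ t) t ⟩
      suc a * (a ^ t * (a + t))       ≤⟨ ℕ.*-monoʳ-≤ (suc a) (bernoulli t) ⟩
      suc a * (a * suc a ^ t)         ≡⟨ swap (suc a) a (suc a ^ t) ⟩
      a * (suc a * suc a ^ t)         ∎
      where
      expand : ∀ a x t → a * x * (a + suc t) + x * t ≡ suc a * (x * (a + t))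
      expand = solve-∀
      swap : ∀ x y z → x * (y * z) ≡ y * (x * z)
      swap = solve-∀

  power-bound : ∀ c {b} → 2 ≤ b → ∃[ t ] c ≤ b ^ t
  power-bound c {b} 2≤b with power-gap c {1} {b} 2≤b
  ... | t , le = t , subst (_≤ b ^ t) (trans (cong (c *_) (ℕ.^-zeroˡ t)) (ℕ.*-identityʳ c)) le

  -- Null sets seen through base-K digits

  module _ (K K′ : ℕ) (K≡1+K′ : K ≡ suc K′) where
    private
      instance
        K≢0 : NonZero K
        K≢0 = subst NonZero (sym K≡1+K′) _

    -- Expansions are read from the least significant digit: s holds the i digits read so far, and w
    -- is a next digit after which almost no exception remains.
    HitsNull : (ℕ → Bool) → Set
    HitsNull χ = ∀ i s → s < K ^ i → ∃[ w ] w < K × Null (λ n → χ (K ^ suc i * n + (K ^ i * w + s)))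

    HitsNull-residue : ∀ χ → HitsNull χ → ∀ r → r < K → HitsNull (λ n → χ (n * K + r))
    HitsNull-residue χ hits r r<K i s s<Kⁱ with hits (suc i) (s * K + r) small
      where
      open ℕ.≤-Reasoning
      small : s * K + r < K ^ suc i
      small = begin-strict
        s * K + r <⟨ ℕ.+-monoʳ-< (s * K) r<K ⟩
        s * K + K ≡⟨ ℕ.+-comm (s * K) K ⟩
        suc s * K ≤⟨ ℕ.*-monoˡ-≤ K s<Kⁱ ⟩
        K ^ i * K ≡⟨ ℕ.*-comm (K ^ i) K ⟩
        K ^ suc i ∎
    ... | w , w<K , null = w , w<K , Null-⊆ (λ n → ℕ.≤-reflexive (cong (λ x → bit (χ x))
            (regroup K (K ^ i) n w s r))) null
      where
      regroup : ∀ K x n w s r → (K * x * n + (x * w + s)) * K + r ≡ K * (K * x) * n + (K * x * w + (s * K + r))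
      regroup = solve-∀

    -- Of the K classes of the next digit one is null and the other K′ obey the inductive bound, so
    -- the density of exceptions shrinks by K′/K per level. The summand 1 absorbs the errors of the
    -- limits: calling the induction with `m * K` makes K such errors add up to a single one after
    -- division by K.
    HitsNull-count : ∀ t χ → HitsNull χ → ∀ m → ∃[ N₀ ] ∀ N → N₀ ≤ N →
      m * count χ (N * K ^ t) ≤ (m * K′ ^ t + 1) * N
    HitsNull-count zero χ hits m = 0 , λ N _ → begin
      m * count χ (N * 1) ≤⟨ ℕ.*-monoʳ-≤ m (count≤ χ (N * 1)) ⟩
      m * (N * 1)         ≤⟨ ℕ.m≤m+n _ N ⟩
      m * (N * 1) + N     ≡⟨ regroup m N ⟩
      (m * 1 + 1) * N     ∎
      where
      open ℕ.≤-Reasoning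
      regroup : ∀ m N → m * (N * 1) + N ≡ (m * 1 + 1) * N
      regroup = solve-∀
    HitsNull-count (suc t) χ hits m
      with eventually-∀< K (λ s N → m * K * count (λ n → χ (n * K + s)) (N * K ^ t) ≤ (m * K * K′ ^ t + 1) * N)
             (λ s s<K → HitsNull-count t (λ n → χ (n * K + s)) (HitsNull-residue χ hits s s<K) (m * K))
         | hits 0 0 (s≤s z≤n)
    ... | N₁ , h₁ | w , w<K , null with null (m * K * K ^ t)
    ... | N₂ , h₂ = N₁ ⊔ N₂ , λ N le → ℕ.*-cancelˡ-≤ K (begin
        K * (m * count χ (N * (K * K ^ t)))      ≡⟨ cong (λ x → K * (m * count χ x)) (assoc N K (K ^ t)) ⟩
        K * (m * count χ (N * K ^ t * K))        ≡⟨ cong (λ x → K * (m * x)) (sumℕ-residues K (N * K ^ t) (λ n → bit (χ n))) ⟩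
        K * (m * sumℕ K (λ s → c s N))           ≡⟨ shuffle K m _ ⟩
        m * K * sumℕ K (λ s → c s N)             ≡⟨ sym (sumℕ-* K (m * K) (λ s → c s N)) ⟩
        sumℕ K (λ s → m * K * c s N)             ≤⟨ except {N} ((m * K * K′ ^ t + 1) * N) N
                                                      (h₁ N (ℕ.≤-trans (ℕ.m≤m⊔n N₁ N₂) le))
                                                      (small N (ℕ.≤-trans (ℕ.m≤n⊔m N₁ N₂) le)) ⟩
        K′ * ((m * K * K′ ^ t + 1) * N) + N      ≡⟨ regroup K≡1+K′ m (K′ ^ t) N ⟩
        K * ((m * (K′ * K′ ^ t) + 1) * N)        ∎)
      where
      open ℕ.≤-Reasoning
      c : ℕ → ℕ → ℕ
      c s N = count (λ n → χ (n * K + s)) (N * K ^ t)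
      assoc : ∀ x y z → x * (y * z) ≡ x * z * y
      assoc = solve-∀
      shuffle : ∀ x y z → x * (y * z) ≡ y * x * z
      shuffle = solve-∀
      regroup : ∀ {K k} → K ≡ suc k → ∀ m x N → k * ((m * K * x + 1) * N) + N ≡ K * ((m * (k * x) + 1) * N)
      regroup {k = k} refl = regroup′ k
        where
        regroup′ : ∀ k m x N → k * ((m * suc k * x + 1) * N) + N ≡ suc k * ((m * (k * x) + 1) * N)
        regroup′ = solve-∀
      except : ∀ {N} B b → (∀ s → s < K → m * K * c s N ≤ B) → m * K * c w N ≤ b →
        sumℕ K (λ s → m * K * c s N) ≤ K′ * B + b
      except {N} B b all≤ w≤ = subst (λ k → sumℕ k (λ s → m * K * c s N) ≤ K′ * B + b) (sym K≡1+K′)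
        (sumℕ-except K′ w B b (subst (w <_) K≡1+K′ w<K) (λ s s< → all≤ s (subst (s <_) (sym K≡1+K′) s<)) w≤)
      instance
        K^t≢0 : NonZero (K ^ t)
        K^t≢0 = ℕ.m^n≢0 K t
      small : ∀ N → N₂ ≤ N → m * K * c w N ≤ N
      small N le = ℕ.*-cancelʳ-≤ _ _ (K ^ t) (begin
        m * K * c w N * K ^ t ≡⟨ commute (m * K) (c w N) (K ^ t) ⟩
        m * K * K ^ t * c w N ≡⟨ cong (m * K * K ^ t *_) (sumℕ-cong (N * K ^ t) λ n _ →
                                   cong (λ x → bit (χ x)) (digit K n w)) ⟩
        m * K * K ^ t * count (λ n → χ (K * 1 * n + (1 * w + 0))) (N * K ^ t)
                              ≤⟨ h₂ (N * K ^ t) (ℕ.≤-trans le (ℕ.m≤m*n N (K ^ t))) ⟩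
        N * K ^ t ∎)
        where
        commute : ∀ x y z → x * y * z ≡ x * z * y
        commute = solve-∀
        digit : ∀ K n w → n * K + w ≡ K * 1 * n + (1 * w + 0)
        digit = solve-∀

    HitsNull⇒Null : ∀ χ → HitsNull χ → Null χ
    -- The factor 4 pays twice: once for the summand 1 in the count, once for rounding N up to a
    -- multiple of K^t.
    HitsNull⇒Null χ hits m with power-gap (4 * m) (ℕ.≤-reflexive (sym K≡1+K′))
    ... | t , gap with HitsNull-count t χ hits (4 * m)
    ... | N₀ , h = suc N₀ * K ^ t , λ N le → ℕ.*-cancelˡ-≤ 4 (begin
        4 * (m * count χ N)                      ≡⟨ sym (ℕ.*-assoc 4 m _) ⟩
        4 * m * count χ N                        ≤⟨ ℕ.*-monoʳ-≤ (4 * m) (count-append χ (ℕ.<⇒≤ (N<[1+N/q]*q N (K ^ t)))) ⟩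
        4 * m * count χ (suc (N / K ^ t) * K ^ t) ≤⟨ h (suc (N / K ^ t)) (N₀≤ N le) ⟩
        (4 * m * K′ ^ t + 1) * suc (N / K ^ t)   ≤⟨ ℕ.*-monoˡ-≤ (suc (N / K ^ t)) (ℕ.+-mono-≤ gap (ℕ.m^n>0 K t)) ⟩
        (K ^ t + K ^ t) * suc (N / K ^ t)        ≡⟨ regroup (K ^ t) (N / K ^ t) ⟩
        2 * (N / K ^ t * K ^ t) + 2 * K ^ t      ≤⟨ ℕ.+-mono-≤ (ℕ.*-monoʳ-≤ 2 (ℕ.m/n*n≤m N (K ^ t)))
                                                     (ℕ.*-monoʳ-≤ 2 (ℕ.≤-trans (ℕ.m≤m+n (K ^ t) (N₀ * K ^ t)) le)) ⟩
        2 * N + 2 * N                            ≡⟨ four N ⟩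
        4 * N                                    ∎)
      where
      open ℕ.≤-Reasoning
      instance
        K^t≢0 : NonZero (K ^ t)
        K^t≢0 = ℕ.m^n≢0 K t
      regroup : ∀ x y → (x + x) * suc y ≡ 2 * (y * x) + 2 * x
      regroup = solve-∀
      four : ∀ N → 2 * N + 2 * N ≡ 4 * N
      four = solve-∀
      N₀≤ : ∀ N → suc N₀ * K ^ t ≤ N → N₀ ≤ suc (N / K ^ t)
      N₀≤ N le = ℕ.*-cancelʳ-≤ N₀ _ (K ^ t) (begin
        N₀ * K ^ t              ≤⟨ ℕ.m≤n+m _ (K ^ t) ⟩
        suc N₀ * K ^ t          ≤⟨ le ⟩
        N                       ≤⟨ ℕ.<⇒≤ (N<[1+N/q]*q N (K ^ t)) ⟩
        suc (N / K ^ t) * K ^ t ∎)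

  -- Almost every base-K expansion passes through one of the digits w.
  AE-digits : ∀ K → 1 ≤ K → ∀ {P : ℕ → Set} → (∀ n → Dec (P n)) →
    (∀ i s → s < K ^ i → ∃[ w ] w < K × AE (λ n → P (K ^ suc i * n + (K ^ i * w + s)))) → AE P
  AE-digits (suc K′) _ {P} P? hits = χ , HitsNull⇒Null (suc K′) K′ refl χ hits′ , λ n → decode (P? n)
    where
    decode : ∀ {A : Set} (d : Dec A) → not (does d) ≡ false → A
    decode (yes a) _ = a
    χ : ℕ → Bool
    χ n = not (does (P? n))
    hits′ : HitsNull (suc K′) K′ refl χ
    hits′ i s s<Kⁱ with hits i s s<Kⁱ
    ... | w , w<K , Z , null , p = w , w<K , Null-⊆ below null
      where
      encode : ∀ {A : Set} (d : Dec A) b → (b ≡ false → A) → bit (not (does d)) ≤ bit b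
      encode (yes _) b     f = z≤n
      encode (no ¬a) true  f = ℕ.≤-refl
      encode (no ¬a) false f = ⊥-elim (¬a (f refl))
      below : ∀ n → bit (χ (suc K′ ^ suc i * n + (suc K′ ^ i * w + s))) ≤ bit (Z n)
      below n = encode (P? _) (Z n) (p n)

  AE-unshift : ∀ {P} b → AE (λ n → P (n + b)) → AE P
  AE-unshift {P} b (Z , null , p) = Z′ , null′ , hold
    where
    open ℕ.≤-Reasoning
    Z′ : ℕ → Bool
    Z′ n with b ℕ.≤? n
    ... | yes _ = Z (n ∸ b)
    ... | no _  = true
    hold : ∀ n → Z′ n ≡ false → P n
    hold n e with b ℕ.≤? n
    ... | yes b≤n = subst P (ℕ.m∸n+n≡m b≤n) (p (n ∸ b) e)
    shifted : ∀ n → Z′ (n + b) ≡ Z n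
    shifted n with b ℕ.≤? (n + b)
    ... | yes _  = cong Z (ℕ.m+n∸n≡m n b)
    ... | no b≰  = ⊥-elim (b≰ (ℕ.m≤n+m b n))
    count′ : ∀ N → count Z′ N ≤ count Z N + b
    count′ N = begin
      count Z′ N                               ≤⟨ count-append Z′ (ℕ.m≤m+n N b) ⟩
      count Z′ (N + b)                         ≡⟨ sumℕ-append N b (λ n → bit (Z′ n)) ⟩
      count (λ n → Z′ (n + b)) N + count Z′ b  ≡⟨ cong (_+ count Z′ b) (sumℕ-cong N λ n _ → cong bit (shifted n)) ⟩
      count Z N + count Z′ b                   ≤⟨ ℕ.+-monoʳ-≤ (count Z N) (count≤ Z′ b) ⟩
      count Z N + b                            ∎
    null′ : Null Z′
    null′ m with null (2 * m)
    ... | N₀ , h = N₀ + 2 * m * b , λ N le → ℕ.*-cancelˡ-≤ 2 (begin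
      2 * (m * count Z′ N)         ≤⟨ ℕ.*-monoʳ-≤ 2 (ℕ.*-monoʳ-≤ m (count′ N)) ⟩
      2 * (m * (count Z N + b))    ≡⟨ distribute m (count Z N) b ⟩
      2 * m * count Z N + 2 * m * b ≤⟨ ℕ.+-mono-≤ (h N (ℕ.≤-trans (ℕ.m≤m+n _ _) le)) (ℕ.≤-trans (ℕ.m≤n+m _ N₀) le) ⟩
      N + N                        ≡⟨ cong (N +_) (sym (ℕ.+-identityʳ N)) ⟩
      2 * N                        ∎)
      where
      distribute : ∀ m x y → 2 * (m * (x + y)) ≡ 2 * m * x + 2 * m * y
      distribute = solve-∀

  ≃ₐ⇒AE : ∀ {a b} → a ≃ₐ b → AE (λ n → a n ≡ b n)
  ≃ₐ⇒AE {a} {b} a≃b = (λ n → not (does (a n ℤ.≟ b n))) ,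
    (λ m → proj₁ (a≃b m) , λ N le → subst (λ x → m * x ≤ N) (agree N) (proj₂ (a≃b m) N le)) ,
    λ n → decode n
    where
    decode : ∀ n → not (does (a n ℤ.≟ b n)) ≡ false → a n ≡ b n
    decode n e with a n ℤ.≟ b n
    ... | yes eq = eq
    agree : ∀ N → countDiff N a b ≡ count (λ n → not (does (a n ℤ.≟ b n))) N
    agree zero = refl
    agree (suc N) with a N ℤ.≟ b N
    ... | yes _ = agree N
    ... | no _  = cong suc (agree N)

  AE⇒≃ₐ : ∀ {a b} → AE (λ n → a n ≡ b n) → a ≃ₐ b
  AE⇒≃ₐ {a} {b} (Z , null , p) m with null m
  ... | N₀ , h = N₀ , λ N le → ℕ.≤-trans (ℕ.*-monoʳ-≤ m (bound N)) (h N le)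
    where
    bound : ∀ N → countDiff N a b ≤ count Z N
    bound zero = z≤n
    bound (suc N) with a N ℤ.≟ b N
    ... | yes _ = ℕ.≤-trans (bound N) (ℕ.m≤n+m _ _)
    ... | no a≢b with Z N in eq
    ...   | true  = s≤s (bound N)
    ...   | false = ⊥-elim (a≢b (p N eq))

  -- Powers of coprime integers

  coprime-* : ∀ {a b c} → Coprime a c → Coprime b c → Coprime (a * b) c
  coprime-* {a} {b} ac bc {d} (d∣ab , d∣c) = bc (coprime-divisor da d∣ab , d∣c)
    where
    da : Coprime d a
    da (e∣d , e∣a) = ac (e∣a , ∣-trans e∣d d∣c)

  coprime-^ˡ : ∀ {a c} i → Coprime a c → Coprime (a ^ i) c
  coprime-^ˡ {a} {c} zero    ac = Coprime.1-coprimeTo c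
  coprime-^ˡ {a} {c} (suc i) ac = coprime-* {a} {a ^ i} {c} ac (coprime-^ˡ {a} {c} i ac)

  coprime-^ : ∀ {a c} i j → Coprime a c → Coprime (a ^ i) (c ^ j)
  coprime-^ {a} {c} i j ac = Coprime.sym (coprime-^ˡ {c} {a ^ i} j (Coprime.sym (coprime-^ˡ {a} {c} i ac)))

  solve-congruence : ∀ {a n} .{{_ : NonZero n}} → Coprime a n → ∀ s → ∃[ w ] w < n × n ∣ a * w + s
  solve-congruence {a} {n} an s with solution (coprime-Bézout an)
    where
    solution : Bézout.Identity 1 a n → ∃[ w ] n ∣ a * w + s
    solution (Bézout.-+ x y eq) = x * s , divides (y * s)
      (trans (factor a x s) (trans (cong (s *_) eq) (rotate s y n)))
      where
      factor : ∀ a x s → a * (x * s) + s ≡ s * (1 + x * a)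
      factor = solve-∀
      rotate : ∀ s y n → s * (y * n) ≡ y * s * n
      rotate = solve-∀
    -- Here x a = 1 + y n, so x has to be multiplied by -s, which `pred n * s` represents modulo n.
    solution (Bézout.+- x y eq) = x * (ℕ.pred n * s) , divides (y * (ℕ.pred n * s) + s)
      (trans (cong (_+ s) (trans (factor a x (ℕ.pred n * s)) (cong (ℕ.pred n * s *_) (sym eq))))
      (trans (expand (ℕ.pred n * s) y n s)
      (trans (cong (λ m → y * (ℕ.pred n * s) * n + m)
                   (trans (group (ℕ.pred n) s) (trans (cong (_* s) (ℕ.suc-pred n)) (ℕ.*-comm n s))))
             (sym (ℕ.*-distribʳ-+ n (y * (ℕ.pred n * s)) s)))))
      where
      factor : ∀ a x z → a * (x * z) ≡ z * (x * a)
      factor = solve-∀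
      expand : ∀ z y n s → z * (1 + y * n) + s ≡ y * z * n + (z + s)
      expand = solve-∀
      group : ∀ p s → p * s + s ≡ suc p * s
      group = solve-∀
  ... | w , n∣ = w % n , ℕ.m%n<n w n ,
    ∣m+n∣m⇒∣n (subst (n ∣_) (trans (cong (λ x → a * x + s) (ℕ.m≡m%n+[m/n]*n w n))
                                   (separate a (w % n) (w / n) n s)) n∣)
               (n∣m*n (a * (w / n)))
    where
    separate : ∀ a r q n s → a * (r + q * n) + s ≡ a * q * n + (a * r + s)
    separate = solve-∀

  -- Numbers k^β ℓ^α with quotient close to 1

  floor-log : ∀ {k} → 2 ≤ k → ∀ {m} → 1 ≤ m → ∀ i₀ n → k ^ i₀ * m ≤ n →
    ∃[ i ] i₀ ≤ i × k ^ i * m ≤ n × n < k ^ suc i * m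
  floor-log {k} 2≤k {m} 1≤m i₀ n low with power-bound (suc n) 2≤k
  ... | N , n<kᴺ = search N (ℕ.<-≤-trans n<kᴺ (ℕ.m≤m*n (k ^ N) m {{ℕ.>-nonZero 1≤m}}))
    where
    search : ∀ N → n < k ^ N * m → ∃[ i ] i₀ ≤ i × k ^ i * m ≤ n × n < k ^ suc i * m
    search zero    n< = ⊥-elim (ℕ.<-irrefl refl (ℕ.<-≤-trans n< (ℕ.≤-trans
      (ℕ.*-monoˡ-≤ m (ℕ.m^n>0 k {{ℕ.>-nonZero (ℕ.<⇒≤ 2≤k)}} i₀)) low)))
    search (suc N) n< with n ℕ.<? k ^ N * m
    ... | yes n<′ = search N n<′
    ... | no n≮ with i₀ ℕ.≤? N
    ...   | yes i₀≤N = N , i₀≤N , ℕ.≮⇒≥ n≮ , n<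
    ...   | no i₀≰N  = ⊥-elim (ℕ.<-irrefl refl (ℕ.<-≤-trans n< (ℕ.≤-trans
              (ℕ.*-monoˡ-≤ m (ℕ.^-monoʳ-≤ k {{ℕ.>-nonZero (ℕ.<⇒≤ 2≤k)}} (ℕ.≰⇒> i₀≰N))) low)))

  ratio-≤ : ∀ {M v X Y} → M ≤ v → v * X ≤ suc v * Y → M * X ≤ suc M * Y
  ratio-≤ {M} {v} {X} {Y} M≤v le with ℕ.≤-total X Y
  ... | inj₁ X≤Y = ℕ.≤-trans (ℕ.*-monoʳ-≤ M X≤Y) (ℕ.m≤n+m (M * Y) Y)
  ... | inj₂ Y≤X = begin
      M * X           ≡⟨ cong (M *_) (sym (ℕ.m+[n∸m]≡n Y≤X)) ⟩
      M * (Y + D)     ≡⟨ ℕ.*-distribˡ-+ M Y D ⟩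
      M * Y + M * D   ≤⟨ ℕ.+-monoʳ-≤ (M * Y) (ℕ.≤-trans (ℕ.*-monoˡ-≤ D M≤v) vD≤Y) ⟩
      M * Y + Y       ≡⟨ ℕ.+-comm (M * Y) Y ⟩
      suc M * Y       ∎
    where
    open ℕ.≤-Reasoning
    D = X ∸ Y
    vD≤Y : v * D ≤ Y
    vD≤Y = ℕ.+-cancelˡ-≤ (v * Y) (v * D) Y (begin
      v * Y + v * D ≡⟨ sym (ℕ.*-distribˡ-+ v Y D) ⟩
      v * (Y + D)   ≡⟨ cong (v *_) (ℕ.m+[n∸m]≡n Y≤X) ⟩
      v * X         ≤⟨ le ⟩
      Y + v * Y     ≡⟨ ℕ.+-comm Y (v * Y) ⟩
      v * Y + Y     ∎)

  same-bucket : ∀ {M v p p′ x x′} → 1 ≤ M → M ≤ v → v * p ≤ M * x → M * x′ < suc v * p′ →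
    M * (x′ * p) ≤ suc M * (x * p′)
  same-bucket {M} {v} {p} {p′} {x} {x′} 1≤M M≤v low high = ratio-≤ M≤v
    (ℕ.*-cancelˡ-≤ M {{ℕ.>-nonZero 1≤M}} (begin
      M * (v * (x′ * p))        ≡⟨ regroup M v x′ p ⟩
      v * p * (M * x′)          ≤⟨ ℕ.*-mono-≤ low (ℕ.<⇒≤ high) ⟩
      M * x * (suc v * p′)      ≡⟨ regroup′ M x (suc v) p′ ⟩
      M * (suc v * (x * p′))    ∎))
    where
    open ℕ.≤-Reasoning
    regroup : ∀ M v x p → M * (v * (x * p)) ≡ v * p * (M * x)
    regroup = solve-∀
    regroup′ : ∀ M x w p → M * x * (w * p) ≡ M * (w * (x * p))
    regroup′ = solve-∀

  Smooth : ℕ → ℕ → ℕ → Set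
  Smooth k ℓ n = ∃[ β ] ∃[ α ] n ≡ k ^ β * ℓ ^ α

  smooth-* : ∀ {k ℓ m n} → Smooth k ℓ m → Smooth k ℓ n → Smooth k ℓ (m * n)
  smooth-* {k} {ℓ} (β , α , refl) (β′ , α′ , refl) = β + β′ , α + α′ ,
    trans (interchange (k ^ β) (ℓ ^ α) (k ^ β′) (ℓ ^ α′))
          (sym (cong₂ _*_ (ℕ.^-distribˡ-+-* k β β′) (ℕ.^-distribˡ-+-* ℓ α α′)))
    where
    interchange : ∀ a b x y → a * b * (x * y) ≡ a * x * (b * y)
    interchange = solve-∀

  smooth-^ : ∀ {k ℓ m} i → Smooth k ℓ m → Smooth k ℓ (m ^ i)
  smooth-^ zero    sm = 0 , 0 , refl
  smooth-^ {k} {ℓ} {m} (suc i) sm = smooth-* {k} {ℓ} {m} {m ^ i} sm (smooth-^ i sm)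

  module _ {k ℓ : ℕ} (2≤k : 2 ≤ k) (2≤ℓ : 2 ≤ ℓ) (k⊥ℓ : Coprime k ℓ) where
    private
      instance
        k≢0 : NonZero k
        k≢0 = ℕ.>-nonZero (ℕ.<⇒≤ 2≤k)
        ℓ≢0 : NonZero ℓ
        ℓ≢0 = ℕ.>-nonZero (ℕ.<⇒≤ 2≤ℓ)

    -- Cancelling ℓ^e would leave ℓ as a divisor of a power of k. This makes the inequality A < B of
    -- a close pair strict.
    powers-differ : ∀ {e e′} i i′ → e < e′ → ℓ ^ e′ * k ^ i ≢ ℓ ^ e * k ^ i′
    powers-differ {e} {e′} i i′ e<e′ eq = ℕ.<-irrefl
      (sym (coprime-^ˡ {k} {ℓ} i′ k⊥ℓ (divides (ℓ ^ (e′ ∸ suc e) * k ^ i) factor , ∣-refl))) 2≤ℓ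
      where
      factor : k ^ i′ ≡ ℓ ^ (e′ ∸ suc e) * k ^ i * ℓ
      factor = ℕ.*-cancelˡ-≡ (k ^ i′) _ (ℓ ^ e) {{ℕ.m^n≢0 ℓ e}} (trans (sym eq)
        (trans (cong (λ y → ℓ ^ y * k ^ i) (trans (sym (ℕ.m∸n+n≡m e<e′)) (ℕ.+-suc (e′ ∸ suc e) e)))
        (trans (cong (λ y → ℓ * y * k ^ i) (ℕ.^-distribˡ-+-* ℓ (e′ ∸ suc e) e))
               (regroup ℓ (ℓ ^ (e′ ∸ suc e)) (ℓ ^ e) (k ^ i)))))
        where
        regroup : ∀ l x y z → l * (x * y) * z ≡ y * (x * z * l)
        regroup = solve-∀

    -- v / M is the mantissa ℓ^e / k^i in [1, k), truncated to a multiple of 1/M. Since v < M k, two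
    -- among M k + 1 exponents share the same v, and M ≤ v turns the additive precision 1/M into a
    -- quotient of at most 1 + 1/M.
    Mantissa : ℕ → ℕ → Set
    Mantissa M e = ∃[ v ] ∃[ i ] v < M * k × M ≤ v × v * k ^ i ≤ M * ℓ ^ e × M * ℓ ^ e < suc v * k ^ i

    mantissa : ∀ M → 1 ≤ M → ∀ e → Mantissa M e
    mantissa M 1≤M e with floor-log 2≤k {1} ℕ.≤-refl 0 (ℓ ^ e) (ℕ.m^n>0 ℓ e)
    ... | i , _ , low , high = (M * ℓ ^ e) / k ^ i , i ,
      ℕ.m<n*o⇒m/o<n {M * ℓ ^ e} {M * k} (begin-strict
        M * ℓ ^ e           <⟨ ℕ.*-monoʳ-< M {{ℕ.>-nonZero 1≤M}} high ⟩
        M * (k ^ suc i * 1) ≡⟨ regroup M k (k ^ i) ⟩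
        M * k * k ^ i       ∎) ,
      subst (_≤ (M * ℓ ^ e) / k ^ i) (ℕ.m*n/n≡m M (k ^ i))
        (ℕ./-monoˡ-≤ (k ^ i) (ℕ.*-monoʳ-≤ M (subst (_≤ ℓ ^ e) (ℕ.*-identityʳ (k ^ i)) low))) ,
      ℕ.m/n*n≤m (M * ℓ ^ e) (k ^ i) ,
      N<[1+N/q]*q (M * ℓ ^ e) (k ^ i)
      where
      open ℕ.≤-Reasoning
      instance
        kⁱ≢0 : NonZero (k ^ i)
        kⁱ≢0 = ℕ.m^n≢0 k i
      regroup : ∀ M k x → M * (k * x * 1) ≡ M * k * x
      regroup = solve-∀

    CloseRatio : ℕ → Set
    CloseRatio M = ∃[ A ] ∃[ B ] 1 ≤ A × A < B × M * B ≤ suc M * A × Smooth k ℓ A × Smooth k ℓ B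

    close-from-mantissas : ∀ M → 1 ≤ M → (∀ e → Mantissa M e) → CloseRatio M
    close-from-mantissas M 1≤M mant =
      let (x , y , x<y , same) = pigeonhole (ℕ.n<1+n (M * k)) (λ e → fromℕ< (v< (toℕ e)))
      in conclude (toℕ x) (toℕ y) x<y
           (trans (sym (toℕ-fromℕ< (v< (toℕ x)))) (trans (cong toℕ same) (toℕ-fromℕ< (v< (toℕ y)))))
      where
      v : ℕ → ℕ
      v e = proj₁ (mant e)
      v< : ∀ e → v e < M * k
      v< e = proj₁ (proj₂ (proj₂ (mant e)))
      smooth : ∀ e i → Smooth k ℓ (ℓ ^ e * k ^ i)
      smooth e i = i , e , ℕ.*-comm (ℓ ^ e) (k ^ i)
      positive : ∀ e i → 1 ≤ ℓ ^ e * k ^ i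
      positive e i = ℕ.*-mono-≤ (ℕ.m^n>0 ℓ e) (ℕ.m^n>0 k i)
      conclude : ∀ e e′ → e < e′ → v e ≡ v e′ → CloseRatio M
      conclude e e′ e<e′ same with mant e | mant e′
      ... | w , i , _ , M≤w , low , high | w′ , i′ , _ , M≤w′ , low′ , high′ with same
      ... | refl with ℕ.<-cmp (ℓ ^ e * k ^ i′) (ℓ ^ e′ * k ^ i)
      ...   | tri< lt _ _ = ℓ ^ e * k ^ i′ , ℓ ^ e′ * k ^ i , positive e i′ , lt ,
                same-bucket {M} {w} {k ^ i} {k ^ i′} {ℓ ^ e} {ℓ ^ e′} 1≤M M≤w low high′ , smooth e i′ , smooth e′ i
      ...   | tri≈ _ eq _ = ⊥-elim (powers-differ i i′ e<e′ (sym eq))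
      ...   | tri> _ _ gt = ℓ ^ e′ * k ^ i , ℓ ^ e * k ^ i′ , positive e′ i , gt ,
                same-bucket {M} {w} {k ^ i′} {k ^ i} {ℓ ^ e′} {ℓ ^ e} 1≤M M≤w low′ high , smooth e′ i , smooth e i′

    -- Two of the powers ℓ^e have base-k mantissas in the same interval [v/M, (v+1)/M).
    close-ratio : ∀ M → 1 ≤ M → CloseRatio M
    close-ratio M 1≤M = close-from-mantissas M 1≤M (mantissa M 1≤M)

  -- For R ≤ M the hypothesis gives B/A ≤ (M+1)/M ≤ (R+1)/R, and the product of D consecutive bounds
  -- of this kind telescopes to (M+1)/(M+1-D).
  bernoulli : ∀ {M A B} → A < B → M * B ≤ suc M * A → ∀ D R → D + R ≡ suc M → B ^ D * R ≤ suc M * A ^ D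
  bernoulli {M} {A} {B} A<B close zero    R eq =
    ℕ.≤-reflexive (trans (ℕ.+-identityʳ R) (trans eq (sym (ℕ.*-identityʳ (suc M)))))
  bernoulli {M} {A} {B} A<B close (suc D) R eq = begin
      B * B ^ D * R             ≡⟨ regroup B (B ^ D) R ⟩
      B ^ D * (R * B)           ≤⟨ ℕ.*-monoʳ-≤ (B ^ D) RB≤ ⟩
      B ^ D * (suc R * A)       ≡⟨ sym (ℕ.*-assoc (B ^ D) (suc R) A) ⟩
      B ^ D * suc R * A         ≤⟨ ℕ.*-monoˡ-≤ A (bernoulli A<B close D (suc R) (trans (ℕ.+-suc D R) eq)) ⟩
      suc M * A ^ D * A         ≡⟨ regroup′ (suc M) (A ^ D) A ⟩
      suc M * (A * A ^ D)       ∎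
    where
    open ℕ.≤-Reasoning
    regroup : ∀ b x r → b * x * r ≡ x * (r * b)
    regroup = solve-∀
    regroup′ : ∀ m x a → m * x * a ≡ m * (a * x)
    regroup′ = solve-∀
    x = B ∸ A
    B≡ : A + x ≡ B
    B≡ = ℕ.m+[n∸m]≡n (ℕ.<⇒≤ A<B)
    Mx≤A : M * x ≤ A
    Mx≤A = ℕ.+-cancelˡ-≤ (M * A) (M * x) A (begin
      M * A + M * x ≡⟨ sym (ℕ.*-distribˡ-+ M A x) ⟩
      M * (A + x)   ≡⟨ cong (M *_) B≡ ⟩
      M * B         ≤⟨ close ⟩
      A + M * A     ≡⟨ ℕ.+-comm A (M * A) ⟩
      M * A + A     ∎)
    R≤M : R ≤ M
    R≤M = subst (R ≤_) (ℕ.suc-injective eq) (ℕ.m≤n+m R D)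
    RB≤ : R * B ≤ suc R * A
    RB≤ = begin
      R * B         ≡⟨ cong (R *_) (sym B≡) ⟩
      R * (A + x)   ≡⟨ ℕ.*-distribˡ-+ R A x ⟩
      R * A + R * x ≤⟨ ℕ.+-monoʳ-≤ (R * A) (ℕ.≤-trans (ℕ.*-monoˡ-≤ x R≤M) Mx≤A) ⟩
      R * A + A     ≡⟨ ℕ.+-comm (R * A) A ⟩
      suc R * A     ∎

  -- For M + 1 = (2m+2)(D+1) the denominator M + 1 - D of the telescoped bound is (2m+1)(D+1) + 1.
  -- The resulting quotient (2m+2)/(2m+1) is the tolerance that `Spread.above` can afford.
  power-ratio-≤ : ∀ m D {A B} → A < B → (ℕ.pred ((2 * m + 2) * suc D)) * B ≤ (2 * m + 2) * suc D * A →
    (2 * m + 1) * B ^ D ≤ (2 * m + 2) * A ^ D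
  power-ratio-≤ m D {A} {B} A<B close = ℕ.*-cancelˡ-≤ (suc D) (begin
      suc D * ((2 * m + 1) * B ^ D)            ≡⟨ regroup D m (B ^ D) ⟩
      B ^ D * ((2 * m + 1) * suc D)            ≤⟨ ℕ.*-monoʳ-≤ (B ^ D) (ℕ.n≤1+n _) ⟩
      B ^ D * suc ((2 * m + 1) * suc D)        ≤⟨ bernoulli A<B (subst (λ y → M * B ≤ y * A) suc-pred close) D (suc ((2 * m + 1) * suc D)) (trans (total D m) suc-pred) ⟩
      suc M * A ^ D                            ≡⟨ cong (_* A ^ D) (sym suc-pred) ⟩
      (2 * m + 2) * suc D * A ^ D              ≡⟨ regroup′ m D (A ^ D) ⟩
      suc D * ((2 * m + 2) * A ^ D)            ∎)
    where
    open ℕ.≤-Reasoning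
    M = ℕ.pred ((2 * m + 2) * suc D)
    suc-pred : (2 * m + 2) * suc D ≡ suc M
    suc-pred = sym (ℕ.suc-pred ((2 * m + 2) * suc D)
      {{ℕ.>-nonZero (ℕ.*-mono-≤ {1} {2 * m + 2} {1} {suc D} (ℕ.≤-trans (s≤s z≤n) (ℕ.m≤n+m 2 (2 * m))) (s≤s z≤n))}})
    total : ∀ D m → D + suc ((2 * m + 1) * suc D) ≡ (2 * m + 2) * suc D
    total = solve-∀
    regroup : ∀ D m x → suc D * ((2 * m + 1) * x) ≡ x * ((2 * m + 1) * suc D)
    regroup = solve-∀
    regroup′ : ∀ m D x → (2 * m + 2) * suc D * x ≡ suc D * ((2 * m + 2) * x)
    regroup′ = solve-∀

open Naturals
open import Data.Integer using (_+_; _*_; _-_; -_)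
open ℤ-Solver using (solve-∀)

-- Linear algebra over ℤ

sum-cong : ∀ d {f g : Fin d → ℤ} → (∀ j → f j ≡ g j) → sumFin d f ≡ sumFin d g
sum-cong zero    f≡g = refl
sum-cong (suc d) f≡g = cong₂ _+_ (f≡g zero) (sum-cong d (λ j → f≡g (suc j)))

sum-0 : ∀ d → sumFin d (λ _ → 0ℤ) ≡ 0ℤ
sum-0 zero    = refl
sum-0 (suc d) = trans (ℤ.+-identityˡ _) (sum-0 d)

sum-+ : ∀ d (f g : Fin d → ℤ) → sumFin d (λ j → f j + g j) ≡ sumFin d f + sumFin d g
sum-+ zero    f g = refl
sum-+ (suc d) f g rewrite sum-+ d (λ j → f (suc j)) (λ j → g (suc j)) =
  interchange (f zero) (g zero) _ _
  where
  interchange : ∀ a b x y → (a + b) + (x + y) ≡ (a + x) + (b + y)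
  interchange = solve-∀

sum-* : ∀ d c (f : Fin d → ℤ) → sumFin d (λ j → c * f j) ≡ c * sumFin d f
sum-* zero    c f = sym (ℤ.*-zeroʳ c)
sum-* (suc d) c f rewrite sum-* d c (λ j → f (suc j)) = sym (ℤ.*-distribˡ-+ c _ _)

sum-swap : ∀ m n (f : Fin m → Fin n → ℤ) →
  sumFin m (λ i → sumFin n (f i)) ≡ sumFin n (λ j → sumFin m (λ i → f i j))
sum-swap zero    n f = sym (sum-0 n)
sum-swap (suc m) n f rewrite sum-swap m n (λ i → f (suc i)) =
  sym (sum-+ n (f zero) (λ j → sumFin m (λ i → f (suc i) j)))

sum-zero : ∀ d {f : Fin d → ℤ} → (∀ j → f j ≡ 0ℤ) → sumFin d f ≡ 0ℤ
sum-zero d f≡0 = trans (sum-cong d f≡0) (sum-0 d)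

sum-single : ∀ d (i : Fin d) {f : Fin d → ℤ} → (∀ j → j ≢ i → f j ≡ 0ℤ) → sumFin d f ≡ f i
sum-single (suc d) zero {f} rest =
  trans (cong (f zero +_) (sum-zero d (λ j → rest (suc j) λ ()))) (ℤ.+-identityʳ _)
sum-single (suc d) (suc i) {f} rest =
  trans (cong₂ _+_ (rest zero λ ())
                   (sum-single d i (λ j j≢i → rest (suc j) λ { refl → j≢i refl })))
        (ℤ.+-identityˡ _)

*-nonzero : ∀ {a b} → a ≢ 0ℤ → b ≢ 0ℤ → a * b ≢ 0ℤ
*-nonzero {a} a≢0 b≢0 ab≡0 with ℤ.i*j≡0⇒i≡0∨j≡0 a ab≡0
... | inj₁ a≡0 = a≢0 a≡0
... | inj₂ b≡0 = b≢0 b≡0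

*-cancel-0 : ∀ {c x} → c ≢ 0ℤ → c * x ≡ 0ℤ → x ≡ 0ℤ
*-cancel-0 {c} c≢0 cx≡0 with ℤ.i*j≡0⇒i≡0∨j≡0 c cx≡0
... | inj₁ c≡0 = ⊥-elim (c≢0 c≡0)
... | inj₂ x≡0 = x≡0

nonzero? : ∀ {d} (v : Fin d → ℤ) → (∃[ i ] v i ≢ 0ℤ) ⊎ (∀ i → v i ≡ 0ℤ)
nonzero? v with any? (λ i → ¬? (v i ℤ.≟ 0ℤ))
... | yes p = inj₁ p
... | no ¬p = inj₂ λ i → decidable-stable (v i ℤ.≟ 0ℤ) λ q → ¬p (i , q)

eliminate : ∀ {D} (i : Fin (suc D)) (p v : Fin (suc D) → ℤ) → Fin D → ℤ
eliminate i p v j = p i * v (punchIn i j) - v i * p (punchIn i j)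

eliminate-0 : ∀ {D} (i : Fin (suc D)) (p v : Fin (suc D) → ℤ) →
  (∀ j → eliminate i p v j ≡ 0ℤ) → ∀ l → p i * v l + (- v i) * p l ≡ 0ℤ
eliminate-0 i p v e≡0 l with i Fin.≟ l
... | yes refl = cancel (p i) (v i)
  where
  cancel : ∀ a b → a * b + (- b) * a ≡ 0ℤ
  cancel = solve-∀
... | no i≢l with e≡0 (punchOut i≢l)
... | h rewrite punchIn-punchOut i≢l = trans (neg (p i) (v l) (v i) (p l)) h
  where
  neg : ∀ a b x y → a * b + (- x) * y ≡ a * b - x * y
  neg = solve-∀

-- Fraction-free Gaussian elimination: cross-multiplication with a pivot row clears its column i,
-- the induction treats the remaining columns, and the coefficient of the pivot row is chosen so
-- that column i cancels as well.
dependent : ∀ D (v : Fin (suc D) → Fin D → ℤ) →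
  Σ (Fin (suc D) → ℤ) λ c → (∃[ h ] c h ≢ 0ℤ) × (∀ x → sumFin (suc D) (λ h → c h * v h x) ≡ 0ℤ)
dependent zero v = (λ _ → 1ℤ) , (zero , λ ()) , λ ()
dependent (suc D) v with nonzero? (v zero)
... | inj₂ v₀≡0 = c , (zero , λ ()) , λ x →
    trans (sum-single (suc (suc D)) zero {λ h → c h * v h x}
            (λ { zero z≢z → ⊥-elim (z≢z refl) ; (suc j) _ → ℤ.*-zeroˡ (v (suc j) x) }))
          (trans (ℤ.*-identityˡ _) (v₀≡0 x))
  where
  c : Fin (suc (suc D)) → ℤ
  c zero    = 1ℤ
  c (suc _) = 0ℤ
... | inj₁ (i , p≢0) with dependent D (λ h → eliminate i (v zero) (v (suc h)))
... | c , (h₀ , ch₀≢0) , rel = c′ , (suc h₀ , *-nonzero ch₀≢0 p≢0) , λ x →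
      trans (reshape x) (eliminate-0 i (v zero) s rel′ x)
  where
  S = sumFin (suc D)
  s : Fin (suc D) → ℤ
  s x = S (λ h → c h * v (suc h) x)
  c′ : Fin (suc (suc D)) → ℤ
  c′ zero    = - s i
  c′ (suc h) = c h * v zero i
  pull : ∀ a x → S (λ h → (c h * a) * v (suc h) x) ≡ a * s x
  pull a x = trans (sum-cong (suc D) (λ h → shuffle (c h) a (v (suc h) x))) (sum-* (suc D) a (λ h → c h * v (suc h) x))
    where
    shuffle : ∀ c a y → (c * a) * y ≡ a * (c * y)
    shuffle = solve-∀
  reshape : ∀ x → c′ zero * v zero x + S (λ h → c′ (suc h) * v (suc h) x)
                ≡ v zero i * s x + (- s i) * v zero x
  reshape x = trans (cong (- s i * v zero x +_) (pull (v zero i) x))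
                    (ℤ.+-comm (- s i * v zero x) _)
  rel′ : ∀ j → eliminate i (v zero) s j ≡ 0ℤ
  rel′ j = trans (cong₂ (λ a b → a - b) (sym (pull (v zero i) (punchIn i j)))
                    (trans (ℤ.*-comm (s i) y) (sym (sum-* (suc D) y (λ h → c h * v (suc h) i)))))
           (trans (sub (λ h → (c h * v zero i) * v (suc h) (punchIn i j))
                       (λ h → y * (c h * v (suc h) i)))
           (trans (sum-cong (suc D) (λ h → dist (c h) (v zero i) (v (suc h) (punchIn i j)) y (v (suc h) i)))
                  (rel j)))
    where
    y = v zero (punchIn i j)
    dist : ∀ c a b y z → (c * a) * b - y * (c * z) ≡ c * (a * b - z * y)
    dist = solve-∀
    sub : ∀ (f g : Fin (suc D) → ℤ) → S f - S g ≡ S (λ h → f h - g h)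
    sub f g = sym (trans (sum-+ (suc D) f (λ h → - g h))
                (cong (S f +_) (trans (sum-cong (suc D) (λ h → minus (g h)))
                  (trans (sum-* (suc D) (- 1ℤ) g) (sym (minus (S g)))))))
      where
      minus : ∀ x → - x ≡ (- 1ℤ) * x
      minus = solve-∀

lowest : ∀ {n} (c : Fin n → ℤ) → (∃[ h ] c h ≢ 0ℤ) →
  ∃[ h ] c h ≢ 0ℤ × (∀ i → toℕ i < toℕ h → c i ≡ 0ℤ)
lowest {suc n} c (h , nz) with c zero ℤ.≟ 0ℤ
... | no c₀≢0 = zero , c₀≢0 , λ i ()
lowest {suc n} c (zero , nz) | yes c₀≡0 = ⊥-elim (nz c₀≡0)
lowest {suc n} c (suc h , nz) | yes c₀≡0 with lowest (λ i → c (suc i)) (h , nz)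
... | g , nz′ , low = suc g , nz′ , λ { zero _ → c₀≡0 ; (suc i) (s≤s i<g) → low i i<g }

highest : ∀ {n} (c : Fin n → ℤ) → (∃[ h ] c h ≢ 0ℤ) →
  ∃[ h ] c h ≢ 0ℤ × (∀ i → toℕ h < toℕ i → c i ≡ 0ℤ)
highest {suc n} c (h , nz) with nonzero? (λ i → c (suc i))
... | inj₁ tail with highest (λ i → c (suc i)) tail
...   | g , nz′ , high = suc g , nz′ , λ { (suc i) (s≤s g<i) → high i g<i }
highest {suc n} c (zero , nz)  | inj₂ tail≡0 = zero , nz , λ { (suc i) _ → tail≡0 i }
highest {suc n} c (suc h , nz) | inj₂ tail≡0 = ⊥-elim (nz (tail≡0 h))

-- Membership in the ℚ-span with the denominator c cleared. As ℤ has no zero divisors, this suffices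
-- to transport zeros.
RSpan : ∀ {d} (p : ℕ) → (Fin p → Fin d → ℤ) → (Fin d → ℤ) → Set
RSpan p F v = Σ ℤ λ c → c ≢ 0ℤ × Σ (Fin p → ℤ) λ t → ∀ x → c * v x ≡ sumFin p (λ j → t j * F j x)

-- The kernel of π is kept rationally spanned by F; a vector reached from F outside that
-- kernel serves as a pivot, which joins F and lowers the rank of π.
module _ {d k : ℕ} (step : Fin k → (Fin d → ℤ) → (Fin d → ℤ)) (𝒫 : (Fin d → ℤ) → Set)
         (𝒫-step : ∀ r v → 𝒫 v → 𝒫 (step r v)) (f : Fin d → ℤ) (𝒫f : 𝒫 f) where

  ClosedSpan : Set
  ClosedSpan = ∃[ p ] Σ (Fin p → Fin d → ℤ) λ F →
    (∀ j → 𝒫 (F j)) × RSpan p F f × (∀ r j → RSpan p F (step r (F j)))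

  closedSpan-from : ∀ D p (F : Fin p → Fin d → ℤ) → (∀ j → 𝒫 (F j)) →
    (π : (Fin d → ℤ) → Fin D → ℤ) →
    (∀ a b v w i → π (λ x → a * v x + b * w x) i ≡ a * π v i + b * π w i) →
    (∀ v → (∀ i → π v i ≡ 0ℤ) → RSpan p F v) → ClosedSpan
  closedSpan-from zero p F 𝒫F π π-lin ker =
    p , F , 𝒫F , ker f (λ ()) , λ r j → ker (step r (F j)) (λ ())
  closedSpan-from (suc D) p F 𝒫F π π-lin ker = decide
    (nonzero? (π f)) (any? (λ r → any? λ j → any? λ i → ¬? (π (step r (F j)) i ℤ.≟ 0ℤ)))
    where
    pivot : ∀ u → 𝒫 u → ∀ i → π u i ≢ 0ℤ → ClosedSpan
    pivot u 𝒫u i a≢0 = closedSpan-from D (suc p) F′ 𝒫F′ (λ v → eliminate i (π u) (π v)) lin′ ker′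
      where
      F′ : Fin (suc p) → Fin d → ℤ
      F′ zero    = u
      F′ (suc j) = F j
      𝒫F′ : ∀ j → 𝒫 (F′ j)
      𝒫F′ zero    = 𝒫u
      𝒫F′ (suc j) = 𝒫F j
      lin′ : ∀ a b v w j → eliminate i (π u) (π (λ x → a * v x + b * w x)) j
                         ≡ a * eliminate i (π u) (π v) j + b * eliminate i (π u) (π w) j
      lin′ a b v w j rewrite π-lin a b v w (punchIn i j) | π-lin a b v w i =
        expand a b (π u i) (π v (punchIn i j)) (π w (punchIn i j)) (π v i) (π w i) (π u (punchIn i j))
        where
        expand : ∀ a b p x y z t q → p * (a * x + b * y) - (a * z + b * t) * q
                                   ≡ a * (p * x - z * q) + b * (p * y - t * q)
        expand = solve-∀
      ker′ : ∀ v → (∀ j → eliminate i (π u) (π v) j ≡ 0ℤ) → RSpan (suc p) F′ v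
      ker′ v e≡0 with ker (λ x → π u i * v x + (- π v i) * u x)
                        (λ l → trans (π-lin (π u i) (- π v i) v u l) (eliminate-0 i (π u) (π v) e≡0 l))
      ... | c , c≢0 , t , eq = c * π u i , *-nonzero c≢0 a≢0 , t′ , λ x →
            trans (split c (π u i) (v x) (π v i) (u x)) (cong ((c * π v i) * u x +_) (eq x))
        where
        t′ : Fin (suc p) → ℤ
        t′ zero    = c * π v i
        t′ (suc j) = t j
        split : ∀ c a y b z → (c * a) * y ≡ (c * b) * z + c * (a * y + (- b) * z)
        split = solve-∀

    decide : (∃[ i ] π f i ≢ 0ℤ) ⊎ (∀ i → π f i ≡ 0ℤ) →
      Dec (∃[ r ] ∃[ j ] ∃[ i ] π (step r (F j)) i ≢ 0ℤ) → ClosedSpan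
    decide (inj₂ πf≡0) (no none) =
      p , F , 𝒫F , ker f πf≡0 , λ r j → ker (step r (F j)) λ i →
        decidable-stable (_ ℤ.≟ 0ℤ) λ q → none (r , j , i , q)
    decide (inj₁ (i , nz)) _ = pivot f 𝒫f i nz
    decide (inj₂ _) (yes (r , j , i , nz)) = pivot (step r (F j)) (𝒫-step r (F j) (𝒫F j)) i nz

  closedSpan : ClosedSpan
  closedSpan = closedSpan-from d 0 (λ ()) (λ ()) (λ v → v) (λ _ _ _ _ _ → refl)
    λ v v≡0 → 1ℤ , (λ ()) , (λ ()) , λ x → trans (ℤ.*-identityˡ _) (v≡0 x)

-- Spans, exactly and up to density zero

module Span {A : Set} (Q : (A → Set) → Set) (pure : ∀ {P} → (∀ x → P x) → Q P)
            (map₂ : ∀ {P P′ P″ : A → Set} → (∀ x → P x → P′ x → P″ x) → Q P → Q P′ → Q P″) where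

  lin : ∀ d → (Fin d → ℤ) → (Fin d → A → ℤ) → A → ℤ
  lin d t g x = sumFin d (λ j → t j * g j x)

  map₁ : ∀ {P P′ : A → Set} → (∀ x → P x → P′ x) → Q P → Q P′
  map₁ {P} f q = map₂ {P} {λ _ → ⊤} (λ x p _ → f x p) q (pure (λ _ → tt))

  InSpan : ∀ d → (Fin d → A → ℤ) → (A → ℤ) → Set
  InSpan d g b = Σ (Fin d → ℤ) λ t → Q (λ x → b x ≡ lin d t g x)

  span-resp : ∀ {d g b b′} → (∀ x → b′ x ≡ b x) → InSpan d g b → InSpan d g b′
  span-resp {d} {g} {b} {b′} eq (t , p) = t ,
    map₁ {λ x → b x ≡ lin d t g x} (λ x e → trans (eq x) e) p

  span-mem : ∀ {d} (g : Fin d → A → ℤ) i → InSpan d g (g i)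
  span-mem {d} g i = t , pure (λ x → sym (trans (sum-single d i {λ j → t j * g j x} (off x)) (on x)))
    where
    t : Fin d → ℤ
    t j with i Fin.≟ j
    ... | yes _ = 1ℤ
    ... | no _  = 0ℤ
    off : ∀ x j → j ≢ i → t j * g j x ≡ 0ℤ
    off x j j≢i with i Fin.≟ j
    ... | yes i≡j = ⊥-elim (j≢i (sym i≡j))
    ... | no _    = refl
    on : ∀ x → t i * g i x ≡ g i x
    on x with i Fin.≟ i
    ... | yes _  = ℤ.*-identityˡ (g i x)
    ... | no i≢i = ⊥-elim (i≢i refl)

  span-0 : ∀ {d} (g : Fin d → A → ℤ) → InSpan d g (λ _ → 0ℤ)
  span-0 {d} g = (λ _ → 0ℤ) , pure λ x → sym (sum-zero d (λ j → refl))

  span-+ : ∀ {d g b b′} → InSpan d g b → InSpan d g b′ → InSpan d g (λ x → b x + b′ x)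
  span-+ {d} {g} {b} {b′} (t , p) (t′ , p′) = (λ j → t j + t′ j) ,
    map₂ {λ x → b x ≡ lin d t g x} {λ x → b′ x ≡ lin d t′ g x}
      (λ x e e′ → trans (cong₂ _+_ e e′)
        (sym (trans (sum-cong d (λ j → ℤ.*-distribʳ-+ (g j x) (t j) (t′ j)))
                    (sum-+ d (λ j → t j * g j x) (λ j → t′ j * g j x))))) p p′

  span-* : ∀ {d g b} c → InSpan d g b → InSpan d g (λ x → c * b x)
  span-* {d} {g} {b} c (t , p) = (λ j → c * t j) ,
    map₁ {λ x → b x ≡ lin d t g x}
      (λ x e → trans (cong (c *_) e)
        (sym (trans (sum-cong d (λ j → ℤ.*-assoc c (t j) (g j x))) (sum-* d c (λ j → t j * g j x))))) p

  span-lin : ∀ {d g} m (t : Fin m → ℤ) {h : Fin m → A → ℤ} → (∀ j → InSpan d g (h j)) → InSpan d g (lin m t h)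
  span-lin {d} {g} zero    t mem = span-0 g
  span-lin {d} {g} (suc m) t {h} mem =
    span-+ {d} {g} {λ x → t zero * h zero x} (span-* {b = h zero} (t zero) (mem zero))
           (span-lin m (λ j → t (suc j)) {λ j → h (suc j)} (λ j → mem (suc j)))

  span-trans : ∀ {d g m} {h : Fin m → A → ℤ} {b} → (∀ j → InSpan d g (h j)) → InSpan m h b → InSpan d g b
  span-trans {d} {g} {m} {h} {b} mem (s , p) with span-lin m s {h} mem
  ... | t , q = t , map₂ {λ x → b x ≡ lin m s h x} {λ x → lin m s h x ≡ lin d t g x} (λ x → trans) p q

  Q-∀Fin : ∀ d {P : Fin d → A → Set} → (∀ j → Q (P j)) → Q (λ x → ∀ j → P j x)
  Q-∀Fin zero    q = pure λ x ()
  Q-∀Fin (suc d) {P} q = map₂ {P zero} {λ x → ∀ j → P (suc j) x}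
    (λ { x p ps zero → p ; x p ps (suc j) → ps j }) (q zero) (Q-∀Fin d (λ j → q (suc j)))

  -- A single c has to serve all m families, so their coordinate vectors are concatenated: D vectors
  -- in a space of dimension m d. D is a variable tied by an equation, so that callers can keep the
  -- number of vectors abstract.
  span-dependent : ∀ d (g : Fin d → A → ℤ) m {D} → D ≡ suc (m ℕ.* d) → (b : Fin m → Fin D → A → ℤ) →
    (∀ J h → InSpan d g (b J h)) →
    Σ (Fin D → ℤ) λ c → (∃[ h ] c h ≢ 0ℤ) × (∀ J → Q (λ x → sumFin D (λ h → c h * b J h x) ≡ 0ℤ))
  span-dependent d g m {D} refl b mem with dependent (m ℕ.* d)
    (λ h idx → proj₁ (mem (proj₁ (remQuot {m} d idx)) h) (proj₂ (remQuot {m} d idx)))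
  ... | c , nz , rel = c , nz , λ J →
      map₁ {λ x → ∀ h → b J h x ≡ lin d (t J h) g x}
        (λ x e → trans (sum-cong D (λ h → cong (c h *_) (e h))) (vanish J x))
        (Q-∀Fin D (λ h → proj₂ (mem J h)))
    where
    t : ∀ J h → Fin d → ℤ
    t J h = proj₁ (mem J h)
    rel′ : ∀ J i → sumFin D (λ h → c h * t J h i) ≡ 0ℤ
    rel′ J i = subst (λ p → sumFin D (λ h → c h * t (proj₁ p) h (proj₂ p)) ≡ 0ℤ)
                     (remQuot-combine J i) (rel (combine J i))
    vanish : ∀ J x → sumFin D (λ h → c h * lin d (t J h) g x) ≡ 0ℤ
    vanish J x =
      trans (sum-cong D (λ h → sym (sum-* d (c h) (λ i → t J h i * g i x))))
     (trans (sum-swap D d (λ h i → c h * (t J h i * g i x)))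
     (sum-zero d λ i →
       trans (sum-cong D (λ h → regroup (c h) (t J h i) (g i x)))
      (trans (sum-* D (g i x) (λ h → c h * t J h i))
      (trans (cong (g i x *_) (rel′ J i)) (ℤ.*-zeroʳ (g i x))))))
      where
      regroup : ∀ c t y → c * (t * y) ≡ y * (c * t)
      regroup = solve-∀

module Exact = Span {ℕ} (λ P → ∀ n → P n) (λ p → p) (λ f p q n → f n (p n) (q n))
module Asym  = Span {ℕ} AE AE-pure AE-map₂

Exact⇒Asym : ∀ {d g b} → Exact.InSpan d g b → Asym.InSpan d g b
Exact⇒Asym (t , p) = t , AE-pure p

exact-∘ : ∀ {d g b} (σ : ℕ → ℕ) → Exact.InSpan d g b → Exact.InSpan d (λ j n → g j (σ n)) (λ n → b (σ n))
exact-∘ σ (t , p) = t , λ n → p (σ n)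

asym-affine : ∀ {d g b} A B → 1 ≤ A → Asym.InSpan d g b →
  Asym.InSpan d (λ j n → g j (A ℕ.* n ℕ.+ B)) (λ n → b (A ℕ.* n ℕ.+ B))
asym-affine {d} {g} {b} A B 1≤A (t , p) = t , AE-affine {λ n → b n ≡ Asym.lin d t g n} A B 1≤A p

++-elim : ∀ {m n} (xs : Fin m → Seq) (ys : Fin n → Seq) (P : Seq → Set) →
  (∀ i → P (xs i)) → (∀ i → P (ys i)) → ∀ j → P ((xs ++ ys) j)
++-elim {m} xs ys P px py j with splitAt m j
... | inj₁ i = px i
... | inj₂ i = py i

module _ {Q : (ℕ → Set) → Set} (pure : ∀ {P} → (∀ x → P x) → Q P)
         (map₂ : ∀ {P P′ P″ : ℕ → Set} → (∀ x → P x → P′ x → P″ x) → Q P → Q P′ → Q P″) where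
  private module S = Span Q pure map₂

  span-++ˡ : ∀ {m n} {xs : Fin m → Seq} {ys : Fin n → Seq} {b} → S.InSpan m xs b → S.InSpan (m ℕ.+ n) (xs ++ ys) b
  span-++ˡ {m} {n} {xs} {ys} {b} = S.span-trans {b = b} λ i →
    subst (S.InSpan (m ℕ.+ n) (xs ++ ys)) (lookup-++ˡ xs ys i) (S.span-mem (xs ++ ys) (i ↑ˡ n))

  span-++ʳ : ∀ {m n} {xs : Fin m → Seq} {ys : Fin n → Seq} {b} → S.InSpan n ys b → S.InSpan (m ℕ.+ n) (xs ++ ys) b
  span-++ʳ {m} {n} {xs} {ys} {b} = S.span-trans {b = b} λ i →
    subst (S.InSpan (m ℕ.+ n) (xs ++ ys)) (lookup-++ʳ xs ys i) (S.span-mem (xs ++ ys) (m ↑ʳ i))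

-- Finite rank of the subsequences along ℓ^e ℕ + x

module _ (ℓ : ℕ) where

  -- One tuple of generators serves every scale e; all counting arguments rest on `dim` not growing
  -- with e.
  record Finite {m} (b : Fin m → Seq) : Set where
    constructor finite
    field
      dim   : ℕ
      gens  : Fin dim → Seq
      spans : ∀ j e x → x < ℓ ^ e → Asym.InSpan dim gens (λ n → b j (ℓ ^ e ℕ.* n ℕ.+ x))

  Finite₁ : Seq → Set
  Finite₁ b = Finite {1} (λ _ → b)

  finite-family : ∀ {m} (b : Fin m → Seq) → (∀ j → Finite₁ (b j)) → Finite b
  finite-family {zero}  b fin = finite 0 (λ ()) (λ ())
  finite-family {suc m} b fin with fin zero | finite-family (λ j → b (suc j)) (λ j → fin (suc j))
  ... | finite d g spans | finite d′ g′ spans′ = finite (d ℕ.+ d′) (g ++ g′) λ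
    { zero    e x x< → span-++ˡ AE-pure AE-map₂ {b = λ n → b zero (ℓ ^ e ℕ.* n ℕ.+ x)} (spans zero e x x<)
    ; (suc j) e x x< → span-++ʳ AE-pure AE-map₂ {m = d} {xs = g} {b = λ n → b (suc j) (ℓ ^ e ℕ.* n ℕ.+ x)} (spans′ j e x x<) }

  finite-lin : ∀ {m} (t : Fin m → ℤ) {b : Fin m → Seq} → Finite b → Finite₁ (Exact.lin m t b)
  finite-lin {m} t {b} (finite d g spans) = finite d g λ _ e x x< →
    Asym.span-lin m t {λ j n → b j (ℓ ^ e ℕ.* n ℕ.+ x)} (λ j → spans j e x x<)

  module _ (1≤ℓ : 1 ≤ ℓ) where

    -- Division by ℓ^e gives A (ℓ^e n + x) + B = ℓ^e (A n + q) + y′ with y′ < ℓ^e. The carry q stays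
    -- below A + B whatever e is, so d (A + B) substituted generators suffice for all scales.
    finite-affine : ∀ A B → 1 ≤ A → ∀ {b} → Finite₁ b → Finite₁ (λ n → b (A ℕ.* n ℕ.+ B))
    finite-affine A B 1≤A {b} (finite d g spans) = finite (d ℕ.* (A ℕ.+ B)) G λ _ e x x< →
      let instance
            ℓ≢0 : NonZero ℓ
            ℓ≢0 = ℕ.>-nonZero 1≤ℓ
            ℓ^e≢0 : NonZero (ℓ ^ e)
            ℓ^e≢0 = ℕ.m^n≢0 ℓ e
          y  = A ℕ.* x ℕ.+ B
          q  = y ℕ./ ℓ ^ e
          q< = ℕ.m<n*o⇒m/o<n {y} {A ℕ.+ B} (bound x< (ℕ.m^n>0 ℓ e))
          base = Asym.span-resp
            {b = λ n → b (ℓ ^ e ℕ.* (A ℕ.* n ℕ.+ q) ℕ.+ y ℕ.% ℓ ^ e)}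
            (λ n → cong b (trans (rearrange A (ℓ ^ e) n x B)
              (trans (cong (ℓ ^ e ℕ.* (A ℕ.* n) ℕ.+_) (ℕ.m≡m%n+[m/n]*n y (ℓ ^ e)))
                     (collect (ℓ ^ e) (A ℕ.* n) (y ℕ.% ℓ ^ e) q))))
            (asym-affine {b = λ n → b (ℓ ^ e ℕ.* n ℕ.+ y ℕ.% ℓ ^ e)} A q 1≤A (spans zero e (y ℕ.% ℓ ^ e) (ℕ.m%n<n y (ℓ ^ e))))
      in Asym.span-trans {b = λ n → b (A ℕ.* (ℓ ^ e ℕ.* n ℕ.+ x) ℕ.+ B)} (λ i → subst (Asym.InSpan (d ℕ.* (A ℕ.+ B)) G) (select i q q<)
           (Asym.span-mem G (combine i (fromℕ< q<)))) base
      where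
      shift : Fin d × Fin (A ℕ.+ B) → Seq
      shift (i , q) n = g i (A ℕ.* n ℕ.+ toℕ q)
      G : Fin (d ℕ.* (A ℕ.+ B)) → Seq
      G idx = shift (remQuot {d} (A ℕ.+ B) idx)
      select : ∀ i q (q< : q < A ℕ.+ B) → G (combine i (fromℕ< q<)) ≡ λ n → g i (A ℕ.* n ℕ.+ q)
      select i q q< = trans (cong shift (remQuot-combine i (fromℕ< q<)))
                            (cong (λ y n → g i (A ℕ.* n ℕ.+ y)) (toℕ-fromℕ< q<))
      rearrange : ∀ A L n x B → A ℕ.* (L ℕ.* n ℕ.+ x) ℕ.+ B ≡ L ℕ.* (A ℕ.* n) ℕ.+ (A ℕ.* x ℕ.+ B)
      rearrange = ℕ-Solver.solve-∀
      collect : ∀ L n r q → L ℕ.* n ℕ.+ (r ℕ.+ q ℕ.* L) ≡ L ℕ.* (n ℕ.+ q) ℕ.+ r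
      collect = ℕ-Solver.solve-∀
      bound : ∀ {x L} → x < L → 0 < L → A ℕ.* x ℕ.+ B < (A ℕ.+ B) ℕ.* L
      bound {x} {L} x<L 0<L = begin-strict
        A ℕ.* x ℕ.+ B           <⟨ ℕ.+-monoˡ-< B (ℕ.*-monoʳ-< A {{ℕ.>-nonZero 1≤A}} x<L) ⟩
        A ℕ.* L ℕ.+ B           ≤⟨ ℕ.+-monoʳ-≤ (A ℕ.* L) (ℕ.m≤m*n B L {{ℕ.>-nonZero 0<L}}) ⟩
        A ℕ.* L ℕ.+ B ℕ.* L     ≡⟨ sym (ℕ.*-distribʳ-+ L A B) ⟩
        (A ℕ.+ B) ℕ.* L         ∎
        where open ℕ.≤-Reasoning

-- Quasi-polynomials and the class 𝒞

diff : ℕ → Seq → Seq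
diff q X n = X (n ℕ.+ q) - X n

diff^ : ℕ → ℕ → Seq → Seq
diff^ q zero    X = X
diff^ q (suc N) X = diff^ q N (diff q X)

diff^-resp : ∀ q N {X Y} → X ≐ Y → diff^ q N X ≐ diff^ q N Y
diff^-resp q zero    eq = eq
diff^-resp q (suc N) eq = diff^-resp q N (λ n → cong₂ _-_ (eq (n ℕ.+ q)) (eq n))

diff^-lin : ∀ q N a b X Y → diff^ q N (λ n → a * X n + b * Y n) ≐ λ n → a * diff^ q N X n + b * diff^ q N Y n
diff^-lin q zero    a b X Y n = refl
diff^-lin q (suc N) a b X Y n = trans
  (diff^-resp q N (λ n → regroup a b (X (n ℕ.+ q)) (X n) (Y (n ℕ.+ q)) (Y n)) n)
  (diff^-lin q N a b (diff q X) (diff q Y) n)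
  where
  regroup : ∀ a b x x′ y y′ → (a * x + b * y) - (a * x′ + b * y′) ≡ a * (x - x′) + b * (y - y′)
  regroup = solve-∀

diff^-affine : ∀ q N a b X n → diff^ (a ℕ.* q) N X (a ℕ.* n ℕ.+ b) ≡ diff^ q N (λ n → X (a ℕ.* n ℕ.+ b)) n
diff^-affine q zero    a b X n = refl
diff^-affine q (suc N) a b X n = trans (diff^-affine q N a b (diff (a ℕ.* q) X) n)
  (diff^-resp q N (λ n → cong (λ y → X y - X (a ℕ.* n ℕ.+ b)) (shift a n b q)) n)
  where
  shift : ∀ a n b q → a ℕ.* n ℕ.+ b ℕ.+ a ℕ.* q ≡ a ℕ.* (n ℕ.+ q) ℕ.+ b
  shift = ℕ-Solver.solve-∀

diff^-outer : ∀ q N X → diff^ q (suc N) X ≐ diff q (diff^ q N X)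
diff^-outer q zero    X n = refl
diff^-outer q (suc N) X n = diff^-outer q N (diff q X) n

Killed : ℕ → ℕ → Seq → Set
Killed q N X = ∀ n → diff^ q N X n ≡ 0ℤ

killed-0 : ∀ q N → Killed q N (λ _ → 0ℤ)
killed-0 q zero    n = refl
killed-0 q (suc N) n = killed-0 q N n

killed-suc : ∀ q N {X} → Killed q N X → Killed q (suc N) X
killed-suc q N {X} z n = trans (diff^-outer q N X n) (cong₂ _-_ (z (n ℕ.+ q)) (z n))

killed-≤ : ∀ q {N N′ X} → N ≤ N′ → Killed q N X → Killed q N′ X
killed-≤ q {N} {N′} {X} N≤N′ z = subst (λ m → Killed q m X) (ℕ.m∸n+n≡m N≤N′) (raise (N′ ℕ.∸ N))
  where
  raise : ∀ m → Killed q (m ℕ.+ N) X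
  raise zero    = z
  raise (suc m) = killed-suc q (m ℕ.+ N) (raise m)

killed-+ : ∀ q N {X Y} → Killed q N X → Killed q N Y → Killed q N (λ n → X n + Y n)
killed-+ q N {X} {Y} zx zy n = trans (diff^-resp q N (λ n → sym (cong₂ _+_ (ℤ.*-identityˡ (X n)) (ℤ.*-identityˡ (Y n)))) n)
  (trans (diff^-lin q N 1ℤ 1ℤ X Y n) (cong₂ (λ x y → 1ℤ * x + 1ℤ * y) (zx n) (zy n)))

killed-* : ∀ q N c {X} → Killed q N X → Killed q N (λ n → c * X n)
killed-* q N c {X} z n = trans (diff^-resp q N (λ n → sym (trans (cong (c * X n +_) (ℤ.*-zeroˡ (X n))) (ℤ.+-identityʳ (c * X n)))) n)
  (trans (diff^-lin q N c 0ℤ X X n) (trans (cong₂ (λ x y → c * x + 0ℤ * y) (z n) (z n)) (collapse c)))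
  where
  collapse : ∀ c → c * 0ℤ + 0ℤ * 0ℤ ≡ 0ℤ
  collapse = solve-∀

killed-lin : ∀ q N m t {g : Fin m → Seq} → (∀ j → Killed q N (g j)) → Killed q N (Exact.lin m t g)
killed-lin q N zero    t z = killed-0 q N
killed-lin q N (suc m) t {g} z = killed-+ q N {λ n → t zero * g zero n}
  (killed-* q N (t zero) (z zero)) (killed-lin q N m (λ j → t (suc j)) (λ j → z (suc j)))

killed-shift : ∀ q N b {X} → Killed q N X → Killed q N (λ n → X (n ℕ.+ b))
killed-shift q N b {X} z n = trans
  (trans (diff^-resp q N (λ n → cong (λ y → X (y ℕ.+ b)) (sym (ℕ.*-identityˡ n))) n)
         (sym (diff^-affine q N 1 b X n)))
  (subst (λ p → diff^ p N X (1 ℕ.* n ℕ.+ b) ≡ 0ℤ) (sym (ℕ.*-identityˡ q)) (z _))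

-- Telescoping: E^{aq} - 1 is a multiple of E^q - 1.
killed-multiple : ∀ q N a {X} → Killed q N X → Killed (a ℕ.* q) N X
killed-multiple q zero    a z = z
killed-multiple q (suc N) a {X} z = killed-multiple q N a (telescope a)
  where
  telescope : ∀ a → Killed q N (diff (a ℕ.* q) X)
  telescope zero n = trans (diff^-resp q N (λ n → trans (cong (λ y → X y - X n) (ℕ.+-identityʳ n)) (ℤ.+-inverseʳ (X n))) n)
                           (killed-0 q N n)
  telescope (suc a) n = trans
    (diff^-resp q N (λ n → trans (cong (λ y → X y - X n) (assoc n q (a ℕ.* q)))
                                 (split (X (n ℕ.+ a ℕ.* q ℕ.+ q)) (X (n ℕ.+ a ℕ.* q)) (X n))) n)
    (killed-+ q N {λ n → diff q X (n ℕ.+ a ℕ.* q)} {diff (a ℕ.* q) X} (killed-shift q N (a ℕ.* q) z) (telescope a) n)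
    where
    assoc : ∀ n q y → n ℕ.+ (q ℕ.+ y) ≡ n ℕ.+ y ℕ.+ q
    assoc = ℕ-Solver.solve-∀
    split : ∀ x y z → x - z ≡ (x - y) + (y - z)
    split = solve-∀

killed-affine : ∀ q N a b {X} → Killed q N X → Killed q N (λ n → X (a ℕ.* n ℕ.+ b))
killed-affine q N a b {X} z n = trans (sym (diff^-affine q N a b X n)) (killed-multiple q N a z _)

binomial : ℕ → Seq
binomial zero    n       = 1ℤ
binomial (suc j) zero    = 0ℤ
binomial (suc j) (suc n) = binomial (suc j) n + binomial j n

diff-binomial : ∀ j → diff 1 (binomial (suc j)) ≐ binomial j
diff-binomial j n rewrite ℕ.+-comm n 1 = cancel (binomial (suc j) n) (binomial j n)
  where
  cancel : ∀ x y → (x + y) - x ≡ y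
  cancel = solve-∀

diff^-binomial : ∀ j → diff^ 1 j (binomial j) ≐ λ _ → 1ℤ
diff^-binomial zero    n = refl
diff^-binomial (suc j) n = trans (diff^-resp 1 j (diff-binomial j) n) (diff^-binomial j n)

killed-binomial : ∀ j → Killed 1 (suc j) (binomial j)
killed-binomial j n = trans (diff^-outer 1 j (binomial j) n)
  (cong₂ _-_ (diff^-binomial j (n ℕ.+ 1)) (diff^-binomial j n))

-- Newton's forward difference formula. The binomial basis keeps the coefficients integral, which
-- monomials would not.
newton : ∀ N {X} → Killed 1 N X → Exact.InSpan N (λ j → binomial (toℕ j)) X
newton zero    z = (λ ()) , z
newton (suc N) {X} z with newton N z
... | c , eq = c′ , expand
  where
  c′ : Fin (suc N) → ℤ
  c′ zero    = X 0
  c′ (suc j) = c j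
  expand : ∀ n → X n ≡ Exact.lin (suc N) c′ (λ j → binomial (toℕ j)) n
  expand zero = sym (trans (cong₂ _+_ (ℤ.*-identityʳ (X 0)) (sum-zero N (λ j → ℤ.*-zeroʳ (c j)))) (ℤ.+-identityʳ (X 0)))
  expand (suc n) = trans (step n)
    (trans (cong₂ _+_ (expand n) (eq n))
    (trans (ℤ.+-assoc (X 0 * 1ℤ) S (Exact.lin N c (λ j → binomial (toℕ j)) n))
    (cong (X 0 * 1ℤ +_)
      (trans (sym (sum-+ N (λ j → c j * binomial (suc (toℕ j)) n) (λ j → c j * binomial (toℕ j) n)))
             (sum-cong N (λ j → sym (ℤ.*-distribˡ-+ (c j) (binomial (suc (toℕ j)) n) (binomial (toℕ j) n))))))))
    where
    S = sumFin N (λ j → c j * binomial (suc (toℕ j)) n)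
    step : ∀ n → X (suc n) ≡ X n + (X (n ℕ.+ 1) - X n)
    step n rewrite ℕ.+-comm n 1 = restore (X (suc n)) (X n)
      where
      restore : ∀ x y → x ≡ y + (x - y)
      restore = solve-∀

record System (k ℓ : ℕ) : Set where
  constructor system
  field
    dim      : ℕ
    seqs     : Fin dim → Seq
    closed   : ∀ j r → r < k → Exact.InSpan dim seqs (λ n → seqs j (k ℕ.* n ℕ.+ r))
    finitary : Finite ℓ seqs

-- Lying in the span of some system replaces regularity because it passes to sums and substitutions
-- by mere juxtaposition of systems. `IsRegular` asks for generators inside the module M_k(b)
-- itself, and restoring that after each operation would require that submodules of ℤ^d are finitely
-- generated.
_∈𝒞[_,_] : Seq → ℕ → ℕ → Set
b ∈𝒞[ k , ℓ ] = Σ (System k ℓ) λ S → Exact.InSpan (System.dim S) (System.seqs S) b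

module _ {k ℓ : ℕ} where

  𝒞-resp : ∀ {b b′} → b′ ≐ b → b ∈𝒞[ k , ℓ ] → b′ ∈𝒞[ k , ℓ ]
  𝒞-resp {b} eq (S , mem) = S , Exact.span-resp {b = b} eq mem

  𝒞-* : ∀ c {b} → b ∈𝒞[ k , ℓ ] → (λ n → c * b n) ∈𝒞[ k , ℓ ]
  𝒞-* c {b} (S , mem) = S , Exact.span-* {b = b} c mem

  𝒞-+ : ∀ {b b′} → b ∈𝒞[ k , ℓ ] → b′ ∈𝒞[ k , ℓ ] → (λ n → b n + b′ n) ∈𝒞[ k , ℓ ]
  𝒞-+ {b} {b′} (system d V closed fin , mem) (system d′ V′ closed′ fin′ , mem′) =
    system (d ℕ.+ d′) (V ++ V′)
      (++-elim V V′ (λ X → ∀ r → r < k → Exact.InSpan (d ℕ.+ d′) (V ++ V′) (λ n → X (k ℕ.* n ℕ.+ r)))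
        (λ i r r<k → left {λ n → V i (k ℕ.* n ℕ.+ r)} (closed i r r<k))
        (λ i r r<k → right {λ n → V′ i (k ℕ.* n ℕ.+ r)} (closed′ i r r<k)))
      (finite-family ℓ (V ++ V′) (++-elim V V′ (Finite₁ ℓ) (single fin) (single fin′))) ,
    Exact.span-+ {b = b} {b′ = b′} (left {b} mem) (right {b′} mem′)
    where
    left : ∀ {b} → Exact.InSpan d V b → Exact.InSpan (d ℕ.+ d′) (V ++ V′) b
    left {b} = span-++ˡ {λ P → ∀ n → P n} (λ p → p) (λ f p q n → f n (p n) (q n)) {b = b}
    right : ∀ {b} → Exact.InSpan d′ V′ b → Exact.InSpan (d ℕ.+ d′) (V ++ V′) b
    right {b} = span-++ʳ {λ P → ∀ n → P n} (λ p → p) (λ f p q n → f n (p n) (q n)) {m = d} {xs = V} {b = b}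
    single : ∀ {m} {W : Fin m → Seq} → Finite ℓ W → ∀ i → Finite₁ ℓ (W i)
    single (finite e g spans) i = finite e g λ _ → spans i

  module _ (1≤k : 1 ≤ k) (1≤ℓ : 1 ≤ ℓ) where
    private instance
      k≢0 : NonZero k
      k≢0 = ℕ.>-nonZero 1≤k

    𝒞-affine : ∀ q x → 1 ≤ q → ∀ {b} → b ∈𝒞[ k , ℓ ] → (λ n → b (q ℕ.* n ℕ.+ x)) ∈𝒞[ k , ℓ ]
    𝒞-affine q x 1≤q {b} (system d V closed (finite e g spans) , t , eq) =
      system (d ℕ.* X) W closed′
        (finite-family ℓ W λ idx → let (i , y) = remQuot {d} X idx in
          finite-affine ℓ 1≤ℓ q (toℕ y) 1≤q {V i} (finite e g λ _ → spans i)) ,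
      Exact.span-trans {h = λ i n → V i (q ℕ.* n ℕ.+ x)} {b = λ n → b (q ℕ.* n ℕ.+ x)}
        (λ i → member i x (s≤s (ℕ.m≤n+m x q))) (t , λ n → eq (q ℕ.* n ℕ.+ x))
      where
      -- Offsets below X are stable under the carry: q ≤ X, r < k and y < X give q r + y < X k. The
      -- given offset x is among them.
      X = suc (q ℕ.+ x)
      shifted : Fin d × Fin X → Seq
      shifted (i , y) n = V i (q ℕ.* n ℕ.+ toℕ y)
      W : Fin (d ℕ.* X) → Seq
      W idx = shifted (remQuot {d} X idx)
      member : ∀ i y → y < X → Exact.InSpan (d ℕ.* X) W (λ n → V i (q ℕ.* n ℕ.+ y))
      member i y y<X = subst (Exact.InSpan (d ℕ.* X) W)
        (trans (cong shifted (remQuot-combine i (fromℕ< y<X)))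
               (cong (λ z n → V i (q ℕ.* n ℕ.+ z)) (toℕ-fromℕ< y<X)))
        (Exact.span-mem W (combine i (fromℕ< y<X)))
      -- q (k n + r) + y = k (q n + ⌊(q r + y) / k⌋) + ((q r + y) mod k)
      carry : ∀ i r y → r < k → y < X → Exact.InSpan (d ℕ.* X) W (λ n → V i (q ℕ.* (k ℕ.* n ℕ.+ r) ℕ.+ y))
      carry i r y r<k y<X = Exact.span-resp {b = λ n → V i (k ℕ.* (q ℕ.* n ℕ.+ z ℕ./ k) ℕ.+ z ℕ.% k)}
        (λ n → cong (V i) (trans (rearrange q k n r y)
          (trans (cong (k ℕ.* (q ℕ.* n) ℕ.+_) (ℕ.m≡m%n+[m/n]*n z k)) (collect k (q ℕ.* n) (z ℕ.% k) (z ℕ./ k)))))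
        (Exact.span-trans {h = λ j n → V j (q ℕ.* n ℕ.+ z ℕ./ k)} {b = λ n → V i (k ℕ.* (q ℕ.* n ℕ.+ z ℕ./ k) ℕ.+ z ℕ.% k)}
          (λ j → member j (z ℕ./ k) (ℕ.m<n*o⇒m/o<n {z} {X} bound))
          (exact-∘ {b = λ n → V i (k ℕ.* n ℕ.+ z ℕ.% k)} (λ n → q ℕ.* n ℕ.+ z ℕ./ k) (closed i (z ℕ.% k) (ℕ.m%n<n z k))))
        where
        z = q ℕ.* r ℕ.+ y
        rearrange : ∀ q k n r y → q ℕ.* (k ℕ.* n ℕ.+ r) ℕ.+ y ≡ k ℕ.* (q ℕ.* n) ℕ.+ (q ℕ.* r ℕ.+ y)
        rearrange = ℕ-Solver.solve-∀
        collect : ∀ k n r z → k ℕ.* n ℕ.+ (r ℕ.+ z ℕ.* k) ≡ k ℕ.* (n ℕ.+ z) ℕ.+ r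
        collect = ℕ-Solver.solve-∀
        bound : z < X ℕ.* k
        bound = begin-strict
          q ℕ.* r ℕ.+ y <⟨ ℕ.+-monoʳ-< (q ℕ.* r) y<X ⟩
          q ℕ.* r ℕ.+ X ≤⟨ ℕ.+-monoˡ-≤ X (ℕ.*-monoˡ-≤ r (ℕ.m≤n⇒m≤1+n (ℕ.m≤m+n q x))) ⟩
          X ℕ.* r ℕ.+ X ≡⟨ trans (ℕ.+-comm (X ℕ.* r) X) (sym (ℕ.*-suc X r)) ⟩
          X ℕ.* suc r   ≤⟨ ℕ.*-monoʳ-≤ X r<k ⟩
          X ℕ.* k       ∎
          where open ℕ.≤-Reasoning
      closed′ : ∀ idx r → r < k → Exact.InSpan (d ℕ.* X) W (λ n → W idx (k ℕ.* n ℕ.+ r))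
      closed′ idx r r<k = carry (proj₁ (remQuot {d} X idx)) r (toℕ (proj₂ (remQuot {d} X idx))) r<k
                                (toℕ<n (proj₂ (remQuot {d} X idx)))

    𝒞-diff : ∀ {b} → b ∈𝒞[ k , ℓ ] → diff 1 b ∈𝒞[ k , ℓ ]
    𝒞-diff {b} mem = 𝒞-resp {b = λ n → b (1 ℕ.* n ℕ.+ 1) + (- 1ℤ) * b n} (λ n → trans (negate (b (n ℕ.+ 1)) (b n))
        (cong (λ y → b (y ℕ.+ 1) + (- 1ℤ) * b n) (sym (ℕ.*-identityˡ n))))
      (𝒞-+ {λ n → b (1 ℕ.* n ℕ.+ 1)} {λ n → (- 1ℤ) * b n} (𝒞-affine 1 1 ℕ.≤-refl mem) (𝒞-* (- 1ℤ) mem))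
      where
      negate : ∀ x y → x - y ≡ x + (- 1ℤ) * y
      negate = solve-∀

    𝒞-diff^ : ∀ N {b} → b ∈𝒞[ k , ℓ ] → diff^ 1 N b ∈𝒞[ k , ℓ ]
    𝒞-diff^ zero    mem = mem
    𝒞-diff^ (suc N) mem = 𝒞-diff^ N (𝒞-diff mem)

    -- Affine substitution does not raise the degree, so the binomials of degree below N serve both
    -- as a closed system in base k and as generators for all scales ℓ^e.
    𝒞-killed : ∀ N {X} → Killed 1 N X → X ∈𝒞[ k , ℓ ]
    𝒞-killed N {X} z = system N (λ j → binomial (toℕ j))
      (λ j r _ → newton N (killed-affine 1 N k r (low j)))
      (finite N (λ j → binomial (toℕ j)) λ j e x _ → Exact⇒Asym (newton N (killed-affine 1 N (ℓ ^ e) x (low j)))) ,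
      newton N z
      where
      low : ∀ (j : Fin N) → Killed 1 N (binomial (toℕ j))
      low j = killed-≤ 1 (toℕ<n j) (killed-binomial (toℕ j))

-- A shift relation

module _ {k ℓ : ℕ} (2≤k : 2 ≤ k) (2≤ℓ : 2 ≤ ℓ) (S : System k ℓ) where
  open System S renaming (dim to d; seqs to V)

  private
    instance
      k≢0 : NonZero k
      k≢0 = ℕ.>-nonZero (ℕ.<⇒≤ 2≤k)
      ℓ≢0 : NonZero ℓ
      ℓ≢0 = ℕ.>-nonZero (ℕ.<⇒≤ 2≤ℓ)

  closed-^ : ∀ i j y → y < k ^ i → Exact.InSpan d V (λ n → V j (k ^ i ℕ.* n ℕ.+ y))
  closed-^ zero    j zero y< = Exact.span-resp {b = V j}
    (λ n → cong (V j) (trans (ℕ.+-identityʳ (1 ℕ.* n)) (ℕ.*-identityˡ n))) (Exact.span-mem V j)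
  closed-^ zero    j (suc y) (s≤s ())
  closed-^ (suc i) j y y< = Exact.span-resp {b = λ n → V j (k ℕ.* (k ^ i ℕ.* n ℕ.+ y ℕ./ k) ℕ.+ y ℕ.% k)}
    (λ n → cong (V j) (trans (cong (k ^ suc i ℕ.* n ℕ.+_) (ℕ.m≡m%n+[m/n]*n y k))
                             (nest k (k ^ i) n (y ℕ.% k) (y ℕ./ k))))
    (Exact.span-trans {h = λ l n → V l (k ^ i ℕ.* n ℕ.+ y ℕ./ k)}
                      {b = λ n → V j (k ℕ.* (k ^ i ℕ.* n ℕ.+ y ℕ./ k) ℕ.+ y ℕ.% k)}
      (λ l → closed-^ i l (y ℕ./ k) (ℕ.m<n*o⇒m/o<n {y} {k ^ i} (subst (y <_) (ℕ.*-comm k (k ^ i)) y<)))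
      (exact-∘ {b = λ n → V j (k ℕ.* n ℕ.+ y ℕ.% k)} (λ n → k ^ i ℕ.* n ℕ.+ y ℕ./ k) (closed j (y ℕ.% k) (ℕ.m%n<n y k))))
    where
    nest : ∀ k K n r q → k ℕ.* K ℕ.* n ℕ.+ (r ℕ.+ q ℕ.* k) ≡ k ℕ.* (K ℕ.* n ℕ.+ q) ℕ.+ r
    nest = ℕ-Solver.solve-∀

  relation-span : ∀ H (c : Fin H → ℤ) (σ : Fin H → ℕ → ℕ) →
    (∀ j → AE (λ n → sumFin H (λ h → c h * V j (σ h n)) ≡ 0ℤ)) →
    ∀ {b} → Exact.InSpan d V b → AE (λ n → sumFin H (λ h → c h * b (σ h n)) ≡ 0ℤ)
  relation-span H c σ rel {b} (t , eq) = AE-map (λ n rels →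
      trans (sum-cong H (λ h → trans (cong (c h *_) (eq (σ h n))) (sym (sum-* d (c h) (λ j → t j * V j (σ h n))))))
     (trans (sum-swap H d (λ h j → c h * (t j * V j (σ h n))))
     (sum-zero d λ j → trans (sum-cong H (λ h → regroup (c h) (t j) (V j (σ h n))))
       (trans (sum-* H (t j) (λ h → c h * V j (σ h n))) (trans (cong (t j *_) (rels j)) (ℤ.*-zeroʳ (t j)))))))
    (AE-∀Fin d rel)
    where
    regroup : ∀ c t y → c * (t * y) ≡ t * (c * y)
    regroup = solve-∀

  -- p(D)V ≃ 0 for a nonzero polynomial p and D : b(n) ↦ b(ℓn); e₀ is the order of vanishing of p at 0.
  scaling-stabilises : ∃[ e₀ ] ∀ b → Exact.InSpan d V b →
    ∀ t → AE (λ n → b (ℓ ^ (t ℕ.+ e₀) ℕ.* n) ≡ 0ℤ) → AE (λ n → b (ℓ ^ e₀ ℕ.* n) ≡ 0ℤ)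
  scaling-stabilises = stable (Asym.span-dependent g-dim gens d refl (λ j h n → V j (ℓ ^ toℕ h ℕ.* n ℕ.+ 0))
                                (λ j h → spans j (toℕ h) 0 (ℕ.m^n>0 ℓ (toℕ h))))
    where
    open Finite finitary renaming (dim to g-dim)
    H = suc (d ℕ.* g-dim)
    stable : (Σ (Fin H → ℤ) λ c → (∃[ h ] c h ≢ 0ℤ) ×
        (∀ j → AE (λ n → sumFin H (λ h → c h * V j (ℓ ^ toℕ h ℕ.* n ℕ.+ 0)) ≡ 0ℤ))) →
      ∃[ e₀ ] ∀ b → Exact.InSpan d V b →
      ∀ t → AE (λ n → b (ℓ ^ (t ℕ.+ e₀) ℕ.* n) ≡ 0ℤ) → AE (λ n → b (ℓ ^ e₀ ℕ.* n) ≡ 0ℤ)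
    stable (c , nz , rel) with lowest c nz
    ... | h₀ , c₀≢0 , low = e₀ , descend
      where
      e₀ = toℕ h₀
      descend : ∀ b → Exact.InSpan d V b →
        ∀ t → AE (λ n → b (ℓ ^ (t ℕ.+ e₀) ℕ.* n) ≡ 0ℤ) → AE (λ n → b (ℓ ^ e₀ ℕ.* n) ≡ 0ℤ)
      descend b mem zero    ae = ae
      -- The relation is taken at ℓ^t n. Its terms with h > h₀ vanish by assumption and those with h
      -- < h₀ have coefficient zero, so the term at ℓ^(t+e₀) n is isolated.
      descend b mem (suc t) ae = descend b mem t (AE-map₂
          {λ n → sumFin H (λ h → c h * b (ℓ ^ toℕ h ℕ.* (ℓ ^ t ℕ.* n) ℕ.+ 0)) ≡ 0ℤ}
          {λ n → ∀ h → toℕ h₀ < toℕ h → b (ℓ ^ toℕ h ℕ.* (ℓ ^ t ℕ.* n) ℕ.+ 0) ≡ 0ℤ}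
          (λ n r hi → subst (λ y → b y ≡ 0ℤ) (index e₀ n)
            (*-cancel-0 c₀≢0 (trans (sym (sum-single H h₀ (off n hi))) r)))
          (AE-scale {λ n → sumFin H (λ h → c h * b (ℓ ^ toℕ h ℕ.* n ℕ.+ 0)) ≡ 0ℤ} (ℓ ^ t) (ℕ.m^n>0 ℓ t)
            (relation-span H c (λ h n → ℓ ^ toℕ h ℕ.* n ℕ.+ 0) rel {b} mem))
          (AE-∀Fin H higher))
        where
        index : ∀ e n → ℓ ^ e ℕ.* (ℓ ^ t ℕ.* n) ℕ.+ 0 ≡ ℓ ^ (t ℕ.+ e) ℕ.* n
        index e n = trans (ℕ.+-identityʳ _) (trans (flip (ℓ ^ e) (ℓ ^ t) n)
          (cong (ℕ._* n) (sym (ℕ.^-distribˡ-+-* ℓ t e))))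
          where
          flip : ∀ x y n → x ℕ.* (y ℕ.* n) ≡ y ℕ.* x ℕ.* n
          flip = ℕ-Solver.solve-∀
        higher : ∀ h → AE (λ n → toℕ h₀ < toℕ h → b (ℓ ^ toℕ h ℕ.* (ℓ ^ t ℕ.* n) ℕ.+ 0) ≡ 0ℤ)
        higher h with e₀ ℕ.<? toℕ h
        ... | no ≮  = AE-pure λ n < → ⊥-elim (≮ <)
        ... | yes < = AE-map (λ n e _ → trans (cong b (trans (index (toℕ h) n) (trans
                (cong (λ y → ℓ ^ y ℕ.* n) exponent)
                (trans (cong (ℕ._* n) (ℕ.^-distribˡ-+-* ℓ (suc t ℕ.+ e₀) s)) (ℕ.*-assoc (ℓ ^ (suc t ℕ.+ e₀)) (ℓ ^ s) n))))) e)
              (AE-scale {λ n → b (ℓ ^ (suc t ℕ.+ e₀) ℕ.* n) ≡ 0ℤ} (ℓ ^ s) (ℕ.m^n>0 ℓ s) ae)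
          where
          s = toℕ h ℕ.∸ suc e₀
          exponent : t ℕ.+ toℕ h ≡ suc t ℕ.+ e₀ ℕ.+ s
          exponent = trans (cong (t ℕ.+_) (sym (ℕ.m+[n∸m]≡n <))) (assoc t e₀ s)
            where
            assoc : ∀ t e s → t ℕ.+ (suc e ℕ.+ s) ≡ suc t ℕ.+ e ℕ.+ s
            assoc = ℕ-Solver.solve-∀
        off : ∀ n → (∀ h → toℕ h₀ < toℕ h → b (ℓ ^ toℕ h ℕ.* (ℓ ^ t ℕ.* n) ℕ.+ 0) ≡ 0ℤ) →
          ∀ h → h ≢ h₀ → c h * b (ℓ ^ toℕ h ℕ.* (ℓ ^ t ℕ.* n) ℕ.+ 0) ≡ 0ℤ
        off n hi h h≢h₀ with ℕ.<-cmp (toℕ h) e₀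
        ... | tri< lt _ _ = trans (cong (_* b (ℓ ^ toℕ h ℕ.* (ℓ ^ t ℕ.* n) ℕ.+ 0)) (low h lt)) (ℤ.*-zeroˡ (b (ℓ ^ toℕ h ℕ.* (ℓ ^ t ℕ.* n) ℕ.+ 0)))
        ... | tri≈ _ eq _ = ⊥-elim (h≢h₀ (toℕ-injective eq))
        ... | tri> _ _ gt = trans (cong (c h *_) (hi h gt)) (ℤ.*-zeroʳ (c h))

  module _ (k⊥ℓ : Coprime k ℓ) where

    -- The relation c holds first along the progressions r + ℓ^E ℕ; cutting a base-K expansion at a
    -- place where the low part is divisible by ℓ^E, scaling-stabilises coarsens them to r + Q ℕ.
    module Coarsen (e₀ e₁ κ H : ℕ)
      (stable : ∀ b → Exact.InSpan d V b →
        ∀ t → AE (λ n → b (ℓ ^ (t ℕ.+ e₀) ℕ.* n) ≡ 0ℤ) → AE (λ n → b (ℓ ^ e₀ ℕ.* n) ≡ 0ℤ))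
      (2L≤K : 2 ℕ.* ℓ ^ (e₁ ℕ.+ e₀) ≤ k ^ κ)
      (offset< : ∀ {r} (h : Fin H) → r < ℓ ^ e₀ → r ℕ.+ toℕ h ℕ.* ℓ ^ e₀ < ℓ ^ (e₁ ℕ.+ e₀))
      (c : Fin H → ℤ)
      (coarse : ∀ j r → r < ℓ ^ e₀ → AE (λ n →
        sumFin H (λ h → c h * V j (ℓ ^ (e₁ ℕ.+ e₀) ℕ.* n ℕ.+ (r ℕ.+ toℕ h ℕ.* ℓ ^ e₀))) ≡ 0ℤ)) where
      private
        Q L K : ℕ
        Q = ℓ ^ e₀
        L = ℓ ^ (e₁ ℕ.+ e₀)
        K = k ^ κ
        U : Fin d → ℕ → Seq
        U j r n = sumFin H (λ h → c h * V j (n ℕ.+ (r ℕ.+ toℕ h ℕ.* Q)))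
      instance
        Q≢0 : NonZero Q
        Q≢0 = ℕ.m^n≢0 ℓ e₀
        L≢0 : NonZero L
        L≢0 = ℕ.m^n≢0 ℓ (e₁ ℕ.+ e₀)
        K≢0 : NonZero K
        K≢0 = ℕ.m^n≢0 k κ
      module Digit (j : Fin d) (r : ℕ) (r<Q : r < Q) (i s : ℕ) (s<Kⁱ : s < K ^ i) where
        Kⁱ⊥L : Coprime (K ^ i) L
        Kⁱ⊥L = subst (λ x → Coprime x L) (sym (ℕ.^-*-assoc k κ i)) (coprime-^ {k} {ℓ} (κ ℕ.* i) (e₁ ℕ.+ e₀) k⊥ℓ)
        congruence = solve-congruence {K ^ i} {L} Kⁱ⊥L s
        w = proj₁ congruence
        w<L = proj₁ (proj₂ congruence)
        y = K ^ i ℕ.* w ℕ.+ s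
        L∣y = proj₂ (proj₂ congruence)
        z = y ℕ./ L
        y≡ : y ≡ L ℕ.* z
        y≡ = sym (ℕ.m*[n/m]≡n L∣y)
        w<K : w < K
        w<K = ℕ.<-≤-trans w<L (ℕ.≤-trans (ℕ.m≤m+n L (L ℕ.+ 0)) 2L≤K)
        -- No carry leaves the lowest i + 1 digits in base K: of the bound 2 L ≤ K, one L makes room
        -- for the digit w < L and the other for the offset r + hQ < L. Hence b below is a fixed
        -- combination of V.
        low< : ∀ h → y ℕ.+ (r ℕ.+ toℕ h ℕ.* Q) < k ^ (κ ℕ.* suc i)
        low< h = begin-strict
          y ℕ.+ (r ℕ.+ toℕ h ℕ.* Q)        <⟨ ℕ.+-mono-<-≤ (ℕ.+-monoʳ-< (K ^ i ℕ.* w) s<Kⁱ) (ℕ.<⇒≤ (offset< h r<Q)) ⟩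
          K ^ i ℕ.* w ℕ.+ K ^ i ℕ.+ L      ≡⟨ cong (ℕ._+ L) (trans (ℕ.+-comm (K ^ i ℕ.* w) (K ^ i)) (sym (ℕ.*-suc (K ^ i) w))) ⟩
          K ^ i ℕ.* suc w ℕ.+ L            ≤⟨ ℕ.+-mono-≤ (ℕ.*-monoʳ-≤ (K ^ i) w<L) (ℕ.m≤n*m L (K ^ i) {{ℕ.m^n≢0 K i}}) ⟩
          K ^ i ℕ.* L ℕ.+ K ^ i ℕ.* L      ≡⟨ double (K ^ i) L ⟩
          2 ℕ.* L ℕ.* K ^ i                ≤⟨ ℕ.*-monoˡ-≤ (K ^ i) 2L≤K ⟩
          K ^ suc i                        ≡⟨ ℕ.^-*-assoc k κ (suc i) ⟩
          k ^ (κ ℕ.* suc i)                ∎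
          where
          open ℕ.≤-Reasoning
          double : ∀ x L → x ℕ.* L ℕ.+ x ℕ.* L ≡ 2 ℕ.* L ℕ.* x
          double = ℕ-Solver.solve-∀
        b : Seq
        b n = U j r (K ^ suc i ℕ.* n ℕ.+ y)
        b-span : Exact.InSpan d V b
        b-span = Exact.span-lin H c {λ h n → V j (K ^ suc i ℕ.* n ℕ.+ y ℕ.+ (r ℕ.+ toℕ h ℕ.* Q))} λ h →
          Exact.span-resp {b = λ n → V j (k ^ (κ ℕ.* suc i) ℕ.* n ℕ.+ (y ℕ.+ (r ℕ.+ toℕ h ℕ.* Q)))}
            (λ n → cong (V j) (trans (ℕ.+-assoc (K ^ suc i ℕ.* n) y (r ℕ.+ toℕ h ℕ.* Q))
              (cong (λ x → x ℕ.* n ℕ.+ (y ℕ.+ (r ℕ.+ toℕ h ℕ.* Q))) (ℕ.^-*-assoc k κ (suc i)))))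
            (closed-^ (κ ℕ.* suc i) j (y ℕ.+ (r ℕ.+ toℕ h ℕ.* Q)) (low< h))
        -- As L divides y, b(L n) evaluates the relation at a multiple of L, where `coarse` applies;
        -- `stable` then replaces L by Q.
        b-null : AE (λ n → b (Q ℕ.* n) ≡ 0ℤ)
        b-null = stable b b-span e₁
          (AE-map (λ n e → trans (cong (U j r) (regroup n)) e)
            (AE-affine {λ n → U j r (L ℕ.* n) ≡ 0ℤ} (K ^ suc i) z (ℕ.m^n>0 K (suc i)) (coarse j r r<Q)))
          where
          regroup : ∀ n → K ^ suc i ℕ.* (L ℕ.* n) ℕ.+ y ≡ L ℕ.* (K ^ suc i ℕ.* n ℕ.+ z)
          regroup n = trans (cong (K ^ suc i ℕ.* (L ℕ.* n) ℕ.+_) y≡) (factor (K ^ suc i) L n z)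
            where
            factor : ∀ x L n z → x ℕ.* (L ℕ.* n) ℕ.+ L ℕ.* z ≡ L ℕ.* (x ℕ.* n ℕ.+ z)
            factor = ℕ-Solver.solve-∀
        Q∣y : Q ∣ y
        Q∣y = ∣-trans (subst (Q ∣_) (sym (ℕ.^-distribˡ-+-* ℓ e₁ e₀)) (n∣m*n (ℓ ^ e₁))) L∣y
        Q∣n : ∀ n → Q ∣ K ^ suc i ℕ.* n ℕ.+ y → Q ∣ n
        Q∣n n Q∣ = coprime-divisor
          (Coprime.sym (subst (λ x → Coprime x Q) (sym (ℕ.^-*-assoc k κ (suc i))) (coprime-^ {k} {ℓ} (κ ℕ.* suc i) e₀ k⊥ℓ)))
          (∣m+n∣m⇒∣n (subst (Q ∣_) (ℕ.+-comm (K ^ suc i ℕ.* n) y) Q∣) Q∣y)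
        -- Q divides y and is coprime to K, so an argument divisible by Q forces Q ∣ n, which is
        -- where `b-null` has information.
        hit : AE (λ n → Q ∣ K ^ suc i ℕ.* n ℕ.+ y → U j r (K ^ suc i ℕ.* n ℕ.+ y) ≡ 0ℤ)
        hit = AE-map (λ n e Q∣ → trans (cong b (sym (exact n (Q∣n n Q∣)))) e) (AE-/ Q {λ n → b (Q ℕ.* n) ≡ 0ℤ} b-null)
          where
          exact : ∀ n → Q ∣ n → Q ℕ.* (n ℕ./ Q) ≡ n
          exact n Q∣n = ℕ.m*[n/m]≡n Q∣n
      on-multiples : ∀ j r → r < Q → AE (λ n → Q ∣ n → U j r n ≡ 0ℤ)
      on-multiples j r r<Q = AE-digits K (ℕ.m^n>0 k κ) (λ n → (Q ∣? n) →-dec (U j r n ℤ.≟ 0ℤ)) λ i s s<Kⁱ →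
        let open Digit j r r<Q i s s<Kⁱ in w , w<K , hit
      everywhere : ∀ j → AE (λ n → sumFin H (λ h → c h * V j (n ℕ.+ toℕ h ℕ.* Q)) ≡ 0ℤ)
      everywhere j = AE-residues Q {λ n → sumFin H (λ h → c h * V j (n ℕ.+ toℕ h ℕ.* Q)) ≡ 0ℤ} λ r r<Q →
        AE-map {λ n → Q ∣ Q ℕ.* n → U j r (Q ℕ.* n) ≡ 0ℤ} (λ n e → trans (reindex n r) (e (m∣m*n n)))
               (AE-scale {λ n → Q ∣ n → U j r n ≡ 0ℤ} Q (ℕ.m^n>0 ℓ e₀) (on-multiples j r r<Q))
        where
        regroup : ∀ n r x → n ℕ.* Q ℕ.+ r ℕ.+ x ≡ Q ℕ.* n ℕ.+ (r ℕ.+ x)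
        regroup n r x = trans (ℕ.+-assoc (n ℕ.* Q) r x) (cong (ℕ._+ (r ℕ.+ x)) (ℕ.*-comm n Q))
        reindex : ∀ n r → sumFin H (λ h → c h * V j (n ℕ.* Q ℕ.+ r ℕ.+ toℕ h ℕ.* Q)) ≡ U j r (Q ℕ.* n)
        reindex n r = sum-cong H {λ h → c h * V j (n ℕ.* Q ℕ.+ r ℕ.+ toℕ h ℕ.* Q)}
          {λ h → c h * V j (Q ℕ.* n ℕ.+ (r ℕ.+ toℕ h ℕ.* Q))} λ h → cong (λ x → c h * V j x) (regroup n r (toℕ h ℕ.* Q))

    module Dependence (e₀ e₁ H : ℕ) (H≡ : H ≡ suc (d ℕ.* ℓ ^ e₀ ℕ.* Finite.dim finitary)) (H≤ : H ≤ ℓ ^ e₁) where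
      private
        Q L : ℕ
        Q = ℓ ^ e₀
        L = ℓ ^ (e₁ ℕ.+ e₀)

      offset< : ∀ {r} (h : Fin H) → r < Q → r ℕ.+ toℕ h ℕ.* Q < L
      offset< {r} h r<Q = begin-strict
        r ℕ.+ toℕ h ℕ.* Q <⟨ ℕ.+-monoˡ-< (toℕ h ℕ.* Q) r<Q ⟩
        suc (toℕ h) ℕ.* Q ≤⟨ ℕ.*-monoˡ-≤ Q (ℕ.≤-trans (toℕ<n h) H≤) ⟩
        ℓ ^ e₁ ℕ.* Q      ≡⟨ sym (ℕ.^-distribˡ-+-* ℓ e₁ e₀) ⟩
        L                 ∎
        where open ℕ.≤-Reasoning

      sample : Fin d × Fin Q → Fin H → Seq
      sample (j , r) h n = V j (L ℕ.* n ℕ.+ (toℕ r ℕ.+ toℕ h ℕ.* Q))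

      coarse-relation : Σ (Fin H → ℤ) λ c → (∃[ h ] c h ≢ 0ℤ) ×
        ∀ j r → r < Q → AE (λ n → sumFin H (λ h → c h * V j (L ℕ.* n ℕ.+ (r ℕ.+ toℕ h ℕ.* Q))) ≡ 0ℤ)
      coarse-relation with Asym.span-dependent (Finite.dim finitary) (Finite.gens finitary) (d ℕ.* Q) H≡
        (λ J h → sample (remQuot {d} Q J) h)
        (λ J h → Finite.spans finitary (proj₁ (remQuot {d} Q J)) (e₁ ℕ.+ e₀)
          (toℕ (proj₂ (remQuot {d} Q J)) ℕ.+ toℕ h ℕ.* Q) (offset< h (toℕ<n (proj₂ (remQuot {d} Q J)))))
      ... | c , nz , rel = c , nz , λ j r r<Q →
        subst (λ y → AE (λ n → sumFin H (λ h → c h * V j (L ℕ.* n ℕ.+ (y ℕ.+ toℕ h ℕ.* Q))) ≡ 0ℤ)) (toℕ-fromℕ< r<Q)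
          (subst (λ p → AE (λ n → sumFin H (λ h → c h * sample p h n) ≡ 0ℤ)) (remQuot-combine {d} j (fromℕ< r<Q))
            (rel (combine j (fromℕ< r<Q))))

    shift-relation : ∃[ Q ] 1 ≤ Q × ∃[ H ] Σ (Fin H → ℤ) λ c → (∃[ h ] c h ≢ 0ℤ) ×
      ∀ j → AE (λ n → sumFin H (λ h → c h * V j (n ℕ.+ toℕ h ℕ.* Q)) ≡ 0ℤ)
    shift-relation =
      let (e₀ , stable)     = scaling-stabilises
          H                 = suc (d ℕ.* ℓ ^ e₀ ℕ.* Finite.dim finitary)
          (e₁ , H≤)         = power-bound H 2≤ℓ
          (κ , 2L≤K)        = power-bound (2 ℕ.* ℓ ^ (e₁ ℕ.+ e₀)) 2≤k
      in  assemble e₀ stable H refl e₁ H≤ κ 2L≤K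
      where
      assemble : ∀ e₀ → (∀ b → Exact.InSpan d V b →
          ∀ t → AE (λ n → b (ℓ ^ (t ℕ.+ e₀) ℕ.* n) ≡ 0ℤ) → AE (λ n → b (ℓ ^ e₀ ℕ.* n) ≡ 0ℤ)) →
        ∀ H → H ≡ suc (d ℕ.* ℓ ^ e₀ ℕ.* Finite.dim finitary) → ∀ e₁ → H ≤ ℓ ^ e₁ →
        ∀ κ → 2 ℕ.* ℓ ^ (e₁ ℕ.+ e₀) ≤ k ^ κ →
        ∃[ Q ] 1 ≤ Q × ∃[ H ] Σ (Fin H → ℤ) λ c → (∃[ h ] c h ≢ 0ℤ) ×
          ∀ j → AE (λ n → sumFin H (λ h → c h * V j (n ℕ.+ toℕ h ℕ.* Q)) ≡ 0ℤ)
      assemble e₀ stable H H≡ e₁ H≤ κ 2L≤K with Dependence.coarse-relation e₀ e₁ H H≡ H≤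
      ... | c , nz , coarse = ℓ ^ e₀ , ℕ.m^n>0 ℓ e₀ , H , c , nz ,
        Coarsen.everywhere e₀ e₁ κ H stable 2L≤K (Dependence.offset< e₀ e₁ H H≡ H≤) c coarse

-- Vandermonde elimination

-- Syntax for the polynomials in E with integer coefficients. Commutativity of their action then
-- follows once and for all by induction on terms (`op-comm`).
data Op : Set where
  con     : ℤ → Op
  E^_     : ℕ → Op
  _⊕_ _⊗_ : Op → Op → Op

infixl 6 _⊕_ _⊖_
infixl 7 _⊗_

⟦_⟧ : Op → Seq → Seq
⟦ con c ⟧ X n = c * X n
⟦ E^ m ⟧  X n = X (n ℕ.+ m)
⟦ p ⊕ r ⟧ X n = ⟦ p ⟧ X n + ⟦ r ⟧ X n
⟦ p ⊗ r ⟧ X   = ⟦ p ⟧ (⟦ r ⟧ X)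

_⊖_ : Op → Op → Op
p ⊖ r = p ⊕ (con (- 1ℤ) ⊗ r)

op-resp : ∀ p {X Y} → X ≐ Y → ⟦ p ⟧ X ≐ ⟦ p ⟧ Y
op-resp (con c) eq n = cong (c *_) (eq n)
op-resp (E^ m)  eq n = eq (n ℕ.+ m)
op-resp (p ⊕ r) eq n = cong₂ _+_ (op-resp p eq n) (op-resp r eq n)
op-resp (p ⊗ r) eq   = op-resp p (op-resp r eq)

op-lin : ∀ p a b X Y → ⟦ p ⟧ (λ n → a * X n + b * Y n) ≐ λ n → a * ⟦ p ⟧ X n + b * ⟦ p ⟧ Y n
op-lin (con c) a b X Y n = move c a b (X n) (Y n)
  where
  move : ∀ c a b x y → c * (a * x + b * y) ≡ a * (c * x) + b * (c * y)
  move = solve-∀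
op-lin (E^ m)  a b X Y n = refl
op-lin (p ⊕ r) a b X Y n = trans (cong₂ _+_ (op-lin p a b X Y n) (op-lin r a b X Y n))
  (regroup a b (⟦ p ⟧ X n) (⟦ p ⟧ Y n) (⟦ r ⟧ X n) (⟦ r ⟧ Y n))
  where
  regroup : ∀ a b x y x′ y′ → (a * x + b * y) + (a * x′ + b * y′) ≡ a * (x + x′) + b * (y + y′)
  regroup = solve-∀
op-lin (p ⊗ r) a b X Y n = trans (op-resp p (op-lin r a b X Y) n) (op-lin p a b (⟦ r ⟧ X) (⟦ r ⟧ Y) n)

op-+ : ∀ p X Y → ⟦ p ⟧ (λ n → X n + Y n) ≐ λ n → ⟦ p ⟧ X n + ⟦ p ⟧ Y n
op-+ p X Y n = trans (op-resp p (λ n → sym (cong₂ _+_ (ℤ.*-identityˡ (X n)) (ℤ.*-identityˡ (Y n)))) n)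
  (trans (op-lin p 1ℤ 1ℤ X Y n) (cong₂ _+_ (ℤ.*-identityˡ (⟦ p ⟧ X n)) (ℤ.*-identityˡ (⟦ p ⟧ Y n))))

op-* : ∀ p c X → ⟦ p ⟧ (λ n → c * X n) ≐ λ n → c * ⟦ p ⟧ X n
op-* p c X n = trans (op-resp p (λ n → pad c (X n)) n)
  (trans (op-lin p c 0ℤ X X n) (sym (pad c (⟦ p ⟧ X n))))
  where
  pad : ∀ c x → c * x ≡ c * x + 0ℤ * x
  pad = solve-∀

op-shift : ∀ p m X n → ⟦ p ⟧ (λ n → X (n ℕ.+ m)) n ≡ ⟦ p ⟧ X (n ℕ.+ m)
op-shift (con c) m X n = refl
op-shift (E^ l)  m X n = cong X (flip n l m)
  where
  flip : ∀ n l m → n ℕ.+ l ℕ.+ m ≡ n ℕ.+ m ℕ.+ l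
  flip = ℕ-Solver.solve-∀
op-shift (p ⊕ r) m X n = cong₂ _+_ (op-shift p m X n) (op-shift r m X n)
op-shift (p ⊗ r) m X n = trans (op-resp p (op-shift r m X) n) (op-shift p m (⟦ r ⟧ X) n)

op-comm : ∀ p r X → ⟦ p ⟧ (⟦ r ⟧ X) ≐ ⟦ r ⟧ (⟦ p ⟧ X)
op-comm p (con c)   X n = op-* p c X n
op-comm p (E^ m)    X n = op-shift p m X n
op-comm p (r ⊕ r′)  X n = trans (op-+ p (⟦ r ⟧ X) (⟦ r′ ⟧ X) n) (cong₂ _+_ (op-comm p r X n) (op-comm p r′ X n))
op-comm p (r ⊗ r′)  X n = trans (op-comm p r (⟦ r′ ⟧ X) n) (op-resp r (op-comm p r′ X) n)

Vanishes : Seq → Set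
Vanishes X = AE (λ n → X n ≡ 0ℤ)

vanishes-resp : ∀ {X Y} → X ≐ Y → Vanishes X → Vanishes Y
vanishes-resp eq = AE-map (λ n e → trans (sym (eq n)) e)

vanishes-+ : ∀ {X Y} → Vanishes X → Vanishes Y → Vanishes (λ n → X n + Y n)
vanishes-+ {X} {Y} = AE-map₂ {λ n → X n ≡ 0ℤ} {λ n → Y n ≡ 0ℤ} (λ n → cong₂ _+_)

vanishes-* : ∀ c {X} → Vanishes X → Vanishes (λ n → c * X n)
vanishes-* c = AE-map (λ n e → trans (cong (c *_) e) (ℤ.*-zeroʳ c))

vanishes-op : ∀ p {X} → Vanishes X → Vanishes (⟦ p ⟧ X)
vanishes-op (con c)     v = vanishes-* c v
vanishes-op (E^ m)  {X} v = AE-shift {λ n → X n ≡ 0ℤ} m v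
vanishes-op (p ⊕ r) {X} v = vanishes-+ {⟦ p ⟧ X} {⟦ r ⟧ X} (vanishes-op p v) (vanishes-op r v)
vanishes-op (p ⊗ r)     v = vanishes-op p (vanishes-op r v)

vanishes-comm : ∀ p r {X} → Vanishes (⟦ p ⟧ (⟦ r ⟧ X)) → Vanishes (⟦ r ⟧ (⟦ p ⟧ X))
vanishes-comm p r {X} = vanishes-resp (op-comm p r X)

-- Horner form of a polynomial in y. The lower coefficients are operators because division by y - y₀
-- puts powers of y₀ into them; the leading coefficient c is never changed and stays an integer, so
-- it can be cancelled at the end.
evaluate : List Op → ℤ → Op → Op
evaluate []       c y = con c
evaluate (f ∷ fs) c y = f ⊕ y ⊗ evaluate fs c y

-- Synthetic division: if F(y) = f + y G(y), then (F(y) - F(y₀)) / (y - y₀) = G(y₀) + y (G(y) - G(y₀)) / (y - y₀).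
quotient : List Op → ℤ → Op → List Op
quotient []       c y₀ = []
quotient (f ∷ fs) c y₀ = evaluate (f ∷ fs) c y₀ ∷ quotient fs c y₀

length-quotient : ∀ fs c y₀ → length (quotient fs c y₀) ≡ length fs
length-quotient []       c y₀ = refl
length-quotient (f ∷ fs) c y₀ = cong suc (length-quotient fs c y₀)

division : ∀ f fs c y y₀ X n →
  ⟦ evaluate (f ∷ fs) c y ⟧ X n + (- 1ℤ) * ⟦ evaluate (f ∷ fs) c y₀ ⟧ X n
    ≡ ⟦ y ⊖ y₀ ⟧ (⟦ evaluate (quotient fs c y₀) c y ⟧ X) n
division f [] c y y₀ X n = cancel (⟦ f ⟧ X n) (⟦ y ⟧ (λ n → c * X n) n) (⟦ y₀ ⟧ (λ n → c * X n) n)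
  where
  cancel : ∀ f a b → (f + a) + (- 1ℤ) * (f + b) ≡ a + (- 1ℤ) * b
  cancel = solve-∀
division f (g ∷ gs) c y y₀ X n = trans
  (cong (λ u → (⟦ f ⟧ X n + u) + (- 1ℤ) * (⟦ f ⟧ X n + ⟦ y₀ ⟧ G₀ n))
    (trans (op-resp y (λ m → trans (split (G m) (G₀ m)) (cong (G₀ m +_) (division g gs c y y₀ X m))) n)
    (trans (op-+ y G₀ (λ m → ⟦ y ⟧ Z m + (- 1ℤ) * ⟦ y₀ ⟧ Z m) n)
    (cong (⟦ y ⟧ G₀ n +_)
      (trans (op-+ y (⟦ y ⟧ Z) (λ m → (- 1ℤ) * ⟦ y₀ ⟧ Z m) n)
      (cong (⟦ y ⟧ (⟦ y ⟧ Z) n +_)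
        (trans (op-* y (- 1ℤ) (⟦ y₀ ⟧ Z) n) (cong ((- 1ℤ) *_) (op-comm y y₀ Z n)))))))))
  (trans (regroup (⟦ f ⟧ X n) (⟦ y ⟧ G₀ n) (⟦ y ⟧ (⟦ y ⟧ Z) n) (⟦ y₀ ⟧ (⟦ y ⟧ Z) n) (⟦ y₀ ⟧ G₀ n))
         (sym (cong₂ (λ u v → u + (- 1ℤ) * v) (op-+ y G₀ (⟦ y ⟧ Z) n) (op-+ y₀ G₀ (⟦ y ⟧ Z) n))))
  where
  G G₀ Z : Seq
  G  = ⟦ evaluate (g ∷ gs) c y ⟧ X
  G₀ = ⟦ evaluate (g ∷ gs) c y₀ ⟧ X
  Z  = ⟦ evaluate (quotient gs c y₀) c y ⟧ X
  split : ∀ a b → a ≡ b + (a + (- 1ℤ) * b)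
  split = solve-∀
  regroup : ∀ f a b b′ d → (f + (a + (b + (- 1ℤ) * b′))) + (- 1ℤ) * (f + d) ≡ (a + b) + (- 1ℤ) * (d + b′)
  regroup = solve-∀

differences : Op → List Op → Op
differences y₀ []       = con 1ℤ
differences y₀ (y ∷ ys) = differences y₀ ys ⊗ (y ⊖ y₀)

vandermonde : List Op → Op
vandermonde []       = con 1ℤ
vandermonde (y ∷ ys) = vandermonde ys ⊗ differences y ys

vanishes-differences : ∀ y₀ {y ys X} → y ∈ ys → Vanishes (⟦ y ⊖ y₀ ⟧ X) → Vanishes (⟦ differences y₀ ys ⟧ X)
vanishes-differences y₀ {y} {_ ∷ ys}  (here refl) v = vanishes-op (differences y₀ ys) v
vanishes-differences y₀ {y} {z ∷ ys} {X} (there y∈) v =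
  vanishes-comm (z ⊖ y₀) (differences y₀ ys) {X} (vanishes-op (z ⊖ y₀) (vanishes-differences y₀ y∈ v))

-- If a polynomial of degree n with leading coefficient c vanishes at y₀, …, yₙ, then divided
-- differences give c ∏_{i<j} (y_j - y_i) = 0 in any commutative ring.
vanishes-vandermonde : ∀ fs {c} → c ≢ 0ℤ → ∀ ys → length ys ≡ suc (length fs) → ∀ {X} →
  (∀ y → y ∈ ys → Vanishes (⟦ evaluate fs c y ⟧ X)) → Vanishes (⟦ vandermonde ys ⟧ X)
vanishes-vandermonde [] c≢0 (y ∷ []) len {X} v =
  vanishes-op (con 1ℤ ⊗ con 1ℤ) {X} (AE-map (λ n → *-cancel-0 c≢0) (v y (here refl)))
vanishes-vandermonde (f ∷ fs) {c} c≢0 (y₀ ∷ ys) len {X} v =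
  vanishes-vandermonde (quotient fs c y₀) c≢0 ys
    (trans (ℕ.suc-injective len) (cong suc (sym (length-quotient fs c y₀)))) λ y y∈ →
      vanishes-comm (differences y₀ ys) (evaluate (quotient fs c y₀) c y) {X}
        (vanishes-differences y₀ y∈ (vanishes-resp (division f fs c y y₀ X)
          (vanishes-+ {⟦ evaluate (f ∷ fs) c y ⟧ X} (v y (there y∈))
            (vanishes-* (- 1ℤ) {⟦ evaluate (f ∷ fs) c y₀ ⟧ X} (v y₀ (here refl))))))

power : ℕ → ℕ → Op
power q zero    = con 1ℤ
power q (suc N) = power q N ⊗ (E^ q ⊖ con 1ℤ)

power-diff^ : ∀ q N X → ⟦ power q N ⟧ X ≐ diff^ q N X
power-diff^ q zero    X n = ℤ.*-identityˡ (X n)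
power-diff^ q (suc N) X n = trans (op-resp (power q N) (λ n → sign (X (n ℕ.+ q)) (X n)) n) (power-diff^ q N (diff q X) n)
  where
  sign : ∀ x y → x + (- 1ℤ) * (1ℤ * y) ≡ x - y
  sign = solve-∀

diff^-+ : ∀ q M N X → diff^ q (M ℕ.+ N) X ≡ diff^ q N (diff^ q M X)
diff^-+ q zero    N X = refl
diff^-+ q (suc M) N X = diff^-+ q M N (diff q X)

-- In E^β - E^α = E^α (E^(β-α) - 1) the factor E^α can be removed, since a shift loses only finitely
-- many terms (`AE-unshift`). A period up to density zero passes to its multiples.
vanishes-period : ∀ {α β q} → α < β → (β ℕ.∸ α) ∣ q → ∀ {X} →
  Vanishes (⟦ E^ β ⊖ E^ α ⟧ X) → Vanishes (⟦ E^ q ⊖ con 1ℤ ⟧ X)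
vanishes-period {α} {β} {q} α<β (divides t refl) {X} v =
  AE-map (λ n e → trans (cong (λ x → x + (- 1ℤ) * (1ℤ * X n)) e) (cancel (X n))) (multiple t)
  where
  δ = β ℕ.∸ α
  cancel : ∀ x → x + (- 1ℤ) * (1ℤ * x) ≡ 0ℤ
  cancel = solve-∀
  periodic : AE (λ n → X (n ℕ.+ δ) ≡ X n)
  periodic = AE-unshift α (AE-map (λ n e → trans (cong X (regroup n)) (balance (X (n ℕ.+ β)) (X (n ℕ.+ α)) e)) v)
    where
    regroup : ∀ n → n ℕ.+ α ℕ.+ δ ≡ n ℕ.+ β
    regroup n = trans (ℕ.+-assoc n α δ) (cong (n ℕ.+_) (ℕ.m+[n∸m]≡n (ℕ.<⇒≤ α<β)))
    balance : ∀ x y → x + (- 1ℤ) * y ≡ 0ℤ → x ≡ y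
    balance x y e = trans (restore x y) (trans (cong (_+ y) e) (ℤ.+-identityˡ y))
      where
      restore : ∀ x y → x ≡ (x + (- 1ℤ) * y) + y
      restore = solve-∀
  multiple : ∀ t → AE (λ n → X (n ℕ.+ t ℕ.* δ) ≡ X n)
  multiple zero    = AE-pure λ n → cong X (ℕ.+-identityʳ n)
  multiple (suc t) = AE-map₂ {λ n → X (n ℕ.+ δ ℕ.+ t ℕ.* δ) ≡ X (n ℕ.+ δ)} {λ n → X (n ℕ.+ δ) ≡ X n}
    (λ n e e′ → trans (cong X (sym (ℕ.+-assoc n δ (t ℕ.* δ)))) (trans e e′))
    (AE-shift {λ n → X (n ℕ.+ t ℕ.* δ) ≡ X n} δ (multiple t)) periodic

gaps : ℕ → List ℕ → ℕ
gaps α []       = 1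
gaps α (β ∷ βs) = (β ℕ.∸ α) ℕ.* gaps α βs

commonPeriod : List ℕ → ℕ
commonPeriod []       = 1
commonPeriod (α ∷ αs) = gaps α αs ℕ.* commonPeriod αs

gaps≥1 : ∀ {α αs} → All (α <_) αs → 1 ≤ gaps α αs
gaps≥1 []         = ℕ.≤-refl
gaps≥1 (α< ∷ inc) = ℕ.*-mono-≤ (ℕ.m<n⇒0<n∸m α<) (gaps≥1 inc)

commonPeriod≥1 : ∀ {αs} → AllPairs _<_ αs → 1 ≤ commonPeriod αs
commonPeriod≥1 []          = ℕ.≤-refl
commonPeriod≥1 (inc ∷ inc′) = ℕ.*-mono-≤ (gaps≥1 inc) (commonPeriod≥1 inc′)

vanishes-gaps : ∀ {q α αs} → All (α <_) αs → gaps α αs ∣ q → ∀ {X} →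
  Vanishes (⟦ differences (E^ α) (map E^_ αs) ⟧ X) → Vanishes (⟦ power q (length αs) ⟧ X)
vanishes-gaps {q} {α} {[]}     []         gaps∣q {X} v = v
vanishes-gaps {q} {α} {β ∷ αs} (α<β ∷ inc) gaps∣q {X} v =
  vanishes-comm (E^ q ⊖ con 1ℤ) (power q (length αs)) {X}
    (vanishes-period α<β (∣-trans (m∣m*n (gaps α αs)) gaps∣q) {⟦ power q (length αs) ⟧ X}
      (vanishes-comm (power q (length αs)) (E^ β ⊖ E^ α) {X}
        (vanishes-gaps inc (∣-trans (n∣m*n (β ℕ.∸ α)) gaps∣q) v)))

-- q is a multiple of every difference of two exponents, so each Vandermonde factor may be traded
-- for E^q - 1. The resulting N is the number of pairs.
vanishes-commonPeriod : ∀ {q αs} → AllPairs _<_ αs → commonPeriod αs ∣ q →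
  ∃[ N ] ∀ X → Vanishes (⟦ vandermonde (map E^_ αs) ⟧ X) → Vanishes (diff^ q N X)
vanishes-commonPeriod {q} {[]} [] _ = 0 , λ X → vanishes-resp (λ n → ℤ.*-identityˡ (X n))
vanishes-commonPeriod {q} {α ∷ αs} (inc ∷ inc′) period∣q
  with vanishes-commonPeriod {q} {αs} inc′ (∣-trans (n∣m*n (gaps α αs)) period∣q)
... | N , imp = N ℕ.+ length αs , λ X v →
  vanishes-resp (λ n → trans (op-resp (power q (length αs)) (power-diff^ q N X) n)
      (trans (power-diff^ q (length αs) (diff^ q N X) n) (cong (λ Y → Y n) (sym (diff^-+ q N (length αs) X)))))
    (vanishes-gaps inc (∣-trans (m∣m*n (commonPeriod αs)) period∣q)
      (vanishes-comm (power q N) (differences (E^ α) (map E^_ αs)) {X}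
        (vanishes-resp (λ n → sym (power-diff^ q N _ n)) (imp _ v))))

increasing-unipotent : ∀ {αs} fs {c} → c ≢ 0ℤ → AllPairs _<_ αs → length αs ≡ suc (length fs) →
  ∃[ q ] 1 ≤ q × ∃[ N ] ∀ X → (∀ y → y ∈ map E^_ αs → Vanishes (⟦ evaluate fs c y ⟧ X)) → Vanishes (diff^ q N X)
increasing-unipotent {αs} fs c≢0 inc len =
  let (N , imp) = vanishes-commonPeriod {commonPeriod αs} {αs} inc ∣-refl in
  commonPeriod αs , commonPeriod≥1 inc , N , λ X v →
    imp X (vanishes-vandermonde fs c≢0 (map E^_ αs) (trans (length-map E^_ αs) len) v)

-- Trailing zero coefficients are cut off, so that the leading coefficient is a nonzero integer and
-- `length fs` is the true degree.
leading : ∀ H (c : Fin H → ℤ) → (∃[ h ] c h ≢ 0ℤ) →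
  Σ (List Op) λ fs → Σ ℤ λ lead → lead ≢ 0ℤ ×
    (∀ α X n → ⟦ evaluate fs lead (E^ α) ⟧ X n ≡ sumFin H (λ h → c h * X (n ℕ.+ toℕ h ℕ.* α)))
leading (suc H) c (h , nz) with nonzero? (λ h → c (suc h))
... | inj₁ (h′ , nz′) with leading H (λ h → c (suc h)) (h′ , nz′)
...   | fs , lead , lead≢0 , eq = con (c zero) ∷ fs , lead , lead≢0 , λ α X n →
        cong₂ _+_ (cong (λ y → c zero * X y) (sym (ℕ.+-identityʳ n)))
          (trans (eq α X (n ℕ.+ α)) (sum-cong H
            {λ h → c (suc h) * X (n ℕ.+ α ℕ.+ toℕ h ℕ.* α)} {λ h → c (suc h) * X (n ℕ.+ (α ℕ.+ toℕ h ℕ.* α))}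
            λ h → cong (λ y → c (suc h) * X y) (ℕ.+-assoc n α (toℕ h ℕ.* α))))
leading (suc H) c (zero , nz) | inj₂ tail≡0 = [] , c zero , nz , λ α X n →
  trans (cong (λ y → c zero * X y) (sym (ℕ.+-identityʳ n)))
  (sym (trans (cong (c zero * X (n ℕ.+ 0) +_)
    (sum-zero H {λ h → c (suc h) * X (n ℕ.+ (α ℕ.+ toℕ h ℕ.* α))}
      (λ h → trans (cong (_* X (n ℕ.+ (α ℕ.+ toℕ h ℕ.* α))) (tail≡0 h)) (ℤ.*-zeroˡ (X (n ℕ.+ (α ℕ.+ toℕ h ℕ.* α)))))))
    (ℤ.+-identityʳ (c zero * X (n ℕ.+ 0)))))
leading (suc H) c (suc h , nz) | inj₂ tail≡0 = ⊥-elim (nz (tail≡0 h))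

-- From one shift relation to (E^q - 1)^N

module _ {k ℓ : ℕ} (2≤k : 2 ≤ k) (2≤ℓ : 2 ≤ ℓ) (k⊥ℓ : Coprime k ℓ) (S : System k ℓ) where
  open System S renaming (dim to d; seqs to V)
  private
    instance
      k≢0 : NonZero k
      k≢0 = ℕ.>-nonZero (ℕ.<⇒≤ 2≤k)

  module _ (Q H : ℕ) (c : Fin H → ℤ)
           (rel : ∀ j → AE (λ n → sumFin H (λ h → c h * V j (n ℕ.+ toℕ h ℕ.* Q)) ≡ 0ℤ)) where

    relation-^ : ∀ i j → AE (λ n → sumFin H (λ h → c h * V j (n ℕ.+ toℕ h ℕ.* (k ^ i ℕ.* Q))) ≡ 0ℤ)
    relation-^ zero    j = subst (λ y → AE (λ n → sumFin H (λ h → c h * V j (n ℕ.+ toℕ h ℕ.* y)) ≡ 0ℤ)) (sym (ℕ.*-identityˡ Q)) (rel j)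
    -- On the class of r mod k a shift by h k^(i+1) Q is a shift by h k^i Q of the sequence V_j(k n
    -- + r), which lies in the span again.
    relation-^ (suc i) j = AE-residues k λ r r<k → AE-map (λ n e → trans (reindex n r) e)
      (relation-span 2≤k 2≤ℓ S H c (λ h n → n ℕ.+ toℕ h ℕ.* (k ^ i ℕ.* Q)) (relation-^ i)
        {λ n → V j (k ℕ.* n ℕ.+ r)} (closed j r r<k))
      where
      regroup : ∀ n k r h y Q → n ℕ.* k ℕ.+ r ℕ.+ h ℕ.* (k ℕ.* y ℕ.* Q) ≡ k ℕ.* (n ℕ.+ h ℕ.* (y ℕ.* Q)) ℕ.+ r
      regroup = ℕ-Solver.solve-∀
      reindex : ∀ n r → sumFin H (λ h → c h * V j (n ℕ.* k ℕ.+ r ℕ.+ toℕ h ℕ.* (k ^ suc i ℕ.* Q)))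
                      ≡ sumFin H (λ h → c h * V j (k ℕ.* (n ℕ.+ toℕ h ℕ.* (k ^ i ℕ.* Q)) ℕ.+ r))
      reindex n r = sum-cong H {λ h → c h * V j (n ℕ.* k ℕ.+ r ℕ.+ toℕ h ℕ.* (k ^ suc i ℕ.* Q))}
        {λ h → c h * V j (k ℕ.* (n ℕ.+ toℕ h ℕ.* (k ^ i ℕ.* Q)) ℕ.+ r)}
        λ h → cong (λ y → c h * V j y) (regroup n k r (toℕ h) (k ^ i) Q)

  strides : ℕ → ℕ → ℕ → List ℕ
  strides Q i zero    = []
  strides Q i (suc n) = k ^ i ℕ.* Q ∷ strides Q (suc i) n

  length-strides : ∀ Q i n → length (strides Q i n) ≡ n
  length-strides Q i zero    = refl
  length-strides Q i (suc n) = cong suc (length-strides Q (suc i) n)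

  strides-above : ∀ {Q} → 1 ≤ Q → ∀ {i j} n → i < j → All (k ^ i ℕ.* Q <_) (strides Q j n)
  strides-above         1≤Q zero    i<j = []
  strides-above {Q} 1≤Q {i} {j} (suc n) i<j =
    ℕ.*-monoˡ-< Q {{ℕ.>-nonZero 1≤Q}} (ℕ.^-monoʳ-< k 2≤k i<j) ∷ strides-above 1≤Q n (ℕ.m<n⇒m<1+n i<j)

  strides-increasing : ∀ {Q} → 1 ≤ Q → ∀ i n → AllPairs _<_ (strides Q i n)
  strides-increasing 1≤Q i zero    = []
  strides-increasing 1≤Q i (suc n) = strides-above 1≤Q n (ℕ.n<1+n i) ∷ strides-increasing 1≤Q (suc i) n

  strides-vanish : ∀ {Q X fs c} → (∀ i → Vanishes (⟦ evaluate fs c (E^ (k ^ i ℕ.* Q)) ⟧ X)) →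
    ∀ i n y → y ∈ map E^_ (strides Q i n) → Vanishes (⟦ evaluate fs c y ⟧ X)
  strides-vanish v i (suc n) y (here refl) = v i
  strides-vanish {fs = fs} {c} v i (suc n) y (there y∈) = strides-vanish {fs = fs} {c} v (suc i) n y y∈

  strides-unipotent : ∀ {Q} → 1 ≤ Q → ∀ fs {c} → c ≢ 0ℤ → ∃[ q ] 1 ≤ q × ∃[ N ] ∀ X →
    (∀ i → Vanishes (⟦ evaluate fs c (E^ (k ^ i ℕ.* Q)) ⟧ X)) → Vanishes (diff^ q N X)
  strides-unipotent {Q} 1≤Q fs {c} c≢0 =
    -- Degree plus one strides: as many nodes as the repeated division consumes before only the
    -- leading coefficient is left.
    let (q , 1≤q , N , imp) = increasing-unipotent fs c≢0 (strides-increasing 1≤Q 0 (suc (length fs)))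
                                (length-strides Q 0 (suc (length fs)))
    in q , 1≤q , N , λ X v → imp X (strides-vanish {Q} {X} {fs} {c} v 0 (suc (length fs)))

  eventually-unipotent : ∃[ q ] 1 ≤ q × ∃[ N ] ∀ j → Vanishes (diff^ q N (V j))
  eventually-unipotent =
    let (Q , 1≤Q , H , c , nz , rel)   = shift-relation 2≤k 2≤ℓ S k⊥ℓ
        (fs , lead , lead≢0 , eq)      = leading H c nz
        (q , 1≤q , N , imp)            = strides-unipotent 1≤Q fs lead≢0
    in q , 1≤q , N , λ j → imp (V j) (λ i → transfer fs lead H c eq (k ^ i ℕ.* Q) (V j) (relation-^ Q H c rel i j))
    where
    transfer : ∀ fs lead H (c : Fin H → ℤ) →
      (∀ α X n → ⟦ evaluate fs lead (E^ α) ⟧ X n ≡ sumFin H (λ h → c h * X (n ℕ.+ toℕ h ℕ.* α))) →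
      ∀ α X → AE (λ n → sumFin H (λ h → c h * X (n ℕ.+ toℕ h ℕ.* α)) ≡ 0ℤ) → Vanishes (⟦ evaluate fs lead (E^ α) ⟧ X)
    transfer fs lead H c eq α X = AE-map (λ n → trans (eq α X n))

diff^-sum : ∀ q N d (t : Fin d → ℤ) (V : Fin d → Seq) n →
  diff^ q N (Exact.lin d t V) n ≡ sumFin d (λ j → t j * diff^ q N (V j) n)
diff^-sum q N zero    t V n = killed-0 q N n
diff^-sum q N (suc d) t V n = trans (diff^-resp q N (λ n → cong (t zero * V zero n +_) (sym (ℤ.*-identityˡ _))) n)
  (trans (diff^-lin q N (t zero) 1ℤ (V zero) (Exact.lin d (λ j → t (suc j)) (λ j → V (suc j))) n)
  (cong (t zero * diff^ q N (V zero) n +_) (trans (ℤ.*-identityˡ _) (diff^-sum q N d (λ j → t (suc j)) (λ j → V (suc j)) n))))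

vanishes-span : ∀ q N {d} {V : Fin d → Seq} {b} → Exact.InSpan d V b →
  (∀ j → Vanishes (diff^ q N (V j))) → Vanishes (diff^ q N b)
vanishes-span q N {d} {V} (t , eq) v = AE-map (λ n vs → trans (diff^-resp q N eq n) (trans (diff^-sum q N d t V n)
    (sum-zero d λ j → trans (cong (t j *_) (vs j)) (ℤ.*-zeroʳ (t j)))))
  (AE-∀Fin d v)

-- Slowly varying sequences

RSpan-vanishes : ∀ {d} (V : Fin d → Seq) {p} {F : Fin p → Fin d → ℤ} {t} → RSpan p F t → ∀ n →
  (∀ j → Exact.lin d (F j) V n ≡ 0ℤ) → Exact.lin d t V n ≡ 0ℤ
RSpan-vanishes {d} V {p} {F} {t} (c , c≢0 , s , eq) n zeros = *-cancel-0 c≢0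
  (trans (sym (sum-* d c (λ x → t x * V x n)))
  (trans (sum-cong d {λ x → c * (t x * V x n)} {λ x → sumFin p (λ j → s j * (F j x * V x n))} each)
  (trans (sum-swap d p (λ x j → s j * (F j x * V x n)))
         (sum-zero p {λ j → sumFin d (λ x → s j * (F j x * V x n))} λ j →
           trans (sum-* d (s j) (λ x → F j x * V x n)) (trans (cong (s j *_) (zeros j)) (ℤ.*-zeroʳ (s j)))))))
  where
  rotate : ∀ v s f → v * (s * f) ≡ s * (f * v)
  rotate = solve-∀
  each : ∀ x → c * (t x * V x n) ≡ sumFin p (λ j → s j * (F j x * V x n))
  each x = trans (sym (ℤ.*-assoc c (t x) (V x n))) (trans (cong (_* V x n) (eq x))
    (trans (ℤ.*-comm (sumFin p (λ j → s j * F j x)) (V x n))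
    (trans (sym (sum-* p (V x n) (λ j → s j * F j x)))
           (sum-cong p (λ j → rotate (V x n) (s j) (F j x))))))

module _ {k ℓ : ℕ} (2≤k : 2 ≤ k) (S : System k ℓ) where
  open System S renaming (dim to d; seqs to V)
  private
    instance
      k≢0 : NonZero k
      k≢0 = ℕ.>-nonZero (ℕ.<⇒≤ 2≤k)

  -- The row vector t times the matrix M_r of the recursion V(kn + r) = M_r V(n).
  digit-step : Fin k → (Fin d → ℤ) → Fin d → ℤ
  digit-step r t j = sumFin d (λ i → t i * proj₁ (closed i (toℕ r) (toℕ<n r)) j)

  lin-digit-step : ∀ r t n → Exact.lin d t V (k ℕ.* n ℕ.+ toℕ r) ≡ Exact.lin d (digit-step r t) V n
  lin-digit-step r t n =
    trans (sum-cong d {λ i → t i * V i (k ℕ.* n ℕ.+ toℕ r)} {λ i → sumFin d (λ j → t i * (M i j * V j n))}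
      (λ i → trans (cong (t i *_) (proj₂ (closed i (toℕ r) (toℕ<n r)) n)) (sym (sum-* d (t i) (λ j → M i j * V j n)))))
   (trans (sum-swap d d (λ i j → t i * (M i j * V j n)))
   (sum-cong d {λ j → sumFin d (λ i → t i * (M i j * V j n))} {λ j → digit-step r t j * V j n} λ j →
     trans (sum-cong d (λ i → rotate (t i) (M i j) (V j n)))
     (trans (sum-* d (V j n) (λ i → t i * M i j)) (ℤ.*-comm (V j n) (digit-step r t j)))))
    where
    M : Fin d → Fin d → ℤ
    M i j = proj₁ (closed i (toℕ r) (toℕ<n r)) j
    rotate : ∀ t m v → t * (m * v) ≡ v * (t * m)
    rotate = solve-∀

  -- If a combination of V is null, so is what it becomes after appending a digit. The finite family
  -- F that rationally spans everything reached from f in this way therefore consists of null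
  -- combinations and has a common zero m ≥ 1; appending further digits to m never leaves the span
  -- of F, so b vanishes at all of them.
  vanishing-block : ∀ {b} → Exact.InSpan d V b → Vanishes b →
    ∃[ m ] 1 ≤ m × ∀ L s → s < k ^ L → b (k ^ L ℕ.* m ℕ.+ s) ≡ 0ℤ
  vanishing-block {b} (f , b≐) v = from-span (closedSpan digit-step (λ t → Vanishes (Exact.lin d t V)) step-null f
      (vanishes-resp b≐ v))
    where
    step-null : ∀ r t → Vanishes (Exact.lin d t V) → Vanishes (Exact.lin d (digit-step r t) V)
    step-null r t v = vanishes-resp (lin-digit-step r t)
      (AE-affine {λ n → Exact.lin d t V n ≡ 0ℤ} k (toℕ r) (ℕ.<⇒≤ 2≤k) v)
    from-span : ClosedSpan digit-step (λ t → Vanishes (Exact.lin d t V)) step-null f (vanishes-resp b≐ v) →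
      ∃[ m ] 1 ≤ m × ∀ L s → s < k ^ L → b (k ^ L ℕ.* m ℕ.+ s) ≡ 0ℤ
    from-span (p , F , nulls , f-span , steps) with AE-exists (AE-∀Fin p nulls) 1
    ... | m , 1≤m , zeros = m , 1≤m , λ L s s< → trans (b≐ (k ^ L ℕ.* m ℕ.+ s))
            (RSpan-vanishes V f-span (k ^ L ℕ.* m ℕ.+ s) (λ j → on-block L j s s<))
      where
      on-block : ∀ L j s → s < k ^ L → Exact.lin d (F j) V (k ^ L ℕ.* m ℕ.+ s) ≡ 0ℤ
      on-block zero j zero    _        = subst (λ y → Exact.lin d (F j) V y ≡ 0ℤ)
        (sym (trans (ℕ.+-identityʳ (1 ℕ.* m)) (ℕ.*-identityˡ m))) (zeros j)
      on-block zero j (suc s) (s≤s ())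
      on-block (suc L) j s s< = trans
        (cong (Exact.lin d (F j) V) (trans (cong (k ^ suc L ℕ.* m ℕ.+_) (ℕ.m≡m%n+[m/n]*n s k))
          (trans (nest k (k ^ L) m (s ℕ.% k) (s ℕ./ k)) (cong (k ℕ.* (k ^ L ℕ.* m ℕ.+ s ℕ./ k) ℕ.+_) (sym (toℕ-fromℕ< r<k))))))
        (trans (lin-digit-step (fromℕ< r<k) (F j) (k ^ L ℕ.* m ℕ.+ s ℕ./ k))
               (RSpan-vanishes V (steps (fromℕ< r<k) j) (k ^ L ℕ.* m ℕ.+ s ℕ./ k)
                 (λ i → on-block L i (s ℕ./ k) (ℕ.m<n*o⇒m/o<n {s} {k ^ L} (subst (s <_) (ℕ.*-comm k (k ^ L)) s<)))))
        where
        r<k = ℕ.m%n<n s k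
        nest : ∀ k K n r q → k ℕ.* K ℕ.* n ℕ.+ (r ℕ.+ q ℕ.* k) ≡ k ℕ.* (K ℕ.* n ℕ.+ q) ℕ.+ r
        nest = ℕ-Solver.solve-∀

-- b is constant on [k^L m, k^L (m+1)), and this interval is extended to the right by the factor B/A
-- at a time: in a relation Σ c_h b(N_h n) = 0 only the last argument N_{h₁} n leaves the known part.
module Spread {k : ℕ} (2≤k : 2 ≤ k) (b : Seq) (m : ℕ) (1≤m : 1 ≤ m)
  (block : ∀ L s → s < k ^ L → b (k ^ L ℕ.* m ℕ.+ s) ≡ b (k ^ L ℕ.* m))
  (slow : AE (λ n → b (suc n) ≡ b n))
  {A B : ℕ} (1≤A : 1 ≤ A) (A<B : A < B)
  (H : ℕ) (c : Fin H → ℤ) (N : Fin H → ℕ) (h₁ : Fin H) (c≢0 : c h₁ ≢ 0ℤ)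
  (beyond : ∀ h → toℕ h₁ < toℕ h → c h ≡ 0ℤ)
  (rel : AE (λ n → sumFin H (λ h → c h * b (N h ℕ.* n)) ≡ 0ℤ))
  (1≤N : ∀ h → 1 ≤ N h)
  (narrow : ∀ h → (2 ℕ.* m ℕ.+ 1) ℕ.* N h₁ ≤ (2 ℕ.* m ℕ.+ 2) ℕ.* N h)
  (close : ∀ h → toℕ h < toℕ h₁ → N h ℕ.* B ≤ A ℕ.* N h₁) where

  private
    q = N h₁
    φ : ℕ → ℤ
    φ L = b (k ^ L ℕ.* m)
    σ = sumFin H c
    instance
      k≢0 : NonZero k
      k≢0 = ℕ.>-nonZero (ℕ.<⇒≤ 2≤k)
      A≢0 : NonZero A
      A≢0 = ℕ.>-nonZero 1≤A
      B≢0 : NonZero B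
      B≢0 = ℕ.>-nonZero (ℕ.≤-trans 1≤A (ℕ.<⇒≤ A<B))
      q≢0 : NonZero q
      q≢0 = ℕ.>-nonZero (1≤N h₁)

  -- The relation reads Σ c_h (b(N_h n) - y) = -σ y; on its left side only the summand of h₁
  -- survives.
  isolate : ∀ y n → sumFin H (λ h → c h * b (N h ℕ.* n)) ≡ 0ℤ →
    (∀ h → toℕ h < toℕ h₁ → b (N h ℕ.* n) ≡ y) → c h₁ * (b (q ℕ.* n) - y) + σ * y ≡ 0ℤ
  isolate y n r lower = trans (cong (_+ σ * y) (sym (sum-single H h₁ {λ h → c h * (b (N h ℕ.* n) - y)} off)))
    (trans (cong₂ _+_ (sum-cong H {λ h → c h * (b (N h ℕ.* n) - y)} {λ h → c h * b (N h ℕ.* n) + (- y) * c h}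
                        (λ h → expand (c h) (b (N h ℕ.* n)) y)) refl)
    (trans (cong (_+ σ * y) (trans (sum-+ H (λ h → c h * b (N h ℕ.* n)) (λ h → (- y) * c h))
                                   (cong₂ _+_ r (sum-* H (- y) c))))
           (collapse y σ)))
    where
    expand : ∀ c x y → c * (x - y) ≡ c * x + (- y) * c
    expand = solve-∀
    collapse : ∀ y s → (0ℤ + (- y) * s) + s * y ≡ 0ℤ
    collapse = solve-∀
    off : ∀ h → h ≢ h₁ → c h * (b (N h ℕ.* n) - y) ≡ 0ℤ
    off h h≢h₁ with ℕ.<-cmp (toℕ h) (toℕ h₁)
    ... | tri< lt _ _ = trans (cong (c h *_) (trans (cong (_- y) (lower h lt)) (ℤ.+-inverseʳ y))) (ℤ.*-zeroʳ (c h))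
    ... | tri≈ _ eq _ = ⊥-elim (h≢h₁ (toℕ-injective eq))
    ... | tri> _ _ gt = trans (cong (_* (b (N h ℕ.* n) - y)) (beyond h gt)) (ℤ.*-zeroˡ (b (N h ℕ.* n) - y))

  -- Together q n ≥ X (m + 1/2) and N_h ≥ q (2m+1)/(2m+2) give N_h n ≥ X (2m+1)²/(4m+4) ≥ X m,
  -- because (2m+1)² = 4m(m+1) + 1. So if q n is past the middle of the block, no argument falls off
  -- its left end.
  above : ∀ X n → X ℕ.* (2 ℕ.* m ℕ.+ 1) ≤ 2 ℕ.* (q ℕ.* n) → ∀ h → X ℕ.* m ≤ N h ℕ.* n
  above X n le h = ℕ.*-cancelˡ-≤ (suc (2 ℕ.* m ℕ.+ 1) ℕ.* 2) (begin
    suc (2 ℕ.* m ℕ.+ 1) ℕ.* 2 ℕ.* (X ℕ.* m)             ≤⟨ ℕ.m≤m+n _ X ⟩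
    suc (2 ℕ.* m ℕ.+ 1) ℕ.* 2 ℕ.* (X ℕ.* m) ℕ.+ X       ≡⟨ square m X ⟩
    (2 ℕ.* m ℕ.+ 1) ℕ.* (X ℕ.* (2 ℕ.* m ℕ.+ 1))         ≤⟨ ℕ.*-monoʳ-≤ (2 ℕ.* m ℕ.+ 1) le ⟩
    (2 ℕ.* m ℕ.+ 1) ℕ.* (2 ℕ.* (q ℕ.* n))               ≡⟨ rotate (2 ℕ.* m ℕ.+ 1) q n ⟩
    2 ℕ.* ((2 ℕ.* m ℕ.+ 1) ℕ.* q ℕ.* n)                 ≤⟨ ℕ.*-monoʳ-≤ 2 (ℕ.*-monoˡ-≤ n (narrow h)) ⟩
    2 ℕ.* ((2 ℕ.* m ℕ.+ 2) ℕ.* N h ℕ.* n)               ≡⟨ rotate′ m (N h) n ⟩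
    suc (2 ℕ.* m ℕ.+ 1) ℕ.* 2 ℕ.* (N h ℕ.* n)           ∎)
    where
    open ℕ.≤-Reasoning
    square : ∀ m X → suc (2 ℕ.* m ℕ.+ 1) ℕ.* 2 ℕ.* (X ℕ.* m) ℕ.+ X ≡ (2 ℕ.* m ℕ.+ 1) ℕ.* (X ℕ.* (2 ℕ.* m ℕ.+ 1))
    square = ℕ-Solver.solve-∀
    rotate : ∀ a q n → a ℕ.* (2 ℕ.* (q ℕ.* n)) ≡ 2 ℕ.* (a ℕ.* q ℕ.* n)
    rotate = ℕ-Solver.solve-∀
    rotate′ : ∀ m N n → 2 ℕ.* ((2 ℕ.* m ℕ.+ 2) ℕ.* N ℕ.* n) ≡ suc (2 ℕ.* m ℕ.+ 1) ℕ.* 2 ℕ.* (N ℕ.* n)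
    rotate′ = ℕ-Solver.solve-∀

  in-block : ∀ L n → k ^ L ℕ.* m ≤ n → n < k ^ L ℕ.* suc m → b n ≡ φ L
  in-block L n low high = subst (λ y → b y ≡ φ L) (ℕ.m+[n∸m]≡n low)
    (block L (n ℕ.∸ k ^ L ℕ.* m) (ℕ.+-cancelˡ-< (k ^ L ℕ.* m) _ _
      (subst₂ _<_ (sym (ℕ.m+[n∸m]≡n low)) (trans (ℕ.*-suc (k ^ L) m) (ℕ.+-comm (k ^ L) (k ^ L ℕ.* m))) high)))

  -- An argument n with all N_h n inside the original interval gives σ φ_L = 0.
  balanced : ∃[ L₀ ] ∀ L → L₀ ≤ L → σ * φ L ≡ 0ℤ
  balanced with AE-meets rel (2 ℕ.* (2 ℕ.* m ℕ.+ 2))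
  ... | N₀ , meets with power-bound (2 ℕ.* q ℕ.* (N₀ ℕ.+ 2 ℕ.* (2 ℕ.* m ℕ.+ 1))) 2≤k
  ... | L₀ , big = L₀ , λ L L₀≤L → at L (ℕ.≤-trans big (ℕ.^-monoʳ-≤ k L₀≤L))
    where
    instance
      2q≢0 : NonZero (2 ℕ.* q)
      2q≢0 = ℕ.m*n≢0 2 q
    w = 2 ℕ.* m ℕ.+ 1
    module At (L : ℕ) (Y len : ℕ) (Y≡ : len ℕ.+ w ≡ Y) (w≤len : w ≤ len)
              (Y-low : Y ℕ.* (2 ℕ.* q) ≤ k ^ L) (Y-high : k ^ L ≤ suc Y ℕ.* (2 ℕ.* q))
              (n : ℕ) (low : w ℕ.* suc Y ≤ n) (high : n < len ℕ.+ w ℕ.* suc Y)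
              (r : sumFin H (λ h → c h * b (N h ℕ.* n)) ≡ 0ℤ) where
      open ℕ.≤-Reasoning
      low′ : k ^ L ℕ.* w ≤ 2 ℕ.* (q ℕ.* n)
      low′ = begin
        k ^ L ℕ.* w                      ≤⟨ ℕ.*-monoˡ-≤ w Y-high ⟩
        suc Y ℕ.* (2 ℕ.* q) ℕ.* w        ≡⟨ regroup (suc Y) q w ⟩
        2 ℕ.* (q ℕ.* (w ℕ.* suc Y))      ≤⟨ ℕ.*-monoʳ-≤ 2 (ℕ.*-monoʳ-≤ q low) ⟩
        2 ℕ.* (q ℕ.* n)                  ∎
        where
        regroup : ∀ y q w → y ℕ.* (2 ℕ.* q) ℕ.* w ≡ 2 ℕ.* (q ℕ.* (w ℕ.* y))
        regroup = ℕ-Solver.solve-∀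
      high′ : q ℕ.* n < k ^ L ℕ.* suc m
      high′ = begin-strict
        q ℕ.* n                            <⟨ ℕ.*-monoʳ-< q high ⟩
        q ℕ.* (len ℕ.+ w ℕ.* suc Y)        ≡⟨ cong (λ y → q ℕ.* (len ℕ.+ w ℕ.* suc y)) (sym Y≡) ⟩
        q ℕ.* (len ℕ.+ w ℕ.* suc (len ℕ.+ w)) ≡⟨ regroup q len m ⟩
        (len ℕ.+ w) ℕ.* (2 ℕ.* q) ℕ.* suc m ≡⟨ cong (λ y → y ℕ.* (2 ℕ.* q) ℕ.* suc m) Y≡ ⟩
        Y ℕ.* (2 ℕ.* q) ℕ.* suc m          ≤⟨ ℕ.*-monoˡ-≤ (suc m) Y-low ⟩
        k ^ L ℕ.* suc m                    ∎
        where
        regroup : ∀ q len m → q ℕ.* (len ℕ.+ (2 ℕ.* m ℕ.+ 1) ℕ.* suc (len ℕ.+ (2 ℕ.* m ℕ.+ 1)))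
          ≡ (len ℕ.+ (2 ℕ.* m ℕ.+ 1)) ℕ.* (2 ℕ.* q) ℕ.* suc m
        regroup = ℕ-Solver.solve-∀
      N≤q : ∀ h → toℕ h < toℕ h₁ → N h ≤ q
      N≤q h lt = ℕ.*-cancelʳ-≤ (N h) q B (ℕ.≤-trans (close h lt)
        (ℕ.≤-trans (ℕ.*-monoˡ-≤ q (ℕ.<⇒≤ A<B)) (ℕ.≤-reflexive (ℕ.*-comm B q))))
      conclusion : σ * φ L ≡ 0ℤ
      conclusion = trans (sym (trans (cong (λ y → c h₁ * (y - φ L) + σ * φ L)
            (in-block L (q ℕ.* n) (above (k ^ L) n low′ h₁) high′)) (cancel (c h₁) (φ L) (σ * φ L))))
          (isolate (φ L) n r λ h lt → in-block L (N h ℕ.* n) (above (k ^ L) n low′ h)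
            (ℕ.≤-<-trans (ℕ.*-monoˡ-≤ n (N≤q h lt)) high′))
        where
        cancel : ∀ c y s → c * (y - y) + s ≡ s
        cancel = solve-∀
    at : ∀ L → 2 ℕ.* q ℕ.* (N₀ ℕ.+ 2 ℕ.* w) ≤ k ^ L → σ * φ L ≡ 0ℤ
    at L big =
      let (n , low , high , r) = meets (w ℕ.* suc Y) len N₀≤ 1≤len dense in
      At.conclusion L Y len (ℕ.m∸n+n≡m w≤Y) w≤len (ℕ.m/n*n≤m (k ^ L) (2 ℕ.* q))
        (ℕ.<⇒≤ (N<[1+N/q]*q (k ^ L) (2 ℕ.* q))) n low high r
      where
      open ℕ.≤-Reasoning
      Y = k ^ L ℕ./ (2 ℕ.* q)
      len = Y ℕ.∸ w
      bigY : N₀ ℕ.+ 2 ℕ.* w ≤ Y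
      bigY = subst (_≤ Y) (trans (cong (ℕ._/ (2 ℕ.* q)) (ℕ.*-comm (2 ℕ.* q) (N₀ ℕ.+ 2 ℕ.* w))) (ℕ.m*n/n≡m (N₀ ℕ.+ 2 ℕ.* w) (2 ℕ.* q)))
        (ℕ./-monoˡ-≤ (2 ℕ.* q) big)
      2w≤Y : 2 ℕ.* w ≤ Y
      2w≤Y = ℕ.≤-trans (ℕ.m≤n+m (2 ℕ.* w) N₀) bigY
      w≤Y : w ≤ Y
      w≤Y = ℕ.≤-trans (ℕ.m≤m+n w (w ℕ.+ 0)) 2w≤Y
      w≤len : w ≤ len
      w≤len = ℕ.+-cancelʳ-≤ w w len (subst₂ _≤_ (cong (w ℕ.+_) (ℕ.+-identityʳ w)) (sym (ℕ.m∸n+n≡m w≤Y)) 2w≤Y)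
      1≤len : 1 ≤ len
      1≤len = ℕ.≤-trans (ℕ.m≤n+m 1 (2 ℕ.* m)) w≤len
      N₀≤ : N₀ ≤ len ℕ.+ w ℕ.* suc Y
      N₀≤ = begin
        N₀                     ≤⟨ ℕ.≤-trans (ℕ.m≤m+n N₀ (2 ℕ.* w)) bigY ⟩
        Y                      ≤⟨ ℕ.n≤1+n Y ⟩
        suc Y                  ≤⟨ ℕ.m≤n*m (suc Y) w {{ℕ.>-nonZero (ℕ.m≤n+m 1 (2 ℕ.* m))}} ⟩
        w ℕ.* suc Y            ≤⟨ ℕ.m≤n+m _ len ⟩
        len ℕ.+ w ℕ.* suc Y    ∎
      dense : len ℕ.+ w ℕ.* suc Y ≤ 2 ℕ.* (2 ℕ.* m ℕ.+ 2) ℕ.* len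
      dense = begin
        len ℕ.+ w ℕ.* suc Y               ≡⟨ cong (λ y → len ℕ.+ w ℕ.* suc y) (sym (ℕ.m∸n+n≡m w≤Y)) ⟩
        len ℕ.+ w ℕ.* suc (len ℕ.+ w)     ≡⟨ regroup len m ⟩
        (2 ℕ.* m ℕ.+ 2) ℕ.* (len ℕ.+ w)   ≤⟨ ℕ.*-monoʳ-≤ (2 ℕ.* m ℕ.+ 2) (ℕ.+-monoʳ-≤ len w≤len) ⟩
        (2 ℕ.* m ℕ.+ 2) ℕ.* (len ℕ.+ len) ≡⟨ regroup′ (2 ℕ.* m ℕ.+ 2) len ⟩
        2 ℕ.* (2 ℕ.* m ℕ.+ 2) ℕ.* len     ∎
        where
        regroup : ∀ l m → l ℕ.+ (2 ℕ.* m ℕ.+ 1) ℕ.* suc (l ℕ.+ (2 ℕ.* m ℕ.+ 1)) ≡ (2 ℕ.* m ℕ.+ 2) ℕ.* (l ℕ.+ (2 ℕ.* m ℕ.+ 1))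
        regroup = ℕ-Solver.solve-∀
        regroup′ : ∀ a l → a ℕ.* (l ℕ.+ l) ≡ 2 ℕ.* a ℕ.* l
        regroup′ = ℕ-Solver.solve-∀

  -- The block [k^L m, k^L (m+1)) with its right end stretched by (B/A)^t, denominators cleared; n
  -- belongs to the stretched blocks of several levels L, and all of them have to predict b n.
  Known : ℕ → ℕ → ℕ → Set
  Known t L₀ n = ∀ L → L₀ ≤ L → k ^ L ℕ.* m ≤ n → A ^ t ℕ.* n < k ^ L ℕ.* suc m ℕ.* B ^ t → b n ≡ φ L

  module Extend (t L₀ L₁ L₂ : ℕ) (balance : ∀ L → L₁ ≤ L → σ * φ L ≡ 0ℤ) (2q≤ : 2 ℕ.* q ≤ k ^ L₂)
                (n n₁ : ℕ) (low₁ : q ℕ.* n ≤ n₁) (high₁ : n₁ < q ℕ.* n ℕ.+ q) (flat : b n₁ ≡ b (q ℕ.* n))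
                (r : sumFin H (λ h → c h * b (N h ℕ.* n)) ≡ 0ℤ)
                (known₁ : Known t L₀ n₁) (known : ∀ h → Known t L₀ (N h ℕ.* n))
                (L : ℕ) (L₀≤L : L₀ ≤ L) (L₁≤L : L₁ ≤ L) (L₂≤L : L₂ ≤ L)
                (low : k ^ L ℕ.* m ≤ n₁) (high : A ^ suc t ℕ.* n₁ < k ^ L ℕ.* suc m ℕ.* B ^ suc t) where
    open ℕ.≤-Reasoning
    private
      X = k ^ L

    module Outside (out : X ℕ.* suc m ℕ.* B ^ t ≤ A ^ t ℕ.* n₁) where
      right : X ℕ.* suc m ≤ n₁
      right = ℕ.*-cancelˡ-≤ (A ^ t) {{ℕ.m^n≢0 A t}} (begin
        A ^ t ℕ.* (X ℕ.* suc m)    ≡⟨ ℕ.*-comm (A ^ t) (X ℕ.* suc m) ⟩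
        X ℕ.* suc m ℕ.* A ^ t      ≤⟨ ℕ.*-monoʳ-≤ (X ℕ.* suc m) (ℕ.^-monoˡ-≤ t (ℕ.<⇒≤ A<B)) ⟩
        X ℕ.* suc m ℕ.* B ^ t      ≤⟨ out ⟩
        A ^ t ℕ.* n₁               ∎)

      -- n₁ lies beyond the block and q n is less than q ≤ X/2 below it, so q n is still past the
      -- middle X (m + 1/2), as `above` demands.
      far : X ℕ.* (2 ℕ.* m ℕ.+ 1) ≤ 2 ℕ.* (q ℕ.* n)
      far = ℕ.+-cancelʳ-≤ X _ _ (begin
        X ℕ.* (2 ℕ.* m ℕ.+ 1) ℕ.+ X     ≡⟨ regroup X m ⟩
        2 ℕ.* (X ℕ.* suc m)             ≤⟨ ℕ.*-monoʳ-≤ 2 (ℕ.≤-trans right (ℕ.<⇒≤ high₁)) ⟩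
        2 ℕ.* (q ℕ.* n ℕ.+ q)           ≡⟨ ℕ.*-distribˡ-+ 2 (q ℕ.* n) q ⟩
        2 ℕ.* (q ℕ.* n) ℕ.+ 2 ℕ.* q     ≤⟨ ℕ.+-monoʳ-≤ (2 ℕ.* (q ℕ.* n)) (ℕ.≤-trans 2q≤ (ℕ.^-monoʳ-≤ k L₂≤L)) ⟩
        2 ℕ.* (q ℕ.* n) ℕ.+ X           ∎)
        where
        regroup : ∀ X m → X ℕ.* (2 ℕ.* m ℕ.+ 1) ℕ.+ X ≡ 2 ℕ.* (X ℕ.* suc m)
        regroup = ℕ-Solver.solve-∀

      inside : ∀ h → toℕ h < toℕ h₁ → A ^ t ℕ.* (N h ℕ.* n) < X ℕ.* suc m ℕ.* B ^ t
      inside h lt = ℕ.*-cancelʳ-< B _ _ (begin-strict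
        A ^ t ℕ.* (N h ℕ.* n) ℕ.* B      ≡⟨ regroup (A ^ t) (N h) n B ⟩
        N h ℕ.* B ℕ.* (A ^ t ℕ.* n)      ≤⟨ ℕ.*-monoˡ-≤ (A ^ t ℕ.* n) (close h lt) ⟩
        A ℕ.* q ℕ.* (A ^ t ℕ.* n)        ≡⟨ regroup′ A q (A ^ t) n ⟩
        A ^ suc t ℕ.* (q ℕ.* n)          ≤⟨ ℕ.*-monoʳ-≤ (A ^ suc t) low₁ ⟩
        A ^ suc t ℕ.* n₁                 <⟨ high ⟩
        X ℕ.* suc m ℕ.* (B ℕ.* B ^ t)    ≡⟨ regroup″ (X ℕ.* suc m) B (B ^ t) ⟩
        X ℕ.* suc m ℕ.* B ^ t ℕ.* B      ∎)
        where
        regroup : ∀ a N n B → a ℕ.* (N ℕ.* n) ℕ.* B ≡ N ℕ.* B ℕ.* (a ℕ.* n)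
        regroup = ℕ-Solver.solve-∀
        regroup′ : ∀ A q a n → A ℕ.* q ℕ.* (a ℕ.* n) ≡ A ℕ.* a ℕ.* (q ℕ.* n)
        regroup′ = ℕ-Solver.solve-∀
        regroup″ : ∀ x B y → x ℕ.* (B ℕ.* y) ≡ x ℕ.* y ℕ.* B
        regroup″ = ℕ-Solver.solve-∀

      value : b n₁ ≡ φ L
      value = trans flat (trans (restore (b (q ℕ.* n)) (φ L)) (trans (cong (_+ φ L)
        (*-cancel-0 c≢0 (trans (sym (trans (cong (c h₁ * (b (q ℕ.* n) - φ L) +_) (balance L L₁≤L))
                                           (ℤ.+-identityʳ (c h₁ * (b (q ℕ.* n) - φ L)))))
          (isolate (φ L) n r λ h lt → known h L L₀≤L (above X n far h) (inside h lt)))))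
        (ℤ.+-identityˡ (φ L))))
        where
        restore : ∀ x y → x ≡ (x - y) + y
        restore = solve-∀

    extended : b n₁ ≡ φ L
    extended with A ^ t ℕ.* n₁ ℕ.<? X ℕ.* suc m ℕ.* B ^ t
    ... | yes in′ = known₁ L L₀≤L low in′
    ... | no  out = Outside.value (ℕ.≮⇒≥ out)

  slow-block : AE (λ n → b n ≡ b (q ℕ.* (n ℕ./ q)))
  slow-block = AE-residues q λ r r<q → AE-map (reindex r r<q)
    (AE-∀< q λ s _ → AE-affine {λ n → b (suc n) ≡ b n} q s (1≤N h₁) slow)
    where
    reindex : ∀ r → r < q → ∀ n → (∀ s → s < q → b (suc (q ℕ.* n ℕ.+ s)) ≡ b (q ℕ.* n ℕ.+ s)) →
      b (n ℕ.* q ℕ.+ r) ≡ b (q ℕ.* ((n ℕ.* q ℕ.+ r) ℕ./ q))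
    reindex r r<q n flat = trans (cong (λ y → b (y ℕ.+ r)) (ℕ.*-comm n q))
      (trans (climb r (ℕ.<⇒≤ r<q)) (cong (λ y → b (q ℕ.* y)) (sym (proj₁ (divMod-unique q n r r<q)))))
      where
      climb : ∀ s → s ≤ q → b (q ℕ.* n ℕ.+ s) ≡ b (q ℕ.* n)
      climb zero    _   = cong b (ℕ.+-identityʳ (q ℕ.* n))
      climb (suc s) s<q = trans (cong b (ℕ.+-suc (q ℕ.* n) s)) (trans (flat s s<q) (climb s (ℕ.<⇒≤ s<q)))

  Related : ℕ → ℕ → ℕ → Set
  Related t L₀ n = sumFin H (λ h → c h * b (N h ℕ.* n)) ≡ 0ℤ × (∀ h → Known t L₀ (N h ℕ.* n))

  related : ∀ t L₀ → AE (Known t L₀) → AE (Related t L₀)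
  related t L₀ ae = AE-map₂ {λ n → sumFin H (λ h → c h * b (N h ℕ.* n)) ≡ 0ℤ} {λ n → ∀ h → Known t L₀ (N h ℕ.* n)}
    (λ n → _,_) rel (AE-∀Fin H (λ h → AE-scale {Known t L₀} (N h) (1≤N h) ae))

  known-suc : ∀ t L₀ L₁ L₂ → (∀ L → L₁ ≤ L → σ * φ L ≡ 0ℤ) → 2 ℕ.* q ≤ k ^ L₂ → ∀ n →
    b n ≡ b (q ℕ.* (n ℕ./ q)) → Known t L₀ n → Related t L₀ (n ℕ./ q) → Known (suc t) (L₀ ⊔ (L₁ ⊔ L₂)) n
  known-suc t L₀ L₁ L₂ balance 2q≤ n flat known₁ (r , known) L le low high =
    Extend.extended t L₀ L₁ L₂ balance 2q≤ (n ℕ./ q) n below over flat r known₁ known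
      L (ℕ.≤-trans (ℕ.m≤m⊔n L₀ (L₁ ⊔ L₂)) le)
      (ℕ.≤-trans (ℕ.≤-trans (ℕ.m≤m⊔n L₁ L₂) (ℕ.m≤n⊔m L₀ (L₁ ⊔ L₂))) le)
      (ℕ.≤-trans (ℕ.≤-trans (ℕ.m≤n⊔m L₁ L₂) (ℕ.m≤n⊔m L₀ (L₁ ⊔ L₂))) le) low high
    where
    below : q ℕ.* (n ℕ./ q) ≤ n
    below = subst (_≤ n) (ℕ.*-comm (n ℕ./ q) q) (ℕ.m/n*n≤m n q)
    over : n < q ℕ.* (n ℕ./ q) ℕ.+ q
    over = subst (n <_) (trans (ℕ.+-comm q (n ℕ./ q ℕ.* q)) (cong (ℕ._+ q) (ℕ.*-comm (n ℕ./ q) q))) (N<[1+N/q]*q n q)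

  known-extend : ∀ t L₀ → AE (Known t L₀) → ∃[ L₀ ] AE (Known (suc t) L₀)
  known-extend t L₀ ae =
    let (L₁ , balance) = balanced
        (L₂ , 2q≤)     = power-bound (2 ℕ.* q) 2≤k
    in L₀ ⊔ (L₁ ⊔ L₂) , join L₁ L₂ balance 2q≤
    where
    join : ∀ L₁ L₂ → (∀ L → L₁ ≤ L → σ * φ L ≡ 0ℤ) → 2 ℕ.* q ≤ k ^ L₂ → AE (Known (suc t) (L₀ ⊔ (L₁ ⊔ L₂)))
    join L₁ L₂ balance 2q≤ = AE-map₂ {λ n → b n ≡ b (q ℕ.* (n ℕ./ q)) × Known t L₀ n} {λ n → Related t L₀ (n ℕ./ q)}
      (λ n p → known-suc t L₀ L₁ L₂ balance 2q≤ n (proj₁ p) (proj₂ p))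
      (AE-map₂ {λ n → b n ≡ b (q ℕ.* (n ℕ./ q))} {Known t L₀} (λ n → _,_) slow-block ae)
      (AE-/ q {Related t L₀} (related t L₀ ae))

  known-all : ∀ t → ∃[ L₀ ] AE (Known t L₀)
  known-all zero = 0 , AE-pure λ n L _ low high → in-block L n low
    (subst₂ _<_ (ℕ.*-identityˡ n) (ℕ.*-identityʳ (k ^ L ℕ.* suc m)) high)
  known-all (suc t) = let (L₀ , ae) = known-all t in known-extend t L₀ ae

  module Constant (L₀ : ℕ) (ae : AE (λ n → ∀ L → L₀ ≤ L → k ^ L ℕ.* m ≤ n → n < 2 ℕ.* k ℕ.* (k ^ L ℕ.* suc m) → b n ≡ φ L)) where
    open ℕ.≤-Reasoning

    2k-step : ∀ L → k ^ suc L ℕ.* suc m < 2 ℕ.* k ℕ.* (k ^ L ℕ.* suc m)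
    2k-step L = begin-strict
      k ^ suc L ℕ.* suc m                 <⟨ ℕ.m<m+n (k ^ suc L ℕ.* suc m) (ℕ.*-mono-≤ (ℕ.m^n>0 k (suc L)) (s≤s z≤n)) ⟩
      k ^ suc L ℕ.* suc m ℕ.+ k ^ suc L ℕ.* suc m ≡⟨ double k (k ^ L) m ⟩
      2 ℕ.* k ℕ.* (k ^ L ℕ.* suc m)       ∎
      where
      double : ∀ k x m → k ℕ.* x ℕ.* suc m ℕ.+ k ℕ.* x ℕ.* suc m ≡ 2 ℕ.* k ℕ.* (x ℕ.* suc m)
      double = ℕ-Solver.solve-∀

    -- Stretched by 2k, the block of level L contains that of level L + 1, on which both levels
    -- predict b. This block is the fraction 1/(m+1) of the segment below its right end, so a point
    -- at which both predictions hold exists for all large L.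
    consecutive : ∃[ L₁ ] ∀ L → L₀ ⊔ L₁ ≤ L → φ (suc L) ≡ φ L
    consecutive with AE-meets ae (suc m)
    ... | N₀ , meets with power-bound N₀ 2≤k
    ... | L₁ , big = L₁ , λ L le →
      let X = k ^ suc L
          L₀≤L = ℕ.≤-trans (ℕ.m≤m⊔n L₀ L₁) le
          (n , low , high , eq) = meets (X ℕ.* m) X
            (begin
              N₀               ≤⟨ big ⟩
              k ^ L₁           ≤⟨ ℕ.^-monoʳ-≤ k (ℕ.m≤n⇒m≤1+n (ℕ.≤-trans (ℕ.m≤n⊔m L₀ L₁) le)) ⟩
              X                ≤⟨ ℕ.m≤m+n X (X ℕ.* m) ⟩
              X ℕ.+ X ℕ.* m    ∎)
            (ℕ.m^n>0 k (suc L))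
            (ℕ.≤-reflexive (trans (sym (ℕ.*-suc X m)) (ℕ.*-comm X (suc m))))
          high′ = subst (n <_) (sym (ℕ.*-suc X m)) high
      in trans (sym (eq (suc L) (ℕ.m≤n⇒m≤1+n L₀≤L) low
                  (ℕ.<-≤-trans high′ (ℕ.m≤n*m (X ℕ.* suc m) (2 ℕ.* k) {{ℕ.m*n≢0 2 k}}))))
               (eq L L₀≤L (ℕ.≤-trans (ℕ.*-monoˡ-≤ m (ℕ.m≤n*m (k ^ L) k)) low) (ℕ.<-trans high′ (2k-step L)))

    constant-from : ∀ L₂ → L₀ ≤ L₂ → (∀ L → L₂ ≤ L → φ (suc L) ≡ φ L) → AE (λ n → b n ≡ φ L₂)
    constant-from L₂ L₀≤L₂ eqs = AE-unshift {λ n → b n ≡ φ L₂} (k ^ L₂ ℕ.* m) (AE-map settle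
        (AE-shift {λ n → ∀ L → L₀ ≤ L → k ^ L ℕ.* m ≤ n → n < 2 ℕ.* k ℕ.* (k ^ L ℕ.* suc m) → b n ≡ φ L} (k ^ L₂ ℕ.* m) ae))
      where
      same : ∀ s → φ (s ℕ.+ L₂) ≡ φ L₂
      same zero    = refl
      same (suc s) = trans (eqs (s ℕ.+ L₂) (ℕ.m≤n+m L₂ s)) (same s)
      settle : ∀ n → (∀ L → L₀ ≤ L → k ^ L ℕ.* m ≤ n ℕ.+ k ^ L₂ ℕ.* m →
          n ℕ.+ k ^ L₂ ℕ.* m < 2 ℕ.* k ℕ.* (k ^ L ℕ.* suc m) → b (n ℕ.+ k ^ L₂ ℕ.* m) ≡ φ L) →
        b (n ℕ.+ k ^ L₂ ℕ.* m) ≡ φ L₂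
      settle n eq = let (L , L₂≤L , low , high) = floor-log 2≤k 1≤m L₂ (n ℕ.+ k ^ L₂ ℕ.* m) (ℕ.m≤n+m (k ^ L₂ ℕ.* m) n) in
        trans (eq L (ℕ.≤-trans L₀≤L₂ L₂≤L) low
                (ℕ.<-trans high (ℕ.≤-<-trans (ℕ.*-monoʳ-≤ (k ^ suc L) (ℕ.n≤1+n m)) (2k-step L))))
              (trans (cong φ (sym (ℕ.m∸n+n≡m L₂≤L))) (same (L ℕ.∸ L₂)))

    constant : ∃[ C ] AE (λ n → b n ≡ C)
    constant = let (L₁ , eqs) = consecutive in φ (L₀ ⊔ L₁) , constant-from (L₀ ⊔ L₁) (ℕ.m≤m⊔n L₀ L₁) eqs

  asymptotically-constant : ∃[ C ] AE (λ n → b n ≡ C)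
  asymptotically-constant with power-gap (2 ℕ.* k) A<B
  ... | t , gap with known-all t
  ... | L₀ , ae = Constant.constant L₀ (AE-map widen ae)
    where
    open ℕ.≤-Reasoning
    widen : ∀ n → Known t L₀ n → ∀ L → L₀ ≤ L → k ^ L ℕ.* m ≤ n → n < 2 ℕ.* k ℕ.* (k ^ L ℕ.* suc m) → b n ≡ φ L
    widen n known L L₀≤L low high = known L L₀≤L low (begin-strict
      A ^ t ℕ.* n                                    <⟨ ℕ.*-monoʳ-< (A ^ t) {{ℕ.m^n≢0 A t}} high ⟩
      A ^ t ℕ.* (2 ℕ.* k ℕ.* (k ^ L ℕ.* suc m))      ≡⟨ regroup (A ^ t) (2 ℕ.* k) (k ^ L ℕ.* suc m) ⟩
      k ^ L ℕ.* suc m ℕ.* (2 ℕ.* k ℕ.* A ^ t)        ≤⟨ ℕ.*-monoʳ-≤ (k ^ L ℕ.* suc m) gap ⟩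
      k ^ L ℕ.* suc m ℕ.* B ^ t                      ∎)
      where
      regroup : ∀ a x y → a ℕ.* (x ℕ.* y) ≡ y ℕ.* (x ℕ.* a)
      regroup = ℕ-Solver.solve-∀

-- Relations between dilates, and constancy of slow sequences

module _ {k ℓ : ℕ} (2≤k : 2 ≤ k) (2≤ℓ : 2 ≤ ℓ) (k⊥ℓ : Coprime k ℓ) where

  -- Closure of the system absorbs k^β exactly and leaves combinations of V_j(ℓ^α n), which the
  -- generators cover. The rank is thus bounded independently of both exponents.
  smooth-span : (S : System k ℓ) → ∀ {b} → Exact.InSpan (System.dim S) (System.seqs S) b → ∀ {N} → Smooth k ℓ N →
    Asym.InSpan (Finite.dim (System.finitary S)) (Finite.gens (System.finitary S)) (λ n → b (N ℕ.* n))
  smooth-span S {b} mem {N} (β , α , refl) =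
    Asym.span-trans {h = λ j n → V j (ℓ ^ α ℕ.* n ℕ.+ 0)} {b = λ n → b (k ^ β ℕ.* ℓ ^ α ℕ.* n)}
      (λ j → Finite.spans finitary j α 0 (ℕ.m^n>0 ℓ {{ℕ.>-nonZero (ℕ.<⇒≤ 2≤ℓ)}} α))
      (Exact⇒Asym {b = λ n → b (k ^ β ℕ.* ℓ ^ α ℕ.* n)}
        (Exact.span-resp {b = λ n → b (k ^ β ℕ.* (ℓ ^ α ℕ.* n ℕ.+ 0) ℕ.+ 0)} (λ n → cong b (regroup (k ^ β) (ℓ ^ α) n))
          (exact-∘ {b = λ n → b (k ^ β ℕ.* n ℕ.+ 0)} (λ n → ℓ ^ α ℕ.* n ℕ.+ 0)
            (Exact.span-trans {h = λ j n → V j (k ^ β ℕ.* n ℕ.+ 0)} {b = λ n → b (k ^ β ℕ.* n ℕ.+ 0)}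
              (λ j → closed-^ 2≤k 2≤ℓ S β j 0 (ℕ.m^n>0 k {{ℕ.>-nonZero (ℕ.<⇒≤ 2≤k)}} β))
              (exact-∘ {b = b} (λ n → k ^ β ℕ.* n ℕ.+ 0) mem)))))
    where
    open System S renaming (seqs to V)
    regroup : ∀ x y n → x ℕ.* y ℕ.* n ≡ x ℕ.* (y ℕ.* n ℕ.+ 0) ℕ.+ 0
    regroup = ℕ-Solver.solve-∀

  module Ratios (D m A B : ℕ) (1≤A : 1 ≤ A) (A<B : A < B)
                (close : (2 ℕ.* m ℕ.+ 1) ℕ.* B ^ D ≤ (2 ℕ.* m ℕ.+ 2) ℕ.* A ^ D) where
    open ℕ.≤-Reasoning
    private instance
      A≢0 : NonZero A
      A≢0 = ℕ.>-nonZero 1≤A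
    1≤B : 1 ≤ B
    1≤B = ℕ.≤-trans 1≤A (ℕ.<⇒≤ A<B)

    -- A geometric progression from A^D to B^D. Its ratio B/A is the gap between consecutive dilates
    -- by which the interval grows, while its total spread (B/A)^D has to remain within the
    -- tolerance of `narrow`.
    mixed : ℕ → ℕ
    mixed h = A ^ (D ℕ.∸ h) ℕ.* B ^ h

    mixed-≥1 : ∀ h → 1 ≤ mixed h
    mixed-≥1 h = ℕ.*-mono-≤ (ℕ.m^n>0 A (D ℕ.∸ h)) (ℕ.m^n>0 B {{ℕ.>-nonZero 1≤B}} h)

    mixed-suc : ∀ h → h < D → mixed h ℕ.* B ≡ A ℕ.* mixed (suc h)
    mixed-suc h h<D = trans (cong (λ e → A ^ e ℕ.* B ^ h ℕ.* B) (ℕ.+-∸-assoc 1 {D} {suc h} h<D))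
                            (regroup A (A ^ (D ℕ.∸ suc h)) (B ^ h) B)
      where
      regroup : ∀ A x y B → A ℕ.* x ℕ.* y ℕ.* B ≡ A ℕ.* (x ℕ.* (B ℕ.* y))
      regroup = ℕ-Solver.solve-∀

    mixed-≤suc : ∀ h → h < D → mixed h ≤ mixed (suc h)
    mixed-≤suc h h<D = ℕ.*-cancelˡ-≤ A (begin
      A ℕ.* mixed h         ≤⟨ ℕ.*-monoˡ-≤ (mixed h) (ℕ.<⇒≤ A<B) ⟩
      B ℕ.* mixed h         ≡⟨ ℕ.*-comm B (mixed h) ⟩
      mixed h ℕ.* B         ≡⟨ mixed-suc h h<D ⟩
      A ℕ.* mixed (suc h)   ∎)

    mixed-mono : ∀ s h → s ℕ.+ h ≤ D → mixed h ≤ mixed (s ℕ.+ h)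
    mixed-mono zero    h _  = ℕ.≤-refl
    mixed-mono (suc s) h le = ℕ.≤-trans (mixed-mono s h (ℕ.<⇒≤ le)) (mixed-≤suc (s ℕ.+ h) le)

    mixed-narrow : ∀ h h′ → h ≤ D → h′ ≤ D → (2 ℕ.* m ℕ.+ 1) ℕ.* mixed h ≤ (2 ℕ.* m ℕ.+ 2) ℕ.* mixed h′
    mixed-narrow h h′ h≤D h′≤D = begin
      (2 ℕ.* m ℕ.+ 1) ℕ.* mixed h    ≤⟨ ℕ.*-monoʳ-≤ (2 ℕ.* m ℕ.+ 1) top ⟩
      (2 ℕ.* m ℕ.+ 1) ℕ.* B ^ D      ≤⟨ close ⟩
      (2 ℕ.* m ℕ.+ 2) ℕ.* A ^ D      ≤⟨ ℕ.*-monoʳ-≤ (2 ℕ.* m ℕ.+ 2) bottom ⟩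
      (2 ℕ.* m ℕ.+ 2) ℕ.* mixed h′   ∎
      where
      top : mixed h ≤ B ^ D
      top = subst (mixed h ≤_) (trans (cong mixed (ℕ.m∸n+n≡m h≤D))
              (trans (cong (λ e → A ^ e ℕ.* B ^ D) (ℕ.n∸n≡0 D)) (ℕ.*-identityˡ (B ^ D))))
              (mixed-mono (D ℕ.∸ h) h (ℕ.≤-reflexive (ℕ.m∸n+n≡m h≤D)))
      bottom : A ^ D ≤ mixed h′
      bottom = subst₂ _≤_ (ℕ.*-identityʳ (A ^ D)) (cong mixed (ℕ.+-identityʳ h′))
        (mixed-mono h′ 0 (ℕ.≤-trans (ℕ.≤-reflexive (ℕ.+-identityʳ h′)) h′≤D))

    mixed-close : ∀ h h′ → h < h′ → h′ ≤ D → mixed h ℕ.* B ≤ A ℕ.* mixed h′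
    mixed-close h h′ h<h′ h′≤D = begin
      mixed h ℕ.* B          ≡⟨ mixed-suc h (ℕ.<-≤-trans h<h′ h′≤D) ⟩
      A ℕ.* mixed (suc h)    ≤⟨ ℕ.*-monoʳ-≤ A (subst (λ y → mixed (suc h) ≤ mixed y) (ℕ.m∸n+n≡m h<h′)
                                  (mixed-mono (h′ ℕ.∸ suc h) (suc h) (ℕ.≤-trans (ℕ.≤-reflexive (ℕ.m∸n+n≡m h<h′)) h′≤D))) ⟩
      A ℕ.* mixed h′         ∎

  module _ (S : System k ℓ) {b : Seq} (mem : Exact.InSpan (System.dim S) (System.seqs S) b)
           (slow : AE (λ n → b (suc n) ≡ b n)) where
    open System S using (finitary)

    constant-from-block : ∀ m → 1 ≤ m → (∀ L s → s < k ^ L → b (k ^ L ℕ.* m ℕ.+ s) ≡ b (k ^ L ℕ.* m)) → ∃[ C ] AE (λ n → b n ≡ C)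
    constant-from-block m 1≤m block =
      let D = Finite.dim finitary
          (A , B , 1≤A , A<B , close , smA , smB) = close-ratio 2≤k 2≤ℓ k⊥ℓ (ℕ.pred ((2 ℕ.* m ℕ.+ 2) ℕ.* suc D)) (pred≥1 D)
      in go D refl A B 1≤A A<B (power-ratio-≤ m D A<B (subst (λ y → ℕ.pred ((2 ℕ.* m ℕ.+ 2) ℕ.* suc D) ℕ.* B ≤ y ℕ.* A) (suc-pred D) close)) smA smB
      where
      pred≥1 : ∀ D → 1 ≤ ℕ.pred ((2 ℕ.* m ℕ.+ 2) ℕ.* suc D)
      pred≥1 D = ℕ.pred-mono-≤ (ℕ.≤-trans (ℕ.m≤n+m 2 (2 ℕ.* m)) (ℕ.m≤m*n (2 ℕ.* m ℕ.+ 2) (suc D)))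
      suc-pred : ∀ D → suc (ℕ.pred ((2 ℕ.* m ℕ.+ 2) ℕ.* suc D)) ≡ (2 ℕ.* m ℕ.+ 2) ℕ.* suc D
      suc-pred D = ℕ.suc-pred ((2 ℕ.* m ℕ.+ 2) ℕ.* suc D)
        {{ℕ.>-nonZero (ℕ.≤-trans (pred≥1 D) ℕ.pred[n]≤n)}}
      go : ∀ D → D ≡ Finite.dim finitary → ∀ A B (1≤A : 1 ≤ A) (A<B : A < B)
        (close : (2 ℕ.* m ℕ.+ 1) ℕ.* B ^ D ≤ (2 ℕ.* m ℕ.+ 2) ℕ.* A ^ D) →
        Smooth k ℓ A → Smooth k ℓ B → ∃[ C ] AE (λ n → b n ≡ C)
      go D D≡ A B 1≤A A<B close smA smB = relate (suc D) (λ h → ℕ.≤-pred (toℕ<n h)) (cong suc (trans D≡ (sym (ℕ.+-identityʳ _))))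
        where
        open Ratios D m A B 1≤A A<B close
        smooth-mixed : ∀ h → Smooth k ℓ (mixed h)
        smooth-mixed h = smooth-* {k} {ℓ} {A ^ (D ℕ.∸ h)} {B ^ h} (smooth-^ (D ℕ.∸ h) smA) (smooth-^ h smB)
        relate : ∀ H → (∀ (h : Fin H) → toℕ h ≤ D) → H ≡ suc (1 ℕ.* Finite.dim finitary) → ∃[ C ] AE (λ n → b n ≡ C)
        relate H bound H≡ =
          let (c , nz , rel) = Asym.span-dependent (Finite.dim finitary) (Finite.gens finitary) 1 H≡
                (λ _ h n → b (mixed (toℕ h) ℕ.* n)) (λ _ h → smooth-span S {b} mem {mixed (toℕ h)} (smooth-mixed (toℕ h)))
              (h₁ , c≢0 , beyond) = highest c nz
          in Spread.asymptotically-constant 2≤k b m 1≤m block slow 1≤A A<B H c (λ h → mixed (toℕ h)) h₁ c≢0 beyond (rel zero)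
               (λ h → mixed-≥1 (toℕ h)) (λ h → mixed-narrow (toℕ h₁) (toℕ h) (bound h₁) (bound h))
               (λ h lt → mixed-close (toℕ h) (toℕ h₁) lt (bound h₁))

  slow⇒constant : ∀ {b} → b ∈𝒞[ k , ℓ ] → Vanishes (diff 1 b) → ∃[ C ] AE (λ n → b n ≡ C)
  slow⇒constant {b} (S , mem) v =
    let (S′ , mem′)       = 𝒞-diff (ℕ.<⇒≤ 2≤k) (ℕ.<⇒≤ 2≤ℓ) {b} (S , mem)
        (m , 1≤m , zeros) = vanishing-block 2≤k S′ {diff 1 b} mem′ v
    in constant-from-block S {b} mem (AE-map (λ n e → step n e) v) m 1≤m (climb m zeros)
    where
    step : ∀ n → diff 1 b n ≡ 0ℤ → b (suc n) ≡ b n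
    step n e = trans (restore (b (suc n)) (b n)) (trans (cong (_+ b n) (trans (cong (λ y → b y - b n) (sym (ℕ.+-comm n 1))) e)) (ℤ.+-identityˡ (b n)))
      where
      restore : ∀ x y → x ≡ (x - y) + y
      restore = solve-∀
    climb : ∀ m → (∀ L s → s < k ^ L → diff 1 b (k ^ L ℕ.* m ℕ.+ s) ≡ 0ℤ) →
      ∀ L s → s < k ^ L → b (k ^ L ℕ.* m ℕ.+ s) ≡ b (k ^ L ℕ.* m)
    climb m zeros L zero    _  = cong b (ℕ.+-identityʳ (k ^ L ℕ.* m))
    climb m zeros L (suc s) s< = trans (cong b (ℕ.+-suc (k ^ L ℕ.* m) s))
      (trans (step (k ^ L ℕ.* m ℕ.+ s) (zeros L s (ℕ.<⇒≤ s<))) (climb m zeros L s (ℕ.<⇒≤ s<)))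

-- Regularity and recurrences

module _ {k ℓ : ℕ} (2≤k : 2 ≤ k) (2≤ℓ : 2 ≤ ℓ) (k⊥ℓ : Coprime k ℓ) where
  private
    1≤k = ℕ.<⇒≤ 2≤k
    1≤ℓ = ℕ.<⇒≤ 2≤ℓ

  -- The N-th difference of `binomial N` is 1, so C times it removes a constant N-th difference C.
  -- The factor `1ℤ` gives the shape to which `diff^-lin` applies.
  remainder : ℕ → Seq → ℤ → Seq
  remainder N u C n = 1ℤ * u n + (- C) * binomial N n

  remainder-𝒞 : ∀ N {u} → u ∈𝒞[ k , ℓ ] → ∀ C → remainder N u C ∈𝒞[ k , ℓ ]
  remainder-𝒞 N {u} mem C = 𝒞-+ {b = λ n → 1ℤ * u n} {λ n → (- C) * binomial N n} (𝒞-* 1ℤ {u} mem)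
    (𝒞-* (- C) {binomial N} (𝒞-killed 1≤k 1≤ℓ (suc N) {binomial N} (killed-binomial N)))

  remainder-vanishes : ∀ N {u} C → AE (λ n → diff^ 1 N u n ≡ C) → Vanishes (diff^ 1 N (remainder N u C))
  remainder-vanishes N {u} C = AE-map {λ n → diff^ 1 N u n ≡ C} λ n e → trans (diff^-lin 1 N 1ℤ (- C) u (binomial N) n)
    (trans (cong₂ (λ x y → 1ℤ * x + (- C) * y) e (diff^-binomial N n)) (cancel C))
    where
    cancel : ∀ c → 1ℤ * c + (- c) * 1ℤ ≡ 0ℤ
    cancel = solve-∀

  Approximation : ℕ → ℕ → Seq → Set
  Approximation q N u = Σ Seq λ u′ → Killed q N u′ × AE (λ n → u n ≡ u′ n)

  add-remainder : ∀ N {u} C → Approximation 1 N (remainder N u C) → Approximation 1 (suc N) u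
  add-remainder N {u} C (w , killed , u≃w) = (λ n → w n + C * binomial N n) ,
      killed-+ 1 (suc N) {w} {λ n → C * binomial N n} (killed-suc 1 N {w} killed) (killed-* 1 (suc N) C {binomial N} (killed-binomial N)) ,
      AE-map {λ n → remainder N u C n ≡ w n} (λ n e → trans (restore (u n) C (binomial N n)) (cong (_+ C * binomial N n) e)) u≃w
    where
    restore : ∀ x c y → x ≡ (1ℤ * x + (- c) * y) + c * y
    restore = solve-∀

  derivative-constant : ∀ N {u} → u ∈𝒞[ k , ℓ ] → Vanishes (diff^ 1 (suc N) u) → ∃[ C ] AE (λ n → diff^ 1 N u n ≡ C)
  derivative-constant N {u} mem v = slow⇒constant 2≤k 2≤ℓ k⊥ℓ {diff^ 1 N u} (𝒞-diff^ 1≤k 1≤ℓ N {u} mem)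
    (vanishes-resp {diff^ 1 (suc N) u} {diff 1 (diff^ 1 N u)} (diff^-outer 1 N u) v)

  approximation-suc : ∀ N → (∀ u → u ∈𝒞[ k , ℓ ] → Vanishes (diff^ 1 N u) → Approximation 1 N u) →
    ∀ u → u ∈𝒞[ k , ℓ ] → (∃[ C ] AE (λ n → diff^ 1 N u n ≡ C)) → Approximation 1 (suc N) u
  approximation-suc N approximate u mem (C , const) =
    add-remainder N {u} C (approximate (remainder N u C) (remainder-𝒞 N {u} mem C) (remainder-vanishes N {u} C const))

  asymptotically-polynomial : ∀ N u → u ∈𝒞[ k , ℓ ] → Vanishes (diff^ 1 N u) → Approximation 1 N u
  asymptotically-polynomial zero    u mem v = (λ _ → 0ℤ) , (λ _ → refl) , v
  asymptotically-polynomial (suc N) u mem v =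
    approximation-suc N (asymptotically-polynomial N) u mem (derivative-constant N {u} mem v)

  -- On each residue class mod q the operator E^q - 1 acts as E - 1, so the polynomials found on the
  -- classes glue to one sequence killed by (E^q - 1)^N.
  interleave : ∀ q → 1 ≤ q → ∀ N {a} → (∀ r → Approximation 1 N (λ n → a (q ℕ.* n ℕ.+ r))) → Approximation q N a
  interleave q 1≤q N {a} class = a′ , killed , AE-residues q λ r r<q →
      AE-map (λ n e → trans (cong (λ y → a (y ℕ.+ r)) (ℕ.*-comm n q)) (trans e (sym (on-class r r<q n)))) (proj₂ (proj₂ (class r)))
    where
    instance
      q≢0 : NonZero q
      q≢0 = ℕ.>-nonZero 1≤q
    a′ : Seq
    a′ n = proj₁ (class (n ℕ.% q)) (n ℕ./ q)
    on-class : ∀ r → r < q → ∀ n → a′ (n ℕ.* q ℕ.+ r) ≡ proj₁ (class r) n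
    on-class r r<q n = cong₂ (λ s m → proj₁ (class s) m) (proj₂ (divMod-unique q n r r<q)) (proj₁ (divMod-unique q n r r<q))
    killed : Killed q N a′
    killed n = subst (λ y → diff^ q N a′ y ≡ 0ℤ) (sym n≡)
      (trans (cong (λ p → diff^ p N a′ (q ℕ.* y ℕ.+ r)) (sym (ℕ.*-identityʳ q)))
      (trans (diff^-affine 1 N q r a′ y)
      (trans (diff^-resp 1 N (λ n → trans (cong (λ y → a′ (y ℕ.+ r)) (ℕ.*-comm q n)) (on-class r (ℕ.m%n<n _ q) n)) y)
             (proj₁ (proj₂ (class r)) y))))
      where
      r = n ℕ.% q
      y = n ℕ./ q
      n≡ : n ≡ q ℕ.* y ℕ.+ r
      n≡ = trans (ℕ.m≡m%n+[m/n]*n n q) (trans (ℕ.+-comm r (y ℕ.* q)) (cong (ℕ._+ r) (ℕ.*-comm y q)))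

  asymptotically-quasipolynomial : ∀ q → 1 ≤ q → ∀ N {a} → a ∈𝒞[ k , ℓ ] → Vanishes (diff^ q N a) → Approximation q N a
  asymptotically-quasipolynomial q 1≤q N {a} mem v = interleave q 1≤q N {a} λ r →
    asymptotically-polynomial N (λ n → a (q ℕ.* n ℕ.+ r)) (𝒞-affine 1≤k 1≤ℓ q r 1≤q {a} mem)
      (AE-map (λ n e → trans (sym (diff^-affine 1 N q r a n)) (trans (cong (λ p → diff^ p N a (q ℕ.* n ℕ.+ r)) (ℕ.*-identityʳ q)) e))
              (AE-affine {λ n → diff^ q N a n ≡ 0ℤ} q r 1≤q v))

-- By induction the q-difference of X is zero, so X has period q exactly; a null set contains no
-- full residue class, hence every class has a zero of X.
killed-vanishes⇒0 : ∀ q N → 1 ≤ q → ∀ {X} → Killed q N X → Vanishes X → X ≐ λ _ → 0ℤ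
killed-vanishes⇒0 q zero    1≤q killed v = killed
killed-vanishes⇒0 q (suc N) 1≤q {X} killed v n =
  let (t , _ , zero-at) = AE-exists (AE-affine {λ n → X n ≡ 0ℤ} q n 1≤q v) 0
  in trans (sym (periodic t)) zero-at
  where
  difference : diff q X ≐ λ _ → 0ℤ
  difference = killed-vanishes⇒0 q N 1≤q killed (AE-map₂ {λ n → X (n ℕ.+ q) ≡ 0ℤ} {λ n → X n ≡ 0ℤ}
    (λ n → cong₂ _-_) (AE-shift {λ n → X n ≡ 0ℤ} q v) v)
  periodic : ∀ t → X (q ℕ.* t ℕ.+ n) ≡ X n
  periodic zero    = cong (λ y → X (y ℕ.+ n)) (ℕ.*-zeroʳ q)
  periodic (suc t) = trans (cong X (regroup q t n)) (trans (restore (X (y ℕ.+ q)) (X y))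
    (trans (cong (_+ X y) (difference y)) (trans (ℤ.+-identityˡ (X y)) (periodic t))))
    where
    y = q ℕ.* t ℕ.+ n
    regroup : ∀ q t n → q ℕ.* suc t ℕ.+ n ≡ q ℕ.* t ℕ.+ n ℕ.+ q
    regroup = ℕ-Solver.solve-∀
    restore : ∀ x z → x ≡ (x - z) + z
    restore = solve-∀

-- Linear recurrences

module Lags = Span {Seq × ℕ} (λ P → ∀ x → P x) (λ p → p) (λ f p q x → f x (p x) (q x))

-- Taking pairs (X, n) as points makes the coefficients independent of the sequence; `diff^-monic`
-- needs this, since its induction passes from X to `diff q X`. The lag j + 1 is counted down from n
-- + D as in `SatisfiesLinearRecurrence`.
lags : ∀ D → Fin D → Seq × ℕ → ℤ
lags D j (X , n) = X ((n ℕ.+ D) ℕ.∸ suc (toℕ j))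

lags-mem : ∀ D i → i < D → Lags.InSpan D (lags D) (λ { (X , n) → X (n ℕ.+ i) })
lags-mem D i i<D = Lags.span-resp {b = lags D (fromℕ< D-i<D)} (λ { (X , n) → cong X (sym (index n)) })
  (Lags.span-mem (lags D) (fromℕ< D-i<D))
  where
  D-i<D : D ℕ.∸ suc i < D
  D-i<D = ℕ.∸-monoʳ-< (s≤s z≤n) i<D
  index : ∀ n → (n ℕ.+ D) ℕ.∸ suc (toℕ (fromℕ< D-i<D)) ≡ n ℕ.+ i
  index n = trans (cong (λ y → (n ℕ.+ D) ℕ.∸ suc y) (toℕ-fromℕ< D-i<D))
    (trans (ℕ.+-∸-assoc n D-i<D) (cong (n ℕ.+_) (trans (cong (D ℕ.∸_) (sym (ℕ.+-∸-assoc 1 i<D))) (ℕ.m∸[m∸n]≡n (ℕ.<⇒≤ i<D)))))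

-- (E^q - 1)^N is a monic polynomial in E of degree Nq.
diff^-monic : ∀ q N → 1 ≤ q → Lags.InSpan (N ℕ.* q) (lags (N ℕ.* q)) (λ { (X , n) → X (n ℕ.+ N ℕ.* q) - diff^ q N X n })
diff^-monic q zero    1≤q = Lags.span-resp {g = lags 0} {b = λ _ → 0ℤ}
  (λ { (X , n) → trans (cong (λ y → X y - X n) (ℕ.+-identityʳ n)) (ℤ.+-inverseʳ (X n)) }) (Lags.span-0 (lags 0))
diff^-monic q (suc N) 1≤q with diff^-monic q N 1≤q
... | s , eq = Lags.span-resp {b = λ { (X , n) → X (n ℕ.+ D) + Lags.lin D s (λ { j (X , n) → lags D j (diff q X , n) }) (X , n) }}
    (λ { (X , n) → trans (cong (λ y → X y - diff^ q N (diff q X) n) (assoc n q D))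
        (trans (split (X (n ℕ.+ D ℕ.+ q)) (X (n ℕ.+ D)) (diff^ q N (diff q X) n)) (cong (X (n ℕ.+ D) +_) (eq (diff q X , n)))) })
    (Lags.span-+ {b = λ { (X , n) → X (n ℕ.+ D) }} {b′ = Lags.lin D s (λ { j (X , n) → lags D j (diff q X , n) })}
      (lags-mem (q ℕ.+ D) D (ℕ.+-monoˡ-≤ D 1≤q))
      (Lags.span-lin D s {λ { j (X , n) → lags D j (diff q X , n) }} lagged))
  where
  D = N ℕ.* q
  assoc : ∀ n q y → n ℕ.+ (q ℕ.+ y) ≡ n ℕ.+ y ℕ.+ q
  assoc = ℕ-Solver.solve-∀
  split : ∀ x y z → x - z ≡ y + ((x - y) - z)
  split = solve-∀
  lagged : ∀ j → Lags.InSpan (q ℕ.+ D) (lags (q ℕ.+ D)) (λ { (X , n) → lags D j (diff q X , n) })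
  lagged j = Lags.span-resp {b = λ { (X , n) → X (n ℕ.+ (y ℕ.+ q)) + (- 1ℤ) * X (n ℕ.+ y) }}
    (λ { (X , n) → trans (cong (λ z → X (z ℕ.+ q) - X z) (ℕ.+-∸-assoc n (toℕ<n j)))
        (trans (negate (X (n ℕ.+ y ℕ.+ q)) (X (n ℕ.+ y))) (cong (λ z → X z + (- 1ℤ) * X (n ℕ.+ y)) (ℕ.+-assoc n y q))) })
    (Lags.span-+ {b = λ { (X , n) → X (n ℕ.+ (y ℕ.+ q)) }} {b′ = λ { (X , n) → (- 1ℤ) * X (n ℕ.+ y) }}
      (lags-mem (q ℕ.+ D) (y ℕ.+ q) (subst (y ℕ.+ q <_) (ℕ.+-comm D q) (ℕ.+-monoˡ-< q y<D)))
      (Lags.span-* {b = λ { (X , n) → X (n ℕ.+ y) }} (- 1ℤ) (lags-mem (q ℕ.+ D) y (ℕ.<-≤-trans y<D (ℕ.m≤n+m D q)))))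
    where
    y = D ℕ.∸ suc (toℕ j)
    y<D : y < D
    y<D = ℕ.∸-monoʳ-< (s≤s z≤n) (toℕ<n j)
    negate : ∀ x z → x - z ≡ x + (- 1ℤ) * z
    negate = solve-∀

killed⇒recurrence : ∀ q N → 1 ≤ q → ∀ {X} → Killed q N X → SatisfiesLinearRecurrence X
killed⇒recurrence q N 1≤q {X} killed with diff^-monic q N 1≤q
... | t , eq = N ℕ.* q , t , λ n → trans (sym (trans (cong (λ y → X (n ℕ.+ N ℕ.* q) - y) (killed n)) (ℤ.+-identityʳ (X (n ℕ.+ N ℕ.* q)))))
                                         (eq (X , n))

kernelSeq-InModule : ∀ k a i r → r < k ^ i → InModule k a (kernelSeq k a i r)
kernelSeq-InModule k a i r r< = 1 , (λ _ → 1ℤ) , (λ _ → i) , (λ _ → r) , (λ _ → r<) ,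
  λ n → sym (trans (ℤ.+-identityʳ _) (ℤ.*-identityˡ (a (k ^ i ℕ.* n ℕ.+ r))))

InModule-digit : ∀ k {a b} r → r < k → InModule k a b → InModule k a (λ n → b (k ℕ.* n ℕ.+ r))
InModule-digit k {a} r r<k (m , c , i , s , s< , eq) = m , c , (λ j → suc (i j)) , (λ j → k ^ i j ℕ.* r ℕ.+ s j) , bound ,
  λ n → trans (eq (k ℕ.* n ℕ.+ r)) (sum-cong m
    {λ j → c j * kernelSeq k a (i j) (s j) (k ℕ.* n ℕ.+ r)} {λ j → c j * kernelSeq k a (suc (i j)) (k ^ i j ℕ.* r ℕ.+ s j) n}
    λ j → cong (λ y → c j * a y) (regroup k (k ^ i j) n r (s j)))
  where
  open ℕ.≤-Reasoning
  regroup : ∀ k x n r s → x ℕ.* (k ℕ.* n ℕ.+ r) ℕ.+ s ≡ k ℕ.* x ℕ.* n ℕ.+ (x ℕ.* r ℕ.+ s)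
  regroup = ℕ-Solver.solve-∀
  bound : ∀ j → k ^ i j ℕ.* r ℕ.+ s j < k ^ suc (i j)
  bound j = begin-strict
    k ^ i j ℕ.* r ℕ.+ s j     <⟨ ℕ.+-monoʳ-< (k ^ i j ℕ.* r) (s< j) ⟩
    k ^ i j ℕ.* r ℕ.+ k ^ i j ≡⟨ trans (ℕ.+-comm (k ^ i j ℕ.* r) (k ^ i j)) (sym (ℕ.*-suc (k ^ i j) r)) ⟩
    k ^ i j ℕ.* suc r         ≤⟨ ℕ.*-monoʳ-≤ (k ^ i j) r<k ⟩
    k ^ i j ℕ.* k             ≡⟨ ℕ.*-comm (k ^ i j) k ⟩
    k ^ suc (i j)             ∎

finite-resp : ∀ {ℓ b b′} → b′ ≐ b → Finite₁ ℓ b → Finite₁ ℓ b′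
finite-resp {ℓ} {b} {b′} eq (finite e G spans) = finite e G λ j l x x< →
  Asym.span-resp {b = λ n → b (ℓ ^ l ℕ.* n ℕ.+ x)} {λ n → b′ (ℓ ^ l ℕ.* n ℕ.+ x)} (λ n → eq (ℓ ^ l ℕ.* n ℕ.+ x)) (spans j l x x<)

-- Asymptotic ℓ-regularity is given for a alone, whereas a system requires finite rank of all its
-- members. These are combinations of a(k^i n + r), and finite rank survives the affine
-- substitution.
module-finite : ∀ {k ℓ} → 1 ≤ k → 1 ≤ ℓ → ∀ {a} → Finite₁ ℓ a → ∀ {b m} (c : Fin m → ℤ) (i r : Fin m → ℕ) →
  b ≐ lincomb m c (λ j → kernelSeq k a (i j) (r j)) → Finite₁ ℓ b
module-finite {k} {ℓ} 1≤k 1≤ℓ {a} fin {b} {m} c i r eq =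
  finite-resp {ℓ} {lincomb m c (λ j → kernelSeq k a (i j) (r j))} {b} eq
    (finite-lin ℓ c {λ j → kernelSeq k a (i j) (r j)} (finite-family ℓ (λ j → kernelSeq k a (i j) (r j)) λ j →
      finite-affine ℓ 1≤ℓ (k ^ i j) (r j) (ℕ.m^n>0 k {{ℕ.>-nonZero 1≤k}} (i j)) {a} fin))

regular-∈𝒞 : ∀ {k ℓ} → 1 ≤ k → 1 ≤ ℓ → ∀ {a} → IsRegular k a → IsAsymptoticallyRegular ℓ a → a ∈𝒞[ k , ℓ ]
regular-∈𝒞 {k} {ℓ} 1≤k 1≤ℓ {a} (d , g , g∈ , spanned) (d′ , g′ , asym) =
  system d g (λ j r r<k → spanned (λ n → g j (k ℕ.* n ℕ.+ r)) (InModule-digit k {a} {g j} r r<k (g∈ j)))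
         (finite-family ℓ g generator-finite) ,
  spanned a (1 , (λ _ → 1ℤ) , (λ _ → 0) , (λ _ → 0) , (λ _ → s≤s z≤n) , λ n →
    sym (trans (ℤ.+-identityʳ _) (trans (ℤ.*-identityˡ _) (cong a (trans (ℕ.+-identityʳ (1 ℕ.* n)) (ℕ.*-identityˡ n))))))
  where
  a-finite : Finite₁ ℓ a
  a-finite = finite d′ g′ λ _ e x x< →
    let (t , b≃) = asym (kernelSeq ℓ a e x) (kernelSeq-InModule ℓ a e x x<) in t , ≃ₐ⇒AE b≃
  generator-finite : ∀ j → Finite₁ ℓ (g j)
  generator-finite j = let (_ , c , i , r , _ , eq) = g∈ j in module-finite {k} {ℓ} 1≤k 1≤ℓ {a} a-finite {g j} c i r eq

-- Coefficients are transported from M_k(a) to M_k(a′): sequences killed by (E^q - 1)^N that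
-- agree almost everywhere are equal.
regular-transport : ∀ {k} → 1 ≤ k → ∀ q N → 1 ≤ q → ∀ {a a′} → Killed q N a′ → AE (λ n → a n ≡ a′ n) →
  IsRegular k a → IsRegular k a′
regular-transport {k} 1≤k q N 1≤q {a} {a′} killed a≃a′ (d , g , g∈ , spanned) = d , g′ , g′∈ , spanned′
  where
  combination : ∀ m → (Fin m → ℤ) → (Fin m → ℕ) → (Fin m → ℕ) → Seq → Seq
  combination m c i r x = lincomb m c (λ j → kernelSeq k x (i j) (r j))
  combination-killed : ∀ m c i r → Killed q N (combination m c i r a′)
  combination-killed m c i r = killed-lin q N m c {λ j → kernelSeq k a′ (i j) (r j)} λ j → killed-affine q N (k ^ i j) (r j) killed
  combination-≃ : ∀ m c i r → AE (λ n → combination m c i r a n ≡ combination m c i r a′ n)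
  combination-≃ m c i r = AE-map (λ n eqs → sum-cong m
      {λ j → c j * kernelSeq k a (i j) (r j) n} {λ j → c j * kernelSeq k a′ (i j) (r j) n} λ j → cong (c j *_) (eqs j))
    (AE-∀Fin m λ j → AE-affine {λ n → a n ≡ a′ n} (k ^ i j) (r j) (ℕ.m^n>0 k {{ℕ.>-nonZero 1≤k}} (i j)) a≃a′)
  g′ : Fin d → Seq
  g′ j = let (m , c , i , r , _) = g∈ j in combination m c i r a′
  g′∈ : ∀ j → InModule k a′ (g′ j)
  g′∈ j = let (m , c , i , r , r< , _) = g∈ j in m , c , i , r , r< , λ n → refl
  g′-killed : ∀ j → Killed q N (g′ j)
  g′-killed j = let (m , c , i , r , _) = g∈ j in combination-killed m c i r
  g≃g′ : ∀ j → AE (λ n → g j n ≡ g′ j n)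
  g≃g′ j = let (m , c , i , r , _ , eq) = g∈ j in AE-map (λ n → trans (eq n)) (combination-≃ m c i r)
  spanned′ : ∀ b → InModule k a′ b → ∃[ t ] (b ≐ lincomb d t g′)
  spanned′ b (m , c , i , r , r< , eq) =
    let (t , eq′) = spanned (combination m c i r a) (m , c , i , r , r< , λ n → refl)
    in t , λ n → trans (eq n) (equal t eq′ n)
    where
    equal : ∀ t → combination m c i r a ≐ lincomb d t g → combination m c i r a′ ≐ lincomb d t g′
    equal t eq′ n = trans (restore (combination m c i r a′ n) (lincomb d t g′ n))
        (trans (cong (_+ lincomb d t g′ n) (killed-vanishes⇒0 q N 1≤q difference-killed difference-vanishes n))
               (ℤ.+-identityˡ (lincomb d t g′ n)))
      where
      restore : ∀ x y → x ≡ (x + (- 1ℤ) * y) + y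
      restore = solve-∀
      cancel : ∀ x → x + (- 1ℤ) * x ≡ 0ℤ
      cancel = solve-∀
      difference-killed : Killed q N (λ n → combination m c i r a′ n + (- 1ℤ) * lincomb d t g′ n)
      difference-killed = killed-+ q N {combination m c i r a′} {λ n → (- 1ℤ) * lincomb d t g′ n} (combination-killed m c i r)
        (killed-* q N (- 1ℤ) {lincomb d t g′} (killed-lin q N d t g′-killed))
      difference-vanishes : Vanishes (λ n → combination m c i r a′ n + (- 1ℤ) * lincomb d t g′ n)
      difference-vanishes = AE-map₂ {λ n → combination m c i r a n ≡ combination m c i r a′ n} {λ n → ∀ j → g j n ≡ g′ j n}
        (λ n e es → trans (cong (λ x → x + (- 1ℤ) * lincomb d t g′ n)
            (trans (sym e) (trans (eq′ n) (sum-cong d {λ j → t j * g j n} {λ j → t j * g′ j n} λ j → cong (t j *_) (es j)))))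
          (cancel (lincomb d t g′ n)))
        (combination-≃ m c i r) (AE-∀Fin d g≃g′)

theorem7p2 : (k ℓ : ℕ) → 2 ≤ k → 2 ≤ ℓ → Coprime k ℓ →
    (a : Seq) → IsRegular k a → IsAsymptoticallyRegular ℓ a →
    ∃[ a′ ] (a ≃ₐ a′ × IsRegular k a′ × SatisfiesLinearRecurrence a′)
theorem7p2 k ℓ 2≤k 2≤ℓ k⊥ℓ a regular asymptotic =
  let (S , mem)            = regular-∈𝒞 (ℕ.<⇒≤ 2≤k) (ℕ.<⇒≤ 2≤ℓ) {a} regular asymptotic
      (q , 1≤q , N , v)    = eventually-unipotent 2≤k 2≤ℓ k⊥ℓ S
      (a′ , killed , a≃a′) = asymptotically-quasipolynomial 2≤k 2≤ℓ k⊥ℓ q 1≤q N {a} (S , mem) (vanishes-span q N {b = a} mem v)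
  in a′ , AE⇒≃ₐ a≃a′ , regular-transport (ℕ.<⇒≤ 2≤k) q N 1≤q killed a≃a′ regular , killed⇒recurrence q N 1≤q killed
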